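{- Let $0<1/n\ll\varepsilon\ll\gamma\ll 1/r$ where $n,r\in\mathbb N$, $r\ge 3$ and $r$ divides $n$, and let $T\in\mathcal T_r\setminus\{C_3\}$. Suppose that $G$ is a digraph on $n$ vertices with $\delta^0(G)\ge (1-1/r-\varepsilon)n$, and that $G$ does not contain any $\gamma$-independent set of size at least $n/r$. Then $G$ contains a perfect $T$-packing.
   Context: Hierarchy notation: $0<a\ll b\ll c$ means the constants are chosen from right to left, each sufficiently small in terms of those to its right. A digraph has no loops and at most one edge in each direction between any two vertices; $\delta^0(G)$ is the minimum of the minimum out- and indegree. $\mathcal T_r$ is the set of tournaments on $r$ vertices; $C_3$ is the cyclic triangle. A perfect $T$-packing is a collection of vertex-disjoint (not necessarily induced) copies of $T$ covering all vertices. For $G$ on $n$ vertices, $S\subseteq V(G)$ is $\gamma$-independent if $G[S]$ has at most $\gamma n^2$ edges. -}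

module Defs where

open import Data.Bool using (Bool; true; false; _∧_; if_then_else_)
open import Data.Nat using (ℕ; zero; suc; _+_; _*_; _≤_; NonZero)
open import Data.Fin using (Fin; zero; suc)
import Data.Sum
open import Data.Product using (Σ; _×_; _,_; uncurry)
open import Data.Integer using (+_)
open import Data.Rational using (ℚ; _/_)
open import Relation.Binary.PropositionalEquality using (_≡_; _≢_)
open import Relation.Nullary using (¬_)
open import Function.Bundles using (_↔_; Inverse)
open import Function.Definitions using (Injective; Bijective)

ℕ→ℚ : ℕ → ℚ
ℕ→ℚ k = (+ k) / 1

sumFin : (n : ℕ) → (Fin n → ℕ) → ℕ
sumFin zero f = 0
sumFin (suc n) f = f zero + sumFin n (λ i → f (suc i))

b2n : Bool → ℕ
b2n true = 1
b2n false = 0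

-- a digraph on vertex set Fin n: adjacency (edge u → v iff adj u v ≡ true);
-- no loops. At most one edge in each direction is automatic.
record Digraph (n : ℕ) : Set where
  field
    adj     : Fin n → Fin n → Bool
    noLoops : ∀ v → adj v v ≡ false
open Digraph public

outdeg : {n : ℕ} → Digraph n → Fin n → ℕ
outdeg {n} G v = sumFin n (λ u → b2n (adj G v u))

indeg : {n : ℕ} → Digraph n → Fin n → ℕ
indeg {n} G v = sumFin n (λ u → b2n (adj G u v))

MinSemiDegAtLeast : {n : ℕ} → Digraph n → ℚ → Set
MinSemiDegAtLeast G d =
  ∀ v → (d Data.Rational.≤ ℕ→ℚ (outdeg G v)) × (d Data.Rational.≤ ℕ→ℚ (indeg G v))

Subset : ℕ → Set
Subset n = Fin n → Bool

size : {n : ℕ} → Subset n → ℕ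
size {n} S = sumFin n (λ v → b2n (S v))

edgesIn : {n : ℕ} → Digraph n → Subset n → ℕ
edgesIn {n} G S = sumFin n (λ u → sumFin n (λ v → b2n (S u ∧ (S v ∧ adj G u v))))

GammaIndependent : {n : ℕ} → Digraph n → ℚ → Subset n → Set
GammaIndependent {n} G γ S =
  ℕ→ℚ (edgesIn G S) Data.Rational.≤ (γ Data.Rational.* ℕ→ℚ (n * n))

record Tournament (r : ℕ) : Set where
  field
    digraph : Digraph r
    oneEdge : ∀ i j → i ≢ j → (adj digraph i j ≡ true × adj digraph j i ≡ false)
                            Data.Sum.⊎ (adj digraph i j ≡ false × adj digraph j i ≡ true)
open Tournament public

C3adj : Fin 3 → Fin 3 → Bool
C3adj zero (suc zero) = true
C3adj (suc zero) (suc (suc zero)) = true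
C3adj (suc (suc zero)) zero = true
C3adj _ _ = false

IsoToC3 : {r : ℕ} → Digraph r → Set
IsoToC3 {r} D = Σ (Fin r ↔ Fin 3) λ f →
  ∀ i j → adj D i j ≡ C3adj (Inverse.to f i) (Inverse.to f j)

IsCopy : {r n : ℕ} → Digraph r → Digraph n → (Fin r → Fin n) → Set
IsCopy T G φ = Injective _≡_ _≡_ φ × (∀ i j → adj T i j ≡ true → adj G (φ i) (φ j) ≡ true)

PerfectPacking : {r n : ℕ} → Digraph r → Digraph n → Set
PerfectPacking {r} {n} T G =
  Σ ℕ λ k → Σ (Fin k → Fin r → Fin n) λ φ →
    (∀ c → IsCopy T G (φ c)) × Bijective _≡_ _≡_ (uncurry φ)

{-# OPTIONS --safe #-}

-- Absorption. For any two vertices x and y there are many sets S of r - 1 vertices such that both S ∪ {x}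
-- and S ∪ {y} span T: embed all vertices of T but two greedily; if the last two candidate sets W₁ and W₂,
-- both of size about n/r, span few edges, then W₁ ∖ W₂ is large (W₁ ∩ W₂ is sparse) and nearly complete, and
-- its vertices have nearly the same non-neighbours, which suffices unless T = C₃. Hence every r-tuple has
-- many absorbers, and a derandomised choice yields a small disjoint family with linearly many for each r-tuple.
-- The rest is covered, up to fewer vertices than the family can absorb, by copies chosen one at a time. A
-- quadratic potential assigns weights to the vertices, and as long as the uncovered set U has the right
-- degrees and no independent set of size about |U|/r, some copy has at most the fair share r/|U| of the weight
-- of U; choosing it keeps all tracked sets, and hence these properties of U, in proportion.

module Submission where

-- The fair share must be met exactly. The potential is a sum of squared shortfalls over 4 n^2
-- tracked sets. For a copy of at most fair weight the linear terms of its change cancel, so it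
-- grows by O(n^4) per copy and O(n^5) in all, and at any moment only O(n) tracked sets lag by a
-- linear amount. A constant factor lost in the weight would accumulate instead. Greedy choice alone
-- does lose one, since the degrees in the uncovered set may be too small by a small fraction of its
-- size; the margin left by independent sets wins it back.
--
-- The case C3 is set apart because an exchange needs a source, a sink, or four vertices i, a, b, c
-- with i → a, i → b, a → b, a → c, b → c. Every tournament on at least five vertices contains the
-- third pattern, every one on four has one of the three, and among those on three only C3 has none.
--
-- All estimates are over ℕ. The error ε becomes an additive e, with r times each non-neighbourhood
-- at most n + e, and γ becomes 1 / g. Strict inequalities and rounding are carried by successors.

open import Defs
open import Data.Bool using (Bool; true; false; _∧_; _∨_; not)
import Data.Bool.Properties as Bool
open import Data.Empty using (⊥; ⊥-elim)
import Data.Fin as Fin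
open import Data.Fin using (Fin; zero; suc; toℕ; fromℕ; inject₁)
open import Data.Fin.Permutation as Perm using (Permutation′; _⟨$⟩ʳ_; _⟨$⟩ˡ_; inverseˡ; inverseʳ; transpose; _∘ₚ_)
open import Data.Fin.Properties using (toℕ≤pred[n]; toℕ-fromℕ; toℕ-injective; ↑ˡ-injective)
import Data.List as List
open import Data.List using (List; []; _∷_; _++_; length)
open import Data.List.Membership.Propositional.Properties using (∈-lookup)
open import Data.List.Relation.Unary.All as All using (All; []; _∷_)
open import Data.List.Relation.Unary.All.Properties using (++⁺)
open import Data.Nat using (ℕ; zero; suc; _+_; _*_; _∸_; _^_; _≤_; _≤?_; z≤n; s≤s; NonZero)
open import Data.Nat.DivMod using (m≡m%n+[m/n]*n; m%n<n)
open import Data.Nat.Divisibility using (_∣_; divides; ∣m+n∣m⇒∣n; n∣m*n; ∣m∣n⇒∣m+n)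
open import Data.Nat.Properties
open import Data.Nat.Tactic.RingSolver using (solve-∀)
open import Data.Product using (Σ; ∃; _×_; _,_; proj₁; proj₂)
open import Data.Sum using (_⊎_; inj₁; inj₂; [_,_]′)
open import Data.Unit using (⊤; tt)
import Data.Vec as Vec
open import Data.Vec using (Vec; []; _∷_; lookup; tabulate)
open import Data.Vec.Properties using (lookup∘tabulate)
open import Data.Vec.Relation.Unary.All using ([]; _∷_)
open import Data.Vec.Relation.Unary.AllPairs using ([]; _∷_)
open import Data.Vec.Relation.Unary.Unique.Propositional using (Unique)
open import Data.Vec.Relation.Unary.Unique.Propositional.Properties using (lookup-injective)
open import Function.Bundles using (mk↔ₛ′)
open import Function.Definitions using (Injective)
open import Relation.Nullary using (¬_; Dec; yes; no; does)
open import Relation.Binary.PropositionalEquality using (_≡_; _≢_; refl; sym; trans; cong; cong₂; subst; subst₂)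

-- Finite sums and subsets

-- A linear (or polynomial) inequality follows from L ≤ R by a ring identity with slack s.
lin : ∀ {L R a b} s → L ≤ R → a + R + s ≡ b + L → a ≤ b
lin {L} {R} {a} {b} s h eq =
  +-cancelʳ-≤ R a b (≤-trans (≤-trans (m≤m+n (a + R) s) (≤-reflexive eq)) (+-monoʳ-≤ b h))

mul : ∀ k {a b} → a ≤ b → k * a ≤ k * b
mul k h = *-monoʳ-≤ k h

infixr 5 _⊕_
_⊕_ : ∀ {a b c d} → a ≤ b → c ≤ d → a + c ≤ b + d
_⊕_ = +-mono-≤

cancel-mul : ∀ k a b → suc k * a ≤ suc k * b → a ≤ b
cancel-mul k a b = *-cancelˡ-≤ (suc k)

cancel-pos : ∀ k {a b} → 1 ≤ k → k * a ≤ k * b → a ≤ b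
cancel-pos (suc k) _ = cancel-mul k _ _

true≢false : ∀ {b} → b ≡ true → b ≡ false → ⊥
true≢false refl ()

not-true : ∀ {b} → not b ≡ true → b ≡ false
not-true {false} _ = refl

∧-true : ∀ {a b} → a ∧ b ≡ true → a ≡ true × b ≡ true
∧-true {true} {true} _ = refl , refl

∧-intro : ∀ {a b} → a ≡ true → b ≡ true → a ∧ b ≡ true
∧-intro refl refl = refl

bool-case : ∀ b → b ≡ true ⊎ b ≡ false
bool-case true = inj₁ refl
bool-case false = inj₂ refl

does-yes : {A : Set} (d : Dec A) → does d ≡ true → A
does-yes (yes a) _ = a

yes-does : {A : Set} (d : Dec A) → A → does d ≡ true
yes-does (yes _) _ = refl
yes-does (no ¬a) a = ⊥-elim (¬a a)

does-no : {A : Set} (d : Dec A) → does d ≡ false → ¬ A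
does-no (no ¬a) _ = ¬a

no-does : {A : Set} (d : Dec A) → ¬ A → does d ≡ false
no-does (yes a) ¬a = ⊥-elim (¬a a)
no-does (no _) _ = refl

sum-cong : ∀ n {f g : Fin n → ℕ} → (∀ i → f i ≡ g i) → sumFin n f ≡ sumFin n g
sum-cong zero h = refl
sum-cong (suc n) h = cong₂ _+_ (h zero) (sum-cong n (λ i → h (suc i)))

sum-mono : ∀ n {f g : Fin n → ℕ} → (∀ i → f i ≤ g i) → sumFin n f ≤ sumFin n g
sum-mono zero h = z≤n
sum-mono (suc n) h = h zero ⊕ sum-mono n (λ i → h (suc i))

sum-+ : ∀ n (f g : Fin n → ℕ) → sumFin n (λ i → f i + g i) ≡ sumFin n f + sumFin n g
sum-+ zero f g = refl
sum-+ (suc n) f g rewrite sum-+ n (λ i → f (suc i)) (λ i → g (suc i)) =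
  interchange (f zero) (g zero) _ _
  where
  interchange : ∀ a b c d → a + b + (c + d) ≡ a + c + (b + d)
  interchange = solve-∀

sum-* : ∀ n k (f : Fin n → ℕ) → sumFin n (λ i → k * f i) ≡ k * sumFin n f
sum-* zero k f = sym (*-zeroʳ k)
sum-* (suc n) k f rewrite sum-* n k (λ i → f (suc i)) = sym (*-distribˡ-+ k (f zero) _)

sum-const : ∀ n k → sumFin n (λ _ → k) ≡ n * k
sum-const zero k = refl
sum-const (suc n) k = cong (k +_) (sum-const n k)

sum-swap : ∀ m n (f : Fin m → Fin n → ℕ) →
  sumFin m (λ i → sumFin n (f i)) ≡ sumFin n (λ j → sumFin m (λ i → f i j))
sum-swap zero n f = sym (trans (sum-const n 0) (*-zeroʳ n))
sum-swap (suc m) n f =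
  trans (cong (sumFin n (f zero) +_) (sum-swap m n (λ i → f (suc i))))
        (sym (sum-+ n (f zero) (λ j → sumFin m (λ i → f (suc i) j))))

sum-term : ∀ n (f : Fin n → ℕ) i → f i ≤ sumFin n f
sum-term (suc n) f zero = m≤m+n (f zero) _
sum-term (suc n) f (suc i) = ≤-trans (sum-term n (λ i → f (suc i)) i) (m≤n+m _ (f zero))

sum-pos : ∀ n (f : Fin n → ℕ) → 1 ≤ sumFin n f → ∃ λ i → 1 ≤ f i
sum-pos (suc n) f h with f zero in eq
... | suc k = zero , subst (1 ≤_) (sym eq) (s≤s z≤n)
... | zero with sum-pos n (λ i → f (suc i)) h
... | i , p = suc i , p

sum-avg : ∀ n (f g : Fin (suc n) → ℕ) → sumFin (suc n) f ≤ sumFin (suc n) g → ∃ λ i → f i ≤ g i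
sum-avg n f g h with f zero ≤? g zero
... | yes p = zero , p
sum-avg zero f g h | no ¬p =
  ⊥-elim (¬p (≤-trans (≤-reflexive (sym (+-identityʳ _))) (≤-trans h (≤-reflexive (+-identityʳ _)))))
sum-avg (suc n) f g h | no ¬p
  with sum-avg n (λ i → f (suc i)) (λ i → g (suc i))
         (+-cancelˡ-≤ (g zero) _ _ (≤-trans (+-monoˡ-≤ _ (<⇒≤ (≰⇒> ¬p))) h))
... | i , p = suc i , p

sumVec : ∀ {n} k → (Vec (Fin n) k → ℕ) → ℕ
sumVec zero f = f []
sumVec {n} (suc k) f = sumFin n (λ v → sumVec k (λ vs → f (v ∷ vs)))

sumVec-mono : ∀ {n} k {f g : Vec (Fin n) k → ℕ} → (∀ v → f v ≤ g v) → sumVec k f ≤ sumVec k g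
sumVec-mono zero h = h []
sumVec-mono {n} (suc k) h = sum-mono n (λ v → sumVec-mono k (λ vs → h (v ∷ vs)))

sumVec-cong : ∀ {n} k {f g : Vec (Fin n) k → ℕ} → (∀ v → f v ≡ g v) → sumVec k f ≡ sumVec k g
sumVec-cong zero h = h []
sumVec-cong {n} (suc k) h = sum-cong n (λ v → sumVec-cong k (λ vs → h (v ∷ vs)))

sumVec-+ : ∀ {n} k (f g : Vec (Fin n) k → ℕ) → sumVec k (λ v → f v + g v) ≡ sumVec k f + sumVec k g
sumVec-+ zero f g = refl
sumVec-+ {n} (suc k) f g =
  trans (sum-cong n (λ v → sumVec-+ k (λ vs → f (v ∷ vs)) (λ vs → g (v ∷ vs)))) (sum-+ n _ _)

sumVec-* : ∀ {n} k c (f : Vec (Fin n) k → ℕ) → sumVec k (λ v → c * f v) ≡ c * sumVec k f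
sumVec-* zero c f = refl
sumVec-* {n} (suc k) c f = trans (sum-cong n (λ v → sumVec-* k c (λ vs → f (v ∷ vs)))) (sum-* n c _)

sumVec-const : ∀ {n} k c → sumVec {n} k (λ _ → c) ≡ n ^ k * c
sumVec-const zero c = sym (+-identityʳ c)
sumVec-const {n} (suc k) c =
  trans (sum-cong n (λ _ → sumVec-const {n} k c)) (trans (sum-const n (n ^ k * c)) (sym (*-assoc n (n ^ k) c)))

sumVec-swap : ∀ {n} j k (f : Vec (Fin n) j → Vec (Fin n) k → ℕ) →
  sumVec j (λ u → sumVec k (f u)) ≡ sumVec k (λ v → sumVec j (λ u → f u v))
sumVec-swap zero k f = refl
sumVec-swap {n} (suc j) k f = trans (sum-cong n (λ u → sumVec-swap j k (λ us → f (u ∷ us)))) (outer k _)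
  where
  outer : ∀ k (h : Fin n → Vec (Fin n) k → ℕ) →
    sumFin n (λ u → sumVec k (h u)) ≡ sumVec k (λ v → sumFin n (λ u → h u v))
  outer zero h = refl
  outer (suc k) h = trans (sum-swap n n (λ u v → sumVec k (λ vs → h u (v ∷ vs))))
    (sum-cong n (λ v → outer k (λ u vs → h u (v ∷ vs))))

sumVec-term : ∀ {n} k (f : Vec (Fin n) k → ℕ) v → f v ≤ sumVec k f
sumVec-term zero f [] = ≤-refl
sumVec-term {n} (suc k) f (v ∷ vs) =
  ≤-trans (sumVec-term k (λ vs → f (v ∷ vs)) vs) (sum-term n (λ v → sumVec k (λ vs → f (v ∷ vs))) v)

sumVec-avg : ∀ {n} k (f g : Vec (Fin (suc n)) k → ℕ) → sumVec k f ≤ sumVec k g → ∃ λ v → f v ≤ g v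
sumVec-avg zero f g h = [] , h
sumVec-avg {n} (suc k) f g h
  with sum-avg n (λ v → sumVec k (λ vs → f (v ∷ vs))) (λ v → sumVec k (λ vs → g (v ∷ vs))) h
... | v , p with sumVec-avg k (λ vs → f (v ∷ vs)) (λ vs → g (v ∷ vs)) p
... | vs , q = v ∷ vs , q

sumVec-pos : ∀ {n} k (f : Vec (Fin n) k → ℕ) → 1 ≤ sumVec k f → ∃ λ v → 1 ≤ f v
sumVec-pos zero f h = [] , h
sumVec-pos {n} (suc k) f h with sum-pos n _ h
... | v , p with sumVec-pos k (λ vs → f (v ∷ vs)) p
... | vs , q = v ∷ vs , q

infixr 7 _∩_
_∩_ : ∀ {n} → Subset n → Subset n → Subset n
(S ∩ X) v = S v ∧ X v

∁ : ∀ {n} → Subset n → Subset n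
∁ S v = not (S v)

full : ∀ {n} → Subset n
full _ = true

infix 4 _⊆_
_⊆_ : ∀ {n} → Subset n → Subset n → Set
S ⊆ X = ∀ v → S v ≡ true → X v ≡ true

b2n-mono : ∀ {a b} → (a ≡ true → b ≡ true) → b2n a ≤ b2n b
b2n-mono {false} h = z≤n
b2n-mono {true} h rewrite h refl = ≤-refl

b2n≤1 : ∀ b → b2n b ≤ 1
b2n≤1 true = ≤-refl
b2n≤1 false = z≤n

size-mono : ∀ {n} {S X : Subset n} → S ⊆ X → size S ≤ size X
size-mono {n} h = sum-mono n (λ v → b2n-mono (h v))

size-full : ∀ n → size {n} full ≡ n
size-full n = trans (sum-const n 1) (*-identityʳ n)

size≤n : ∀ {n} (S : Subset n) → size S ≤ n
size≤n {n} S = ≤-trans (size-mono {S = S} {full} (λ _ _ → refl)) (≤-reflexive (size-full n))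

size-split : ∀ {n} (S X : Subset n) → size S ≡ size (S ∩ X) + size (S ∩ ∁ X)
size-split {n} S X = trans (sum-cong n (λ v → pt (S v) (X v))) (sum-+ n _ _)
  where
  pt : ∀ a b → b2n a ≡ b2n (a ∧ b) + b2n (a ∧ not b)
  pt true true = refl
  pt true false = refl
  pt false b = refl

size-∁ : ∀ {n} (X : Subset n) → n ≡ size X + size (∁ X)
size-∁ {n} X = trans (sym (size-full n)) (size-split full X)

size-cover : ∀ {n} {S X Y : Subset n} →
  (∀ v → S v ≡ true → X v ≡ true ⊎ Y v ≡ true) → size S ≤ size X + size Y
size-cover {n} {S} {X} {Y} h = ≤-trans (sum-mono n pt) (≤-reflexive (sum-+ n _ _))
  where
  pt : ∀ v → b2n (S v) ≤ b2n (X v) + b2n (Y v)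
  pt v with S v in eq
  ... | false = z≤n
  ... | true with h v eq
  ... | inj₁ p rewrite p = s≤s z≤n
  ... | inj₂ p rewrite p = m≤n+m 1 (b2n (X v))

member : ∀ {n} (S : Subset n) → 1 ≤ size S → ∃ λ v → S v ≡ true
member {n} S h with sum-pos n _ h
... | v , p with S v in eq
... | true = v , eq

size-pos : ∀ {n} {S : Subset n} v → S v ≡ true → 1 ≤ size S
size-pos {n} {S} v p = ≤-trans (≤-reflexive (cong b2n (sym p))) (sum-term n _ v)

markov : ∀ {n} (S : Subset n) (f : Fin n → ℕ) c →
  (∀ v → S v ≡ true → c ≤ f v) → c * size S ≤ sumFin n f
markov {n} S f c h = ≤-trans (≤-reflexive (sym (sum-* n c _))) (sum-mono n pt)
  where
  pt : ∀ v → c * b2n (S v) ≤ f v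
  pt v with S v in eq
  ... | true = ≤-trans (≤-reflexive (*-identityʳ c)) (h v eq)
  ... | false = ≤-trans (≤-reflexive (*-zeroʳ c)) z≤n

take-subset : ∀ {n} (S : Subset n) c → c ≤ size S → Σ (Subset n) λ X → X ⊆ S × size X ≡ c
take-subset {zero} S c h = S , (λ _ p → p) , sym (n≤0⇒n≡0 h)
take-subset {suc n} S c h with S zero in eq
take-subset {suc n} S zero h | _ = (λ _ → false) , (λ _ ()) , trans (sum-const n 0) (*-zeroʳ n)
take-subset {suc n} S (suc c) h | true with take-subset (λ v → S (suc v)) c (≤-pred h)
... | X , sub , sz = (λ { zero → true ; (suc v) → X v }) ,
  (λ { zero _ → eq ; (suc v) p → sub v p }) , cong suc sz
take-subset {suc n} S (suc c) h | false with take-subset (λ v → S (suc v)) (suc c) h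
... | X , sub , sz = (λ { zero → false ; (suc v) → X v }) ,
  (λ { zero () ; (suc v) p → sub v p }) , sz

-- Labelled tournaments and nested density

-- E true u v is the edge u → v and E false u v the edge v → u.
record BiGraph (n : ℕ) : Set where
  field
    E : Bool → Fin n → Fin n → Bool
    E-sym : ∀ b u v → E b u v ≡ E (not b) v u
    E-irr : ∀ b v → E b v v ≡ false
open BiGraph public

op : ∀ {n} → BiGraph n → BiGraph n
op G = record
  { E = λ b → E G (not b)
  ; E-sym = λ b → E-sym G (not b)
  ; E-irr = λ b → E-irr G (not b) }

-- Degrees enter through non-neighbourhoods: each has about n / r vertices, the vertex itself
-- included, and fixing a vertex then costs any candidate set an additive amount.
A : ∀ {n} → BiGraph n → Bool → Fin n → Subset n
A G b u v = not (E G b u v)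

edges : ∀ {n} → BiGraph n → Bool → Subset n → ℕ
edges {n} G b S = sumFin n (λ u → sumFin n (λ v → b2n (S u ∧ (S v ∧ E G b u v))))

Labelling : ℕ → Set
Labelling k = Fin k → Fin k → Bool

Anti : ∀ {k} → Labelling k → Set
Anti t = ∀ i j → i ≢ j → t j i ≡ not (t i j)

tail : ∀ {k} → Labelling (suc k) → Labelling k
tail t i j = t (suc i) (suc j)

tail-anti : ∀ {k} {t : Labelling (suc k)} → Anti t → Anti (tail t)
tail-anti h i j i≢j = h (suc i) (suc j) (λ { refl → i≢j refl })

-- For `Anti t` the two orders of a pair state the same condition, since `E false` is the reversed
-- edge. Nothing is asked of the opposite edge, so copies are not induced.
Copy : ∀ {n k} → BiGraph n → Labelling k → Vec (Fin n) k → Set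
Copy G t vs = ∀ i j → i ≢ j → E G (t i j) (lookup vs i) (lookup vs j) ≡ true

copy-cons : ∀ {n k} (G : BiGraph n) {t : Labelling (suc k)} → Anti t → ∀ {v vs} →
  (∀ d → E G (t zero (suc d)) v (lookup vs d) ≡ true) → Copy G (tail t) vs → Copy G t (v ∷ vs)
copy-cons G at h c zero zero i≢j = ⊥-elim (i≢j refl)
copy-cons G at h c zero (suc j) i≢j = h j
copy-cons G {t} at {v} {vs} h c (suc i) zero i≢j rewrite at zero (suc i) (λ ()) =
  trans (sym (E-sym G (t zero (suc i)) v (lookup vs i))) (h i)
copy-cons G at h c (suc i) (suc j) i≢j = c i j (λ { refl → i≢j refl })

Many : ∀ {n} → ℕ → (Fin n → Set) → Set
Many {n} K P = Σ (Subset n) λ S → n ≤ K * size S × (∀ v → S v ≡ true → P v)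

-- A tree with at least n / K children at every node, rather than a number of tuples: later choices
-- may depend on earlier ones, trees concatenate, and a small set of vertices can be deleted level
-- by level.
ManyT : ∀ {n} → ℕ → ∀ k → (Vec (Fin n) k → Set) → Set
ManyT K zero P = P []
ManyT K (suc k) P = Many K (λ v → ManyT K k (λ vs → P (v ∷ vs)))

ManyT-map : ∀ {n K} k {P Q : Vec (Fin n) k → Set} → (∀ vs → P vs → Q vs) → ManyT K k P → ManyT K k Q
ManyT-map zero f m = f [] m
ManyT-map (suc k) f (S , s , h) = S , s , λ v p → ManyT-map k (λ vs → f (v ∷ vs)) (h v p)

all-or : ∀ n {P : Fin n → Set} {X : Set} → (∀ v → P v ⊎ X) → (∀ v → P v) ⊎ X
all-or zero h = inj₁ (λ ())
all-or (suc n) h with h zero | all-or n (λ v → h (suc v))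
... | inj₂ x | _ = inj₂ x
... | inj₁ _ | inj₂ x = inj₂ x
... | inj₁ p | inj₁ q = inj₁ (λ { zero → p ; (suc v) → q v })

-- Candidate sets U d for the labels d; choosing v for the label 0 restricts the later ones.
restrict : ∀ {n k} → BiGraph n → Labelling (suc k) → (Fin (suc k) → Subset n) → Fin n → Fin k → Subset n
restrict G t U v d = U (suc d) ∩ E G (t zero (suc d)) v

Fits : ∀ {n k} → BiGraph n → Labelling k → (Fin k → Subset n) → Vec (Fin n) k → Set
Fits G t U vs = (∀ d → U d (lookup vs d) ≡ true) × Copy G t vs

fits-cons : ∀ {n k} (G : BiGraph n) {t : Labelling (suc k)} → Anti t → ∀ U {v vs} → U zero v ≡ true →
  Fits G (tail t) (restrict G t U v) vs → Fits G t U (v ∷ vs)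
fits-cons G at U u0 (h , c) =
  (λ { zero → u0 ; (suc d) → proj₁ (∧-true (h d)) }) ,
  copy-cons G at (λ d → proj₂ (∧-true (h d))) c

restrict-size : ∀ {n} (G : BiGraph n) R M (U Y : Subset n) b v → U ⊆ Y →
  R * size (Y ∩ A G b v) ≤ M → R * size U ≤ R * size (U ∩ E G b v) + M
restrict-size G R M U Y b v sub h =
  ≤-trans (≤-reflexive (trans (cong (R *_) (size-split U (E G b v))) (*-distribˡ-+ R (size (U ∩ E G b v)) _)))
    (+-monoʳ-≤ (R * size (U ∩ E G b v)) (≤-trans (mul R (size-mono sub')) h))
  where
  sub' : (U ∩ ∁ (E G b v)) ⊆ (Y ∩ A G b v)
  sub' w p with ∧-true {U w} p
  ... | a , c = ∧-intro (sub w a) c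

module _ {n : ℕ} (G : BiGraph n) (K R M N : ℕ) (Y : Subset n)
  (deg : ∀ v → Y v ≡ true → ∀ b → R * size (Y ∩ A G b v) ≤ M)
  (large : ∀ (S : Subset n) → N ≤ R * size S → n ≤ K * size S) where

  -- Each earlier label costs a candidate set at most M / R vertices, so label d still has N / R
  -- candidates when its turn comes.
  greedy-many : ∀ k (t : Labelling k) → Anti t → (U : Fin k → Subset n) → (∀ d → U d ⊆ Y) →
    (∀ d → toℕ d * M + N ≤ R * size (U d)) → ManyT K k (Fits G t U)
  greedy-many zero t at U sub h = (λ ()) , λ ()
  greedy-many (suc k) t at U sub h = U zero , large (U zero) (h zero) , λ v u0 →
    ManyT-map k (λ vs → fits-cons G at U u0)
      (greedy-many k (tail t) (tail-anti at) (restrict G t U v)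
        (λ d w p → sub (suc d) w (proj₁ (∧-true p)))
        (λ d → +-cancelˡ-≤ M _ _
          (≤-trans (≤-reflexive (sym (+-assoc M (toℕ d * M) N)))
            (≤-trans (h (suc d))
              (≤-trans (restrict-size G R M (U (suc d)) Y (t zero (suc d)) v (sub (suc d))
                         (deg v (sub zero v u0) (t zero (suc d))))
                (≤-reflexive (+-comm _ M)))))))

edges-bound : ∀ {n} (G : BiGraph n) b S (f : Fin n → ℕ) →
  (∀ u → S u ≡ true → size (S ∩ E G b u) ≤ f u) → edges G b S ≤ sumFin n f
edges-bound {n} G b S f h = sum-mono n pt
  where
  pt : ∀ u → sumFin n (λ v → b2n (S u ∧ (S v ∧ E G b u v))) ≤ f u
  pt u with S u in eq
  ... | true = h u eq
  ... | false = ≤-trans (≤-reflexive (trans (sum-const n 0) (*-zeroʳ n))) z≤n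

edges-extend : ∀ {n} (G : BiGraph n) b (I X : Subset n) →
  edges G b (λ v → I v ∨ X v) ≤ edges G b I + 2 * (n * size X)
edges-extend {n} G b I X = ≤-trans
  (sum-mono n (λ u → sum-mono n (λ v → pt (I u) (X u) (I v) (X v) (E G b u v))))
  (≤-reflexive (trans (sum-cong n inner)
    (trans (sum-+ n _ (λ u → n * b2n (X u) + size X)) (cong (edges G b I +_)
      (trans (sum-+ n (λ u → n * b2n (X u)) (λ _ → size X))
        (trans (cong₂ _+_ (sum-* n n (λ u → b2n (X u))) (sum-const n (size X))) (double (n * size X))))))))
  where
  pt : ∀ a x a' x' e → b2n ((a ∨ x) ∧ ((a' ∨ x') ∧ e)) ≤ b2n (a ∧ (a' ∧ e)) + (b2n x + b2n x')
  pt true x true x' e = m≤m+n (b2n e) _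
  pt true x false true e = ≤-trans (b2n≤1 e) (m≤n+m 1 (b2n x))
  pt true x false false e = z≤n
  pt false true a' x' e = ≤-trans (b2n≤1 _) (s≤s z≤n)
  pt false false a' x' e = z≤n
  inner : ∀ u → sumFin n (λ v → b2n (I u ∧ (I v ∧ E G b u v)) + (b2n (X u) + b2n (X v))) ≡
    sumFin n (λ v → b2n (I u ∧ (I v ∧ E G b u v))) + (n * b2n (X u) + size X)
  inner u = trans (sum-+ n (λ v → b2n (I u ∧ (I v ∧ E G b u v))) (λ v → b2n (X u) + b2n (X v)))
    (cong (sumFin n (λ v → b2n (I u ∧ (I v ∧ E G b u v))) +_)
      (trans (sum-+ n (λ _ → b2n (X u)) (λ v → b2n (X v))) (cong (_+ size X) (sum-const n (b2n (X u))))))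
  double : ∀ a → a + a ≡ 2 * a
  double = solve-∀

NonSparse : ∀ {n} → BiGraph n → ℕ → ℕ → Set
NonSparse {n} G r g = ∀ b S → n ≤ r * size S → suc (n * n) ≤ g * edges G b S

-- Otherwise I could be padded with at most l vertices to size n / r. They add at most 2 n l edges,
-- and the padded set would span at most n^2 / (2 g) of them.
nonsparse-small : ∀ {n} (G : BiGraph n) r g → 1 ≤ r → NonSparse G r g → ∀ b I l →
  4 * g * edges G b I ≤ n * n → 8 * g * l ≤ n → suc (r * (size I + l)) ≤ n
nonsparse-small {n} G r g 1≤r ns b I l few hl = ≰⇒> contra
  where
  module _ (le : n ≤ r * (size I + l)) where
    ext : ∃ λ X → X ⊆ ∁ I × size X ≤ l × n ≤ r * (size I + size X)
    ext with l ≤? size (∁ I)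
    ... | yes p with take-subset (∁ I) l p
    ... | X , sub , sz = X , sub , ≤-reflexive sz , subst (λ z → n ≤ r * (size I + z)) (sym sz) le
    ext | no p = ∁ I , (λ _ q → q) , <⇒≤ (≰⇒> p) ,
      ≤-trans (≤-reflexive (size-∁ I)) (≤-trans (m≤m+n _ 0) (*-monoˡ-≤ (size I + size (∁ I)) 1≤r))
    X = proj₁ ext
    big : n ≤ r * size (λ v → I v ∨ X v)
    big = ≤-trans (proj₂ (proj₂ (proj₂ ext))) (mul r
      (≤-trans (≤-reflexive (sym (sum-+ n _ _))) (sum-mono n pt)))
      where
      pt : ∀ v → b2n (I v) + b2n (X v) ≤ b2n (I v ∨ X v)
      pt v with I v in eq | X v in eq'
      ... | true | false = ≤-refl
      ... | false | x = ≤-refl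
      ... | true | true with trans (sym (proj₁ (proj₂ ext) v eq')) (cong not eq)
      ... | ()
    main : suc (n * n) * 4 ≤ 2 * (n * n)
    main = lin (2 * g * n * 4 * (l ∸ size X)) (mul 4 (ns b _ big) ⊕ mul (4 * g) (edges-extend G b I X) ⊕ few ⊕ mul n hl)
      (ident (edges G b (λ v → I v ∨ X v)) (edges G b I) n g (size X) (l ∸ size X) l
        (sym (m+[n∸m]≡n (proj₁ (proj₂ (proj₂ ext))))))
      where
      ident : ∀ e e' n g x d l → l ≡ x + d →
        suc (n * n) * 4 + (4 * (g * e) + (4 * g * (e' + 2 * (n * x)) + (n * n + n * n))) + 2 * g * n * 4 * d ≡
        2 * (n * n) + (4 * suc (n * n) + (4 * g * e + (4 * g * e' + n * (8 * g * l))))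
      ident e e' n g x d .(x + d) refl = idt e e' n g x d
        where
        idt : ∀ e e' n g x d →
          suc (n * n) * 4 + (4 * (g * e) + (4 * g * (e' + 2 * (n * x)) + (n * n + n * n))) + 2 * g * n * 4 * d ≡
          2 * (n * n) + (4 * suc (n * n) + (4 * g * e + (4 * g * e' + n * (8 * g * (x + d)))))
        idt = solve-∀
    contra : ⊥
    contra = <-irrefl refl (≤-trans gap main)
      where
      gap : suc (2 * (n * n)) ≤ suc (n * n) * 4
      gap = ≤-trans (m≤m+n _ (3 + 2 * (n * n))) (≤-reflexive (widen (n * n)))
        where
        widen : ∀ x → suc (2 * x) + (3 + 2 * x) ≡ suc x * 4
        widen = solve-∀

-- Double counting of the non-adjacent pairs in P.
near-complete : ∀ {n} (G : BiGraph n) β P K N → (∀ p → P p ≡ true → K * size (P ∩ A G β p) ≤ N) →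
  Σ (Subset n) λ P' → P' ⊆ P × size P ≤ 2 * size P' ×
    (∀ p → P' p ≡ true → ∀ b → K * size (P' ∩ A G b p) ≤ 2 * N)
near-complete {n} G β P K N h = P' , (λ v p → proj₁ (∧-true p)) , half , both
  where
  few : Subset n
  few p = does (K * size (P ∩ A G (not β) p) ≤? 2 * N)
  P' R : Subset n
  P' = P ∩ few
  R = P ∩ ∁ few
  both : ∀ p → P' p ≡ true → ∀ b → K * size (P' ∩ A G b p) ≤ 2 * N
  both p q b = ≤-trans (mul K (size-mono (λ v r → let (a , c) = ∧-true {P' v} r in ∧-intro (proj₁ (∧-true a)) c))) (dir b)
    where
    dir : ∀ b → K * size (P ∩ A G b p) ≤ 2 * N
    dir b with b Data.Bool.≟ β
    ... | yes refl = ≤-trans (h p (proj₁ (∧-true q))) (m≤m+n N _)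
    ... | no ¬e = subst (λ c → K * size (P ∩ A G c p) ≤ 2 * N) (sym (Bool.¬-not ¬e))
                    (does-yes (K * size (P ∩ A G (not β) p) ≤? 2 * N) (proj₂ (∧-true {P p} q)))
  sums : sumFin n (λ p → b2n (P p) * size (P ∩ A G (not β) p)) ≡ sumFin n (λ p → b2n (P p) * size (P ∩ A G β p))
  sums = trans (sum-cong n (λ p → sym (sum-* n (b2n (P p)) _)))
    (trans (sum-swap n n _)
      (trans (sum-cong n (λ q → sum-cong n (λ p → pt p q))) (sum-cong n (λ q → sum-* n (b2n (P q)) _))))
    where
    flip : ∀ x y a → b2n x * b2n (y ∧ a) ≡ b2n y * b2n (x ∧ a)
    flip true true a = refl
    flip true false a = refl
    flip false true a = refl
    flip false false a = refl
    pt : ∀ p q → b2n (P p) * b2n (P q ∧ A G (not β) p q) ≡ b2n (P q) * b2n (P p ∧ A G β q p)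
    pt p q rewrite E-sym G β q p = flip (P p) (P q) _
  upper : K * sumFin n (λ p → b2n (P p) * size (P ∩ A G β p)) ≤ N * size P
  upper = ≤-trans (≤-reflexive (sym (sum-* n K _)))
    (≤-trans (sum-mono n pt) (≤-reflexive (sum-* n N _)))
    where
    pt : ∀ p → K * (b2n (P p) * size (P ∩ A G β p)) ≤ N * b2n (P p)
    pt p with P p in eq
    ... | false = ≤-trans (≤-reflexive (*-zeroʳ K)) z≤n
    ... | true = ≤-trans (≤-reflexive (cong (K *_) (+-identityʳ _))) (≤-trans (h p eq) (≤-reflexive (sym (*-identityʳ N))))
  lower : suc (2 * N) * size R ≤ sumFin n (λ p → K * (b2n (P p) * size (P ∩ A G (not β) p)))
  lower = markov R _ (suc (2 * N)) (λ p q → let (a , c) = ∧-true {P p} q in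
    ≤-trans (≰⇒> (does-no (K * size (P ∩ A G (not β) p) ≤? 2 * N) (not-true c)))
      (≤-reflexive (cong (K *_) (sym (trans (cong (λ z → b2n z * size (P ∩ A G (not β) p)) a) (+-identityʳ _))))))
  total : suc (2 * N) * size R ≤ N * size P
  total = ≤-trans lower (≤-trans (≤-reflexive (trans (sum-* n K _) (cong (K *_) sums))) upper)
  cancel : ∀ N r p → suc (2 * N) * r ≤ N * p → 2 * r ≤ p
  cancel zero r p le = ≤-trans (*-monoʳ-≤ 2 (≤-trans (m≤m+n r 0) le)) z≤n
  cancel (suc N) r p le = cancel-mul N (2 * r) p (lin r le (idt N r p))
    where
    idt : ∀ N r p → suc N * (2 * r) + suc N * p + r ≡ suc N * p + suc (2 * suc N) * r
    idt = solve-∀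
  half : size P ≤ 2 * size P'
  half = lin 0 (cancel N (size R) (size P) total) (ident (size P) (size P') (size R) (size-split P few))
    where
    ident : ∀ p q r → p ≡ q + r → p + p + 0 ≡ 2 * q + 2 * r
    ident .(q + r) q r refl = idt q r
      where
      idt : ∀ q r → q + r + (q + r) + 0 ≡ 2 * q + 2 * r
      idt = solve-∀

-- Exchanging two vertices

floor : ∀ n c → 1 ≤ c → ∃ λ l → c * l ≤ n × suc n ≤ c * l + c
floor n (suc c) _ = l , ≤-trans (m≤n+m (suc c * l) m) (≤-reflexive (sym eq)) ,
  ≤-trans (s≤s (≤-reflexive eq)) (≤-trans (+-monoˡ-≤ (suc c * l) (m%n<n n (suc c))) (≤-reflexive (+-comm (suc c) _)))
  where
  l = n Data.Nat.DivMod./ suc c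
  m = n Data.Nat.DivMod.% suc c
  eq : n ≡ m + suc c * l
  eq = trans (m≡m%n+[m/n]*n n (suc c)) (cong (m +_) (*-comm l (suc c)))

private
  arith-P : ∀ r g n e wa i p bd l → 1 ≤ r → wa ≤ i + (p + bd) → 128 * (g * r) * bd ≤ n → n ≤ r * wa + r * e →
    suc (r * (i + l)) ≤ n → suc n ≤ 8 * g * l + 8 * g → 128 * (g * r) * e ≤ n →
    14 * (r * n) ≤ 128 * (g * r) * p
  arith-P r g n e wa i p bd l 1≤r h1 hb h2 h3 h4 he =
    lin (16 * r) (mul (128 * (g * r)) step ⊕ mul (16 * r) h4 ⊕ hb ⊕ he ⊕ mul (2 * n) 1≤r) (idt r g n e p bd l)
    where
    step : suc l ≤ p + bd + e
    step = *-cancelˡ-< r l (p + bd + e) (lin 0 (h3 ⊕ h2 ⊕ mul r h1) (idt' r n e wa i p bd l))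
      where
      idt' : ∀ r n e wa i p bd l → suc (r * l) + (n + (r * wa + r * e + r * (i + (p + bd)))) + 0 ≡
        r * (p + bd + e) + (suc (r * (i + l)) + (n + r * wa))
      idt' = solve-∀
    idt : ∀ r g n e p bd l → 14 * (r * n) + (128 * (g * r) * (p + bd + e) + (16 * r * (8 * g * l + 8 * g) +
        (n + (n + 2 * n * r)))) + 16 * r ≡
      128 * (g * r) * p + (128 * (g * r) * suc l + (16 * r * suc n + (128 * (g * r) * bd + (128 * (g * r) * e + 2 * n * 1))))
    idt = solve-∀

  arith-near : ∀ r K n e an aw ea → 1 ≤ r → r * (aw + an) ≤ n + e → n ≤ r * (ea + aw) + r * e → K * ea ≤ n →
    4 * (K * (r * e)) ≤ n → K * an ≤ 2 * n
  arith-near (suc r) K n e an aw ea 1≤r h1 h2 h3 h4 = cancel-mul r _ _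
    (lin (2 * (K * (suc r * e)) + K * (r * e) + n * r) (mul K h1 ⊕ mul K h2 ⊕ mul (suc r) h3 ⊕ h4) (idt r K n e an aw ea))
    where
    idt : ∀ r K n e an aw ea → suc r * (K * an) + (K * (n + e) + (K * (suc r * (ea + aw) + suc r * e) + (suc r * n + n))) +
        (2 * (K * (suc r * e)) + K * (r * e) + n * r) ≡
      suc r * (2 * n) + (K * (suc r * (aw + an)) + (K * n + (suc r * (K * ea) + 4 * (K * (suc r * e)))))
    idt = solve-∀

  arith-B : ∀ r K n e an aw ea wb → wb ≡ ea + aw → r * (aw + an) ≤ n + e → K * ea ≤ n →
    K * (r * wb) ≤ K * (n + e) + r * n
  arith-B r K n e an aw ea .(ea + aw) refl h1 h3 = lin (K * (r * an)) (mul K h1 ⊕ mul r h3) (idt r K n e an aw ea)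
    where
    idt : ∀ r K n e an aw ea → K * (r * (ea + aw)) + (K * (n + e) + r * n) + K * (r * an) ≡
      K * (n + e) + r * n + (K * (r * (aw + an)) + r * (K * ea))
    idt = solve-∀

  arith-e : ∀ r K n e → 1 ≤ r → 4 * (K * (r * e)) ≤ n → K * e ≤ n
  arith-e (suc r) K n e _ h = lin (3 * (K * (suc r * e)) + K * (r * e)) h (idt r K n e)
    where
    idt : ∀ r K n e → K * e + n + (3 * (K * (suc r * e)) + K * (r * e)) ≡ n + 4 * (K * (suc r * e))
    idt = solve-∀

∩-comm-size : ∀ {n} (S X : Subset n) → size (S ∩ X) ≡ size (X ∩ S)
∩-comm-size {n} S X = sum-cong n (λ v → cong b2n (Bool.∧-comm (S v) (X v)))

-- The structure found when two candidate sets span few edges: P lies in the first of them, B is the second.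
record Cluster {n : ℕ} (G : BiGraph n) (r e K : ℕ) (β : Bool) (Z : Subset n) : Set where
  field
    P B : Subset n
    P⊆Z : P ⊆ Z
    P-B : ∀ v → P v ≡ true → B v ≡ false
    P-large : 14 * (r * n) ≤ K * size P
    B-small : ∀ p → P p ≡ true → K * (r * size B) ≤ K * (n + e) + r * n
    near : ∀ p → P p ≡ true → K * size (A G β p ∩ ∁ B) ≤ 2 * n

cluster-mono : ∀ {n} {G : BiGraph n} {r e K β Z Z'} → Z ⊆ Z' → Cluster G r e K β Z → Cluster G r e K β Z'
cluster-mono sub c = record
  { P = P ; B = B ; P⊆Z = λ v p → sub v (P⊆Z v p) ; P-B = P-B ; P-large = P-large ; B-small = B-small ; near = near }
  where open Cluster c

module Reach {n : ℕ} (G : BiGraph n) (r g e : ℕ) (1≤r : 1 ≤ r) (1≤g : 1 ≤ g)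
  (deg : ∀ b v → r * size (A G b v) ≤ n + e)
  (ns : NonSparse G r g)
  (small : 4 * (128 * (g * r) * (r * e)) ≤ n) where

  K : ℕ
  K = 128 * (g * r)

  module _ (β : Bool) (Wa Wb : Subset n) (ha : n ≤ r * size Wa + r * e) (hb : n ≤ r * size Wb + r * e) where

    rich : Subset n
    rich a = does (n ≤? K * size (Wb ∩ E G β a))

    inter core : Subset n
    inter = Wa ∩ Wb
    core = Wa ∩ (∁ Wb ∩ ∁ rich)

    -- A vertex p of `core` misses nearly all of Wb. Since Wb has about n / r vertices and p has at
    -- most (n + e) / r non-neighbours, the non-neighbourhood of p nearly equals Wb, whichever p is
    -- taken.
    cluster : K * size (Wa ∩ rich) ≤ n → Cluster G r e K β Wa
    cluster few = record
      { P = core ; B = Wb ; P⊆Z = λ v p → proj₁ (∧-true {Wa v} p)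
      ; P-B = λ v p → not-true (proj₁ (∧-true {not (Wb v)} (proj₂ (∧-true {Wa v} p))))
      -- Here l is about n / (8 g), that is 16 r n / K. The rich vertices and e cost at most n / K
      -- each, which leaves the 14.
      ; P-large = arith-P r g n e (size Wa) (size inter) (size core) (size (Wa ∩ rich)) l 1≤r cover few ha i-small
          (proj₂ (proj₂ fl)) (arith-e r K n e 1≤r small)
      ; B-small = λ p q → arith-B r K n e (size (A G β p ∩ ∁ Wb)) (size (A G β p ∩ Wb)) (size (Wb ∩ E G β p)) (size Wb)
          (wb p) (degA p) (poor p q)
      ; near = λ p q → arith-near r K n e (size (A G β p ∩ ∁ Wb)) (size (A G β p ∩ Wb)) (size (Wb ∩ E G β p)) 1≤r
          (degA p) (subst (λ z → n ≤ r * z + r * e) (wb p) hb) (poor p q) small }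
      where
      fl = floor n (8 * g) (≤-trans 1≤g (m≤m+n g _))
      l = proj₁ fl
      wb : ∀ p → size Wb ≡ size (Wb ∩ E G β p) + size (A G β p ∩ Wb)
      wb p = trans (size-split Wb (E G β p)) (cong (size (Wb ∩ E G β p) +_) (∩-comm-size Wb (A G β p)))
      degA : ∀ p → r * (size (A G β p ∩ Wb) + size (A G β p ∩ ∁ Wb)) ≤ n + e
      degA p = subst (λ z → r * z ≤ n + e) (size-split (A G β p) Wb) (deg β p)
      poor : ∀ p → core p ≡ true → K * size (Wb ∩ E G β p) ≤ n
      poor p q = <⇒≤ (≰⇒> (does-no (n ≤? _) (not-true (proj₂ (∧-true {not (Wb p)} (proj₂ (∧-true {Wa p} q)))))))
      cover : size Wa ≤ size inter + (size core + size (Wa ∩ rich))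
      cover = ≤-trans (≤-reflexive (size-split Wa Wb)) (+-monoʳ-≤ (size inter)
        (size-cover {S = Wa ∩ ∁ Wb} {core} {Wa ∩ rich} pt))
        where
        pt : ∀ v → (Wa ∩ ∁ Wb) v ≡ true → core v ≡ true ⊎ (Wa ∩ rich) v ≡ true
        pt v q with ∧-true {Wa v} q | bool-case (rich v)
        ... | a , b | inj₁ c = inj₂ (∧-intro a c)
        ... | a , b | inj₂ c = inj₁ (∧-intro a (∧-intro b (cong not c)))
      f : Fin n → ℕ
      f u = b2n (inter u) * size (inter ∩ E G β u)
      -- The at most n / K rich vertices contribute up to n edges each, all others at most n / K.
      few-edges : K * edges G β inter ≤ 2 * (n * n)
      few-edges = ≤-trans (mul K (edges-bound G β inter f (λ u q → ≤-reflexive (sym (trans (cong (λ z → b2n z * size (inter ∩ E G β u)) q) (+-identityʳ _))))))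
        (≤-trans (≤-reflexive (sym (sum-* n K f)))
        (≤-trans (sum-mono n pt)
        (≤-trans (≤-reflexive (trans (sum-+ n (λ u → n * (K * b2n ((Wa ∩ rich) u))) (λ _ → n))
                   (cong₂ _+_ (trans (sum-* n n _) (cong (n *_) (sum-* n K _))) (sum-const n n))))
        (≤-trans (+-monoˡ-≤ (n * n) (mul n few)) (≤-reflexive (double (n * n)))))))
        where
        double : ∀ a → a + a ≡ 2 * a
        double = solve-∀
        pt : ∀ u → K * f u ≤ n * (K * b2n ((Wa ∩ rich) u)) + n
        pt u with bool-case (inter u)
        ... | inj₂ q rewrite q | *-zeroʳ K = z≤n
        ... | inj₁ q with bool-case (rich u)
        ... | inj₁ c rewrite q | proj₁ (∧-true {Wa u} q) | c | *-identityʳ K | +-identityʳ (size (inter ∩ E G β u)) =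
          ≤-trans (mul K (size≤n (inter ∩ E G β u))) (≤-trans (≤-reflexive (*-comm K n)) (m≤m+n (n * K) n))
        ... | inj₂ c rewrite q | +-identityʳ (size (inter ∩ E G β u)) = ≤-trans
          (mul K (size-mono {S = inter ∩ E G β u} {Wb ∩ E G β u} (λ v p → let (a , b) = ∧-true {inter v} p in ∧-intro (proj₂ (∧-true {Wa v} a)) b)))
          (≤-trans (<⇒≤ (≰⇒> (does-no (n ≤? K * size (Wb ∩ E G β u)) c))) (m≤n+m n _))
      i-small : suc (r * (size inter + l)) ≤ n
      i-small = nonsparse-small G r g 1≤r ns β inter l (*-cancelˡ-≤ 32 (scaled r 1≤r few-edges)) (proj₁ (proj₂ fl))
        where
        scaled : ∀ r → 1 ≤ r → 128 * (g * r) * edges G β inter ≤ 2 * (n * n) → 32 * (4 * g * edges G β inter) ≤ 32 * (n * n)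
        scaled (suc r) _ h = lin (128 * (g * r * edges G β inter) + 30 * (n * n)) h (idt r g (edges G β inter) (n * n))
          where
          idt : ∀ r g x m → 32 * (4 * g * x) + 2 * m + (128 * (g * r * x) + 30 * m) ≡ 32 * m + 128 * (g * suc r) * x
          idt = solve-∀

    dichotomy : Many K (λ a → Wa a ≡ true × Many K (λ b → Wb b ≡ true × E G β a b ≡ true)) ⊎ Cluster G r e K β Wa
    dichotomy with n ≤? K * size (Wa ∩ rich)
    ... | yes p = inj₁ (Wa ∩ rich , p , λ a q → let (c , d) = ∧-true {Wa a} q in
            c , (Wb ∩ E G β a , does-yes (n ≤? _) d , λ b → ∧-true))
    ... | no ¬p = inj₂ (cluster (<⇒≤ (≰⇒> ¬p)))

  sub-last : ∀ k → Fin (suc (suc k))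
  sub-last k = inject₁ (fromℕ k)

  large : ∀ {X : Subset n} c → 1 ≤ c → n + c * (n + e) ≤ r * size X + r * e → n ≤ K * size X
  large {X} (suc c) _ h = arith r g n e (size X) c 1≤r 1≤g h small
    where
    arith : ∀ r g n e x c → 1 ≤ r → 1 ≤ g → n + suc c * (n + e) ≤ r * x + r * e →
      4 * (128 * (g * r) * (r * e)) ≤ n → n ≤ 128 * (g * r) * x
    arith r (suc g) n e x c 1≤r _ h small = ≤-trans (lin (c * (n + e) + e + 511 * (r * e)) (h ⊕ small') (idt r g n e x c)) (≤-trans (m≤m+n (r * x) ((127 + 128 * g) * (r * x))) (≤-reflexive (idt' r g x)))
      where
      small' : 512 * (r * e) ≤ n
      small' = ≤-trans (≤-trans (lin 0 (mul (512 * (r * e)) 1≤r) (idt'' r e)) (≤-trans (m≤m+n (512 * (r * (r * e))) (512 * (g * r * (r * e)))) (≤-reflexive (idt3 r g e)))) small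
        where
        idt'' : ∀ r e → 512 * (r * e) + 512 * (r * e) * r + 0 ≡ 512 * (r * (r * e)) + 512 * (r * e) * 1
        idt'' = solve-∀
        idt3 : ∀ r g e → 512 * (r * (r * e)) + 512 * (g * r * (r * e)) ≡ 4 * (128 * (suc g * r) * (r * e))
        idt3 = solve-∀
      idt : ∀ r g n e x c → n + (r * x + r * e + n) + (c * (n + e) + e + 511 * (r * e)) ≡ r * x + (n + suc c * (n + e) + 512 * (r * e))
      idt = solve-∀
      idt' : ∀ r g x → r * x + (127 + 128 * g) * (r * x) ≡ 128 * (suc g * r) * x
      idt' = solve-∀

  -- Each of the k labels before the last two costs n + e in units of 1 / r, which leaves those two
  -- about n / r candidates. A cluster found after some choice also lies in the original candidate
  -- set, so a single failure anywhere yields the second alternative.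
  peel : ∀ k (t : Labelling (suc (suc k))) → Anti t → (U : Fin (suc (suc k)) → Subset n) →
    (∀ d → n + k * (n + e) ≤ r * size (U d) + r * e) →
    ManyT K (suc (suc k)) (Fits G t U) ⊎
    Cluster G r e K (t (sub-last k) (fromℕ (suc k))) (U (sub-last k))
  peel zero t at U h with dichotomy (t zero (suc zero)) (U zero) (U (suc zero)) (bound zero) (bound (suc zero))
    where
    bound : ∀ d → n ≤ r * size (U d) + r * e
    bound d = ≤-trans (≤-reflexive (sym (+-identityʳ n))) (h d)
  ... | inj₂ c = inj₂ c
  ... | inj₁ (S , s , f) = inj₁ (S , s , λ a p → let (ua , S' , s' , f') = f a p in
    S' , s' , λ b q → let (ub , ab) = f' b q in
      fits-cons G at U {vs = b ∷ []} ua
        (fits-cons G (tail-anti at) (restrict G t U a) {vs = []} (∧-intro ub ab) ((λ ()) , λ ())))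
  peel (suc k) t at U h with all-or n {X = Cluster G r e K (t (sub-last (suc k)) (fromℕ (suc (suc k)))) (U (sub-last (suc k)))} step
    where
    step : ∀ v → (U zero v ≡ true → ManyT K (suc (suc k)) (Fits G (tail t) (restrict G t U v))) ⊎
      Cluster G r e K (t (sub-last (suc k)) (fromℕ (suc (suc k)))) (U (sub-last (suc k)))
    step v with bool-case (U zero v)
    ... | inj₂ q = inj₁ (λ p → ⊥-elim (true≢false p q))
    ... | inj₁ q with peel k (tail t) (tail-anti at) (restrict G t U v)
        (λ d → arith n (k * (n + e)) (n + e) (r * size (U (suc d))) (r * size (restrict G t U v d)) (r * e) (h (suc d))
          (restrict-size G r (n + e) (U (suc d)) full (t zero (suc d)) v (λ _ _ → refl) (deg (t zero (suc d)) v)))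
      where
      arith : ∀ n km m u u' re → n + (m + km) ≤ u + re → u ≤ u' + m → n + km ≤ u' + re
      arith n km m u u' re h1 h2 = lin 0 (h1 ⊕ h2) (idt n km m u u' re)
        where
        idt : ∀ n km m u u' re → n + km + (u + re + (u' + m)) + 0 ≡ u' + re + (n + (m + km) + u)
        idt = solve-∀
    ... | inj₁ m = inj₁ (λ _ → m)
    ... | inj₂ c = inj₂ (cluster-mono (λ w p → proj₁ (∧-true {U (suc (sub-last k)) w} p)) c)
  ... | inj₂ c = inj₂ c
  ... | inj₁ f = inj₁ (U zero , large (suc k) (s≤s z≤n) (h zero) ,
        λ v u → ManyT-map (suc (suc k)) (λ vs → fits-cons G at U {vs = vs} u) (f v u))

  Exchange : ∀ {k} → Labelling (suc k) → Fin n → Fin n → Vec (Fin n) k → Set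
  Exchange t x y vs = Copy G t (x ∷ vs) × Copy G t (y ∷ vs)

  module _ (x y : Fin n) where

    common : ∀ {k} → Labelling (suc k) → Fin k → Subset n
    common t d = E G (t zero (suc d)) x ∩ E G (t zero (suc d)) y

    exchange : ∀ {k} {t : Labelling (suc k)} → Anti t → ∀ vs → Fits G (tail t) (common t) vs → Exchange t x y vs
    exchange at vs (h , c) =
      copy-cons G at (λ d → proj₁ (∧-true (h d))) c , copy-cons G at (λ d → proj₂ (∧-true (h d))) c

    common-size : ∀ b → r * n ≤ r * size (E G b x ∩ E G b y) + (n + e) + (n + e)
    common-size b = ≤-trans (≤-reflexive (cong (r *_) (sym (size-full n))))
      (≤-trans (restrict-size G r (n + e) full full b x (λ _ _ → refl) (deg b x))
        (+-monoˡ-≤ (n + e) (restrict-size G r (n + e) (E G b x) full b y (λ _ _ → refl) (deg b y))))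

    first : ∀ k (t : Labelling (3 + k)) → Anti t → r ≡ 3 + k →
      ManyT K (2 + k) (Exchange t x y) ⊎
      Cluster G r e K (t (suc (sub-last k)) (suc (fromℕ (suc k)))) (common t (sub-last k))
    first k t at req with peel k (tail t) (tail-anti at) (common t)
        (λ d → arith r k n e (r * size (common t d)) req (common-size (t zero (suc d))))
      where
      arith : ∀ r k n e s → r ≡ 3 + k → r * n ≤ s + (n + e) + (n + e) → n + k * (n + e) ≤ s + r * e
      arith .(3 + k) k n e s refl h = lin e h (idt k n e s)
        where
        idt : ∀ k n e s → n + k * (n + e) + (s + (n + e) + (n + e)) + e ≡ s + (3 + k) * e + (3 + k) * n
        idt = solve-∀
    ... | inj₁ m = inj₁ (ManyT-map (2 + k) (exchange at) m)
    ... | inj₂ c = inj₂ c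

    -- All labels other than the source share one candidate set, so the labels need not be kept
    -- apart. P avoids B, hence its vertices miss little of P; after `near-complete` this holds in
    -- both directions, and everything but the source is embedded inside P'.
    reach-source : ∀ k (t : Labelling (3 + k)) → Anti t → r ≡ 3 + k → (∀ d → t zero (suc d) ≡ true) →
      ManyT K (2 + k) (Exchange t x y)
    reach-source k t at req src with first k t at req
    ... | inj₁ m = m
    ... | inj₂ c = ManyT-map (2 + k) widen
      (greedy-many G K K (2 * (2 * n)) n P' (λ p q b → deg' p q b) (λ S s → s) (2 + k) (tail t) (tail-anti at)
        (λ _ → P') (λ _ _ p → p) (λ d → arith k n (toℕ d) (K * size P) (K * size P') (toℕ≤pred[n] d)
          (subst (λ z → 14 * (z * n) ≤ K * size P) req P-large)
          (≤-trans (mul K half) (≤-reflexive (swap K (size P'))))))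
      where
      open Cluster c
      β = t (suc (sub-last k)) (suc (fromℕ (suc k)))
      nc = near-complete G β P K (2 * n) (λ p q → ≤-trans (mul K (size-mono {S = P ∩ A G β p} {A G β p ∩ ∁ B} (λ v u →
              let (a , b) = ∧-true {P v} u in ∧-intro b (cong not (P-B v a))))) (near p q))
      P' = proj₁ nc
      P'⊆P = proj₁ (proj₂ nc)
      half = proj₁ (proj₂ (proj₂ nc))
      deg' : ∀ p → P' p ≡ true → ∀ b → K * size (P' ∩ A G b p) ≤ 2 * (2 * n)
      deg' = proj₂ (proj₂ (proj₂ nc))
      swap : ∀ a b → a * (2 * b) ≡ 2 * (a * b)
      swap = solve-∀
      arith : ∀ k n d p p' → d ≤ suc k → 14 * ((3 + k) * n) ≤ p → p ≤ 2 * p' → d * (2 * (2 * n)) + n ≤ p'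
      arith k n d p p' h1 h2 h3 = *-cancelˡ-≤ 2 (lin (6 * (k * n) + 32 * n) (mul (8 * n) h1 ⊕ h2 ⊕ h3) (idt k n d p p'))
        where
        idt : ∀ k n d p p' → 2 * (d * (2 * (2 * n)) + n) + (8 * n * suc k + (p + 2 * p')) + (6 * (k * n) + 32 * n) ≡
          2 * p' + (8 * n * d + (14 * ((3 + k) * n) + p))
        idt = solve-∀
      widen : ∀ vs → Fits G (tail t) (λ _ → P') vs → Exchange t x y vs
      widen vs (h , c) = exchange at vs ((λ d → subst (λ b → (E G b x ∩ E G b y) (lookup vs d) ≡ true)
        (trans (src (sub-last k)) (sym (src d))) (P⊆Z _ (P'⊆P _ (h d)))) , c)

    private
      arith-last : ∀ k g n e u c b p q K r → 1 ≤ g → r ≡ 4 + k → K ≡ 128 * (g * r) → r * n ≤ r * c + (n + e) + (n + e) →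
        c ≤ u + (b + (p + q)) → K * (r * b) ≤ K * (n + e) + r * n → K * p ≤ 2 * n → K * q ≤ 2 * n →
        4 * (K * (r * e)) ≤ n → k * (2 * (n + e)) + n ≤ 2 * r * u
      arith-last k (suc g) n e u c b p q .(128 * (suc g * r)) r 1≤g refl refl h1 h2 h3 h4 h5 h6 = cancel-pos K' (s≤s z≤n)
        (lin (5120 * (e * g) + 2304 * (e * g * k) + 256 * (e * g * k * k) + 2304 * (e * k) + 256 * (e * k * k) + 5120 * e + 128 * (g * k * n) + 512 * (g * n) + 118 * (k * n) + 471 * n)
          (mul (2 * K') h1 ⊕ mul (2 * K' * (4 + k)) h2 ⊕ mul 2 h3 ⊕ mul (2 * (4 + k)) h4 ⊕ mul (2 * (4 + k)) h5 ⊕ h6)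
          (idt k g n e u c b p q))
        where
        K' = 128 * (suc g * (4 + k))
        idt : ∀ k g n e u c b p q → let r = 4 + k ; K' = 128 * (suc g * (4 + k)) in
          K' * (k * (2 * (n + e)) + n) + (2 * K' * (r * c + (n + e) + (n + e)) + (2 * K' * r * (u + (b + (p + q))) +
            (2 * (K' * (n + e) + r * n) + (2 * r * (2 * n) + (2 * r * (2 * n) + n))))) +
            (5120 * (e * g) + 2304 * (e * g * k) + 256 * (e * g * k * k) + 2304 * (e * k) + 256 * (e * k * k) + 5120 * e + 128 * (g * k * n) + 512 * (g * n) + 118 * (k * n) + 471 * n) ≡
          K' * (2 * r * u) + (2 * K' * (r * n) + (2 * K' * r * c + (2 * (K' * (r * b)) + (2 * r * (K' * p) + (2 * r * (K' * q) + 4 * (K' * (r * e)))))))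
        idt = solve-∀

      arith-other : ∀ k d n e u r → r ≡ 4 + k → r * n ≤ r * u + (n + e) + (n + e) + (n + e) + (n + e) → suc d ≤ k →
        2 * (r * e) ≤ n → d * (2 * (n + e)) + n ≤ 2 * r * u
      arith-other k d n e u r refl h1 h2 h3 = lin (2 * e) (mul 2 h1 ⊕ mul (2 * (n + e)) h2 ⊕ h3) (idt k d n e u)
        where
        idt : ∀ k d n e u → d * (2 * (n + e)) + n + (2 * ((4 + k) * u + (n + e) + (n + e) + (n + e) + (n + e)) + (2 * (n + e) * k + n)) + 2 * e ≡
          2 * (4 + k) * u + (2 * ((4 + k) * n) + (2 * (n + e) * suc d + 2 * ((4 + k) * e)))
        idt = solve-∀

      arith-small : ∀ r g e n → 1 ≤ r → 1 ≤ g → 4 * (128 * (g * r) * (r * e)) ≤ n → 2 * (r * e) ≤ n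
      arith-small (suc r) (suc g) e n _ _ h = ≤-trans (m≤m+n _ (510 * (suc r * e) + 512 * (r * (suc r * e) + g * (suc r * (suc r * e)))))
        (≤-trans (≤-reflexive (idt r g e)) h)
        where
        idt : ∀ r g e → 2 * (suc r * e) + (510 * (suc r * e) + 512 * (r * (suc r * e) + g * (suc r * (suc r * e)))) ≡ 4 * (128 * (suc g * suc r) * (suc r * e))
        idt = solve-∀

    -- The last label c is an out-neighbour of both p₁ and p₂, whose out-non-neighbourhoods nearly coincide.
    reach-twins : ∀ k (t : Labelling (4 + k)) → Anti t → r ≡ 4 + k →
      let c = suc (suc (suc (fromℕ k))) in
      t zero (suc zero) ≡ true → t zero (suc (suc zero)) ≡ true → t (suc zero) (suc (suc zero)) ≡ true →
      t (suc zero) c ≡ true → t (suc (suc zero)) c ≡ true →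
      Cluster G r e K true (E G true x ∩ E G true y) → ManyT K (3 + k) (Exchange t x y)
    reach-twins k t at req t01 t02 t12 t1c t2c cl = ManyT-map (3 + k) (exchange at) (P , P-big , λ p₁ q₁ →
      (P ∩ E G true p₁ , P₁-big p₁ q₁ , λ p₂ q₂ → ManyT-map (suc k) (λ vs f →
        fits-cons G (tail-anti at) (common t) {vs = p₂ ∷ vs} (in-common t01 p₁ q₁)
          (fits-cons G (tail-anti (tail-anti at)) (restrict G (tail t) (common t) p₁) {vs = vs}
            (∧-intro (in-common t02 p₂ (proj₁ (∧-true {P p₂} q₂))) (subst (λ b → E G b p₁ p₂ ≡ true) (sym t12) (proj₂ (∧-true {P p₂} q₂)))) f))
        (greedy-many G K (2 * r) (2 * (n + e)) n full (λ v _ b → deg₂ b v) big (suc k) (tail (tail (tail t)))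
          (tail-anti (tail-anti (tail-anti at))) (U p₁ p₂) (λ _ _ _ → refl) (bound p₁ q₁ p₂ (proj₁ (∧-true {P p₂} q₂))))))
      where
      open Cluster cl
      U : Fin n → Fin n → Fin (suc k) → Subset n
      U p₁ p₂ = restrict G (tail (tail t)) (restrict G (tail t) (common t) p₁) p₂
      in-common : ∀ {b} → b ≡ true → ∀ p → P p ≡ true → (E G b x ∩ E G b y) p ≡ true
      in-common refl p q = P⊆Z p q
      ≤-of-14 : ∀ {s} → 14 * (r * n) ≤ s → n ≤ s
      ≤-of-14 h = ≤-trans (≤-trans (≤-trans (m≤m+n n 0) (*-monoˡ-≤ n 1≤r)) (m≤m+n (r * n) _)) h
      P-big : n ≤ K * size P
      P-big = ≤-of-14 P-large
      P₁-big : ∀ p → P p ≡ true → n ≤ K * size (P ∩ E G true p)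
      P₁-big p q = arith r n (K * size P) (K * size (P ∩ E G true p)) 1≤r P-large
        (restrict-size G K (2 * n) P P true p (λ _ z → z)
          (≤-trans (mul K (size-mono {S = P ∩ A G true p} {A G true p ∩ ∁ B} (λ v u →
              let (a , b) = ∧-true {P v} u in ∧-intro b (cong not (P-B v a))))) (near p q)))
        where
        arith : ∀ r n s s' → 1 ≤ r → 14 * (r * n) ≤ s → s ≤ s' + 2 * n → n ≤ s'
        arith (suc r) n s s' _ h1 h2 = lin (11 * n + 14 * (r * n)) (h1 ⊕ h2) (idt r n s s')
          where
          idt : ∀ r n s s' → n + (s + (s' + 2 * n)) + (11 * n + 14 * (r * n)) ≡ s' + (14 * (suc r * n) + s)
          idt = solve-∀
      deg₂ : ∀ b v → 2 * r * size (full ∩ A G b v) ≤ 2 * (n + e)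
      deg₂ b v = ≤-trans (≤-reflexive (*-assoc 2 r _)) (mul 2 (deg b v))
      big : ∀ S → n ≤ 2 * r * size S → n ≤ K * size S
      big S h = ≤-trans h (*-monoˡ-≤ (size S) (arith r g 1≤g))
        where
        arith : ∀ r g → 1 ≤ g → 2 * r ≤ 128 * (g * r)
        arith r (suc g) _ = ≤-trans (m≤m+n (2 * r) (126 * r + 128 * (g * r))) (≤-reflexive (idt r g))
          where
          idt : ∀ r g → 2 * r + (126 * r + 128 * (g * r)) ≡ 128 * (suc g * r)
          idt = solve-∀
      bound : ∀ p₁ → P p₁ ≡ true → ∀ p₂ → P p₂ ≡ true → ∀ d → toℕ d * (2 * (n + e)) + n ≤ 2 * r * size (U p₁ p₂ d)
      bound p₁ q₁ p₂ q₂ d with suc (toℕ d) ≤? k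
      -- Fixing x, y, p₁ and p₂ leaves each candidate set about k n / r vertices, enough for a label
      -- with fewer than k predecessors. The last label has k of them; for it the non-neighbourhoods
      -- of p₁ and p₂ are both covered by B and two small remainders, so only three shares of n / r
      -- are lost instead of four.
      ... | yes d<k = arith-other k (toℕ d) n e (size (U p₁ p₂ d)) r req
            (≤-trans (common-size (t zero (suc (suc (suc d))))) (+-monoˡ-≤ _ (+-monoˡ-≤ _
              (≤-trans (restrict-size G r (n + e) (common t (suc (suc d))) full (t (suc zero) (suc (suc (suc d)))) p₁ (λ _ _ → refl) (deg _ p₁))
                (≤-trans (+-monoˡ-≤ (n + e) (restrict-size G r (n + e) (restrict G (tail t) (common t) p₁ (suc d)) full (t (suc (suc zero)) (suc (suc (suc d)))) p₂ (λ _ _ → refl) (deg _ p₂)))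
                  ≤-refl)))))
            d<k (arith-small r g e n 1≤r 1≤g small)
      ... | no d≮k with toℕ-injective {i = d} {fromℕ k} (trans (≤-antisym (toℕ≤pred[n] d) (≮⇒≥ d≮k)) (sym (toℕ-fromℕ k)))
      ... | refl = subst (λ z → z * (2 * (n + e)) + n ≤ 2 * r * size (U p₁ p₂ (fromℕ k))) (sym (toℕ-fromℕ k))
            (arith-last k g n e (size (U p₁ p₂ (fromℕ k))) (size (common t (suc (suc (fromℕ k))))) (size B)
              (size (A G true p₁ ∩ ∁ B)) (size (A G true p₂ ∩ ∁ B)) K r 1≤g req refl
              (common-size (t zero (suc (suc (suc (fromℕ k)))))) cover (B-small p₁ q₁) (near p₁ q₁) (near p₂ q₂) small)
        where
        X : Subset n
        X v = (A G true p₁ ∩ ∁ B) v ∨ (A G true p₂ ∩ ∁ B) v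
        Y : Subset n
        Y v = B v ∨ X v
        or : ∀ a b → a ∨ b ≡ true → a ≡ true ⊎ b ≡ true
        or true b _ = inj₁ refl
        or false b p = inj₂ p
        cover : size (common t (suc (suc (fromℕ k)))) ≤ size (U p₁ p₂ (fromℕ k)) +
          (size B + (size (A G true p₁ ∩ ∁ B) + size (A G true p₂ ∩ ∁ B)))
        cover = ≤-trans (size-cover {X = U p₁ p₂ (fromℕ k)} {Y} pt) (+-monoʳ-≤ _
          (≤-trans (size-cover {S = Y} {B} {X} (λ v → or (B v) (X v))) (+-monoʳ-≤ (size B)
            (size-cover {S = X} {A G true p₁ ∩ ∁ B} {A G true p₂ ∩ ∁ B} (λ v → or _ _)))))
          where
          pt : ∀ v → common t (suc (suc (fromℕ k))) v ≡ true → U p₁ p₂ (fromℕ k) v ≡ true ⊎ Y v ≡ true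
          pt v q rewrite t1c | t2c | q with E G true p₁ v | E G true p₂ v | B v
          ... | true | true | _ = inj₁ refl
          ... | true | false | true = inj₂ refl
          ... | true | false | false = inj₂ refl
          ... | false | _ | true = inj₂ refl
          ... | false | _ | false = inj₂ refl

-- Copies of small weight

weight : ∀ {n k} → (Fin n → ℕ) → Vec (Fin n) k → ℕ
weight w [] = 0
weight w (v ∷ vs) = w v + weight w vs

weightOn : ∀ {n} → (Fin n → ℕ) → Subset n → ℕ
weightOn {n} w S = sumFin n (λ v → b2n (S v) * w v)

rangeSum : (ℕ → ℕ) → ℕ → ℕ → ℕ
rangeSum a lo zero = 0
rangeSum a lo (suc k) = a lo + rangeSum a (suc lo) k

rangeSum-++ : ∀ a lo j k → rangeSum a lo (j + k) ≡ rangeSum a lo j + rangeSum a (lo + j) k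
rangeSum-++ a lo zero k rewrite +-identityʳ lo = refl
rangeSum-++ a lo (suc j) k rewrite rangeSum-++ a (suc lo) j k | +-suc lo j =
  sym (+-assoc (a lo) (rangeSum a (suc lo) j) _)

rangeSum-bound : ∀ a lo k c → (∀ j → suc j ≤ lo + k → a j ≤ c) → rangeSum a lo k ≤ k * c
rangeSum-bound a lo zero c h = z≤n
rangeSum-bound a lo (suc k) c h = h lo (≤-trans (s≤s (m≤m+n lo k)) (≤-reflexive (sym (+-suc lo k)))) ⊕
  rangeSum-bound a (suc lo) k c (λ j p → h j (≤-trans p (≤-reflexive (sym (+-suc lo k)))))

rangeSum-* : ∀ c a lo k → c * rangeSum a lo k ≡ rangeSum (λ j → c * a j) lo k
rangeSum-* c a lo zero = *-zeroʳ c
rangeSum-* c a lo (suc k) = trans (*-distribˡ-+ c (a lo) _) (cong (c * a lo +_) (rangeSum-* c a (suc lo) k))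

weightOn-mono : ∀ {n} w {S X : Subset n} → S ⊆ X → weightOn w S ≤ weightOn w X
weightOn-mono {n} w h = sum-mono n (λ v → *-monoˡ-≤ (w v) (b2n-mono (h v)))

argmin : ∀ {n} (w : Fin n → ℕ) (S : Subset n) → 1 ≤ size S →
  ∃ λ v → S v ≡ true × (∀ u → S u ≡ true → w v ≤ w u)
argmin {suc n} w S h with 1 ≤? size (λ v → S (suc v))
argmin {suc n} w S h | no ¬p with S zero in eq
... | true = zero , eq , λ { zero _ → ≤-refl ; (suc u) q → ⊥-elim (¬p (size-pos u q)) }
... | false = ⊥-elim (¬p h)
argmin {suc n} w S h | yes p with argmin (λ v → w (suc v)) (λ v → S (suc v)) p | bool-case (S zero)
... | v , sv , mn | inj₂ s0 = suc v , sv , λ { zero q → ⊥-elim (true≢false q s0) ; (suc u) q → mn u q }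
... | v , sv , mn | inj₁ s0 with w zero ≤? w (suc v)
... | yes le = zero , s0 , λ { zero _ → ≤-refl ; (suc u) q → ≤-trans le (mn u q) }
... | no nle = suc v , sv , λ { zero _ → <⇒≤ (≰⇒> nle) ; (suc u) q → mn u q }

argmax : ∀ (f : ℕ → ℕ) r → ∃ λ i → i ≤ r × (∀ j → j ≤ r → f j ≤ f i)
argmax f zero = zero , z≤n , λ { zero _ → ≤-refl }
argmax f (suc r) with argmax f r
... | i , i≤r , mx with f (suc r) ≤? f i
... | yes le = i , m≤n⇒m≤1+n i≤r , λ j p → [ (λ q → mx j (≤-pred q)) , (λ { refl → le }) ]′ (m≤n⇒m<n∨m≡n p)
... | no nle = suc r , ≤-refl , λ j p → [ (λ q → ≤-trans (mx j (≤-pred q)) (<⇒≤ (≰⇒> nle))) , (λ { refl → ≤-refl }) ]′ (m≤n⇒m<n∨m≡n p)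

low : ∀ {n} → (Fin n → ℕ) → ℕ → Subset n
low w c v = does (w v ≤? c)

-- a is the (c+1)-th smallest weight.
quantile : ∀ {n} (w : Fin n → ℕ) (Q : Subset n) c → suc c ≤ size Q →
  ∃ λ a → suc c ≤ size (Q ∩ low w a) × size Q ≤ c + size (Q ∩ λ v → does (a ≤? w v))
quantile {n} w Q c h = search (sumFin n w) (≤-trans h (size-mono (λ v q →
    ∧-intro q (yes-does (w v ≤? sumFin n w) (sum-term n w v)))))
  where
  search : ∀ N → suc c ≤ size (Q ∩ low w N) →
    ∃ λ a → suc c ≤ size (Q ∩ low w a) × size Q ≤ c + size (Q ∩ λ v → does (a ≤? w v))
  search zero p = zero , p , ≤-trans (size-mono (λ v q → ∧-intro q (yes-does (0 ≤? w v) z≤n))) (m≤n+m _ c)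
  search (suc N) p with suc c ≤? size (Q ∩ low w N)
  ... | yes q = search N q
  ... | no nq = suc N , p , ≤-trans (size-cover {S = Q} {Q ∩ low w N} {Q ∩ λ v → does (suc N ≤? w v)} pt)
          (+-monoˡ-≤ _ (≤-pred (≰⇒> nq)))
    where
    pt : ∀ v → Q v ≡ true → (Q ∩ low w N) v ≡ true ⊎ (Q ∩ λ v → does (suc N ≤? w v)) v ≡ true
    pt v q with w v ≤? N
    ... | yes le = inj₁ (∧-intro q (yes-does (w v ≤? N) le))
    ... | no nle = inj₂ (∧-intro q (yes-does (suc N ≤? w v) (≰⇒> nle)))

module _ {n : ℕ} (w : Fin n → ℕ) (Q : Subset n) where

  -- A certificate that Q weighs at least T, using exactly acc of its vertices, so that disjoint
  -- blocks can still be added.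
  Reserved : ℕ → ℕ → Set
  Reserved acc T = Σ (Subset n) λ X → X ⊆ Q × size X ≡ acc × T ≤ weightOn w X

  reserve : ∀ {acc T} c θ → Reserved acc T → acc + c ≤ size (Q ∩ λ v → does (θ ≤? w v)) →
    Reserved (acc + c) (T + c * θ)
  reserve {acc} {T} c θ (X , sub , sz , hT) h = X' , sub' , sz' , hT'
    where
    H : Subset n
    H = (Q ∩ λ v → does (θ ≤? w v)) ∩ ∁ X
    H-big : c ≤ size H
    H-big = +-cancelˡ-≤ acc c (size H) (≤-trans h (≤-trans (≤-reflexive (size-split (Q ∩ λ v → does (θ ≤? w v)) X))
      (+-monoˡ-≤ (size H) (≤-trans (size-mono (λ v p → proj₂ (∧-true {(Q ∩ λ v → does (θ ≤? w v)) v} p))) (≤-reflexive sz)))))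
    Y = proj₁ (take-subset H c H-big)
    Y⊆H = proj₁ (proj₂ (take-subset H c H-big))
    Ysz = proj₂ (proj₂ (take-subset H c H-big))
    X' : Subset n
    X' v = X v ∨ Y v
    sub' : X' ⊆ Q
    sub' v p with bool-case (X v)
    ... | inj₁ q = sub v q
    ... | inj₂ q rewrite q = proj₁ (∧-true (proj₁ (∧-true (Y⊆H v p))))
    union : ∀ v → b2n (X' v) ≡ b2n (X v) + b2n (Y v)
    union v with X v in eq | Y v in eq'
    ... | true | false = refl
    ... | false | y = refl
    ... | true | true with trans (sym (proj₂ (∧-true {(Q ∩ λ v → does (θ ≤? w v)) v} (Y⊆H v eq')))) (cong not eq)
    ... | ()
    sz' : size X' ≡ acc + c
    sz' = trans (sum-cong n union) (trans (sum-+ n _ _) (cong₂ _+_ sz Ysz))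
    hT' : T + c * θ ≤ weightOn w X'
    hT' = ≤-trans (hT ⊕ ≤-trans (≤-reflexive (trans (*-comm c θ) (cong (θ *_) (sym Ysz))))
        (markov Y (λ v → b2n (Y v) * w v) θ (λ v p → ≤-trans
          (does-yes (θ ≤? w v) (proj₂ (∧-true {Q v} (proj₁ (∧-true (Y⊆H v p))))))
          (≤-reflexive (sym (trans (cong (λ z → b2n z * w v) p) (+-identityʳ (w v))))))))
      (≤-reflexive (trans (sym (sum-+ n _ _)) (sum-cong n (λ v → trans (sym (*-distribʳ-+ (w v) (b2n (X v)) (b2n (Y v))))
        (cong (_* w v) (sym (union v)))))))

  module _ (a : ℕ → ℕ) where

    -- Blocks are reserved from the last index downwards. For index j it suffices that the vertices
    -- of weight at least `a j` outnumber those reserved so far by J: any J of them not yet taken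
    -- form the block.
    blocks : ∀ {acc T} J end → Reserved acc T → ∀ k lo → lo + k ≡ end →
      (∀ j k → j + suc k ≡ end → acc + suc k * J ≤ size (Q ∩ λ v → does (a j ≤? w v))) →
      Reserved (acc + k * J) (T + J * rangeSum a lo k)
    blocks {acc} {T} J end R zero lo eq h =
      subst₂ Reserved (sym (+-identityʳ acc)) (sym (trans (cong (T +_) (*-zeroʳ J)) (+-identityʳ T))) R
    blocks {acc} {T} J end R (suc k) lo eq h = subst₂ Reserved (idt acc k J) (idt' T J (a lo) (rangeSum a (suc lo) k))
      (reserve J (a lo) (blocks J end R k (suc lo) (trans (sym (+-suc lo k)) eq) h)
        (≤-trans (≤-reflexive (idt acc k J)) (h lo k eq)))
      where
      idt : ∀ acc k J → acc + k * J + J ≡ acc + suc k * J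
      idt = solve-∀
      idt' : ∀ T J x y → T + J * y + J * x ≡ T + J * (x + y)
      idt' = solve-∀

    reserved-≤ : ∀ {acc T} → Reserved acc T → T ≤ weightOn w Q
    reserved-≤ (X , sub , _ , h) = ≤-trans h (weightOn-mono w sub)

Ext : ∀ {n} → BiGraph n → (Fin n → ℕ) → ∀ {k} → Labelling k → (Fin k → Subset n) → ℕ → Set
Ext {n} G w {k} t U b = ∃ λ vs → Fits G t U vs × weight w vs ≤ b

module _ {n : ℕ} (G : BiGraph n) (w : Fin n → ℕ) where

  ext-cons : ∀ {k} {t : Labelling (suc k)} → Anti t → ∀ U {a b} v → U zero v ≡ true → w v ≤ a →
    Ext G w (tail t) (restrict G t U v) b → Ext G w t U (a + b)
  ext-cons at U v u wv (vs , f , h) = v ∷ vs , fits-cons G at U {vs = vs} u f , wv ⊕ h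

  restrict-⊆ : ∀ {k} {t : Labelling (suc k)} {Q : Subset n} {U : Fin (suc k) → Subset n} v →
    (∀ d → U d ⊆ Q) → ∀ d → restrict G t U v d ⊆ Q
  restrict-⊆ {U = U} v sub d x p = sub (suc d) x (proj₁ (∧-true {U (suc d) x} p))

  restrict-miss : ∀ {k} {t : Labelling (suc k)} {U : Fin (suc k) → Subset n} (Q : Subset n) R c s v →
    (∀ b → R * size (Q ∩ A G b v) ≤ s) → (∀ d → R * size (Q ∩ ∁ (U d)) ≤ c * s) →
    ∀ d → R * size (Q ∩ ∁ (restrict G t U v d)) ≤ suc c * s
  restrict-miss {t = t} {U} Q R c s v h miss d = ≤-trans (mul R (size-cover {X = Q ∩ A G (t zero (suc d)) v} {Q ∩ ∁ (U (suc d))} pt))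
    (≤-trans (≤-reflexive (*-distribˡ-+ R _ _)) (h (t zero (suc d)) ⊕ miss (suc d)))
    where
    pt : ∀ x → (Q ∩ ∁ (restrict G t U v d)) x ≡ true →
      (Q ∩ A G (t zero (suc d)) v) x ≡ true ⊎ (Q ∩ ∁ (U (suc d))) x ≡ true
    pt x p with Q x | U (suc d) x | E G (t zero (suc d)) v x
    ... | true | true | false = inj₁ refl
    ... | true | false | _ = inj₂ refl

  meet : ∀ (L Q U : Subset n) R c → L ⊆ Q → R * size (Q ∩ ∁ U) ≤ c → suc c ≤ R * size L →
    ∃ λ v → (U ∩ L) v ≡ true
  meet L Q U R c sub miss h = member (U ∩ L) (pos R (size (U ∩ L)) (+-cancelˡ-≤ c 1 _
    (≤-trans (≤-reflexive (+-comm c 1)) (≤-trans h (≤-trans (mul R (size-cover {S = L} {Q ∩ ∁ U} {U ∩ L} pt))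
      (≤-trans (≤-reflexive (*-distribˡ-+ R _ _)) (+-monoˡ-≤ _ miss)))))))
    where
    pos : ∀ R x → 1 ≤ R * x → 1 ≤ x
    pos R zero h = ≤-trans h (≤-reflexive (*-zeroʳ R))
    pos R (suc x) h = s≤s z≤n
    pt : ∀ v → L v ≡ true → (Q ∩ ∁ U) v ≡ true ⊎ (U ∩ L) v ≡ true
    pt v p with bool-case (U v)
    ... | inj₁ q = inj₂ (∧-intro q p)
    ... | inj₂ q = inj₁ (∧-intro (sub v p) (cong not q))

-- The number s bounds every non-degree inside Q, and r s exceeds |Q| by at most ξ. The margin d
-- keeps independent sets away from |Q| / r, and δ is the amount by which a set of light vertices
-- may fall short of a multiple of |Q| / r.
module Tile {n : ℕ} (G : BiGraph n) (Q : Subset n) (r s ξ δ d : ℕ)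
  (degQ : ∀ v → Q v ≡ true → ∀ b → 1 * size (Q ∩ A G b v) ≤ s)
  (rs≥m : size Q ≤ r * s) (rs≤m : r * s ≤ size Q + ξ)
  (indep : ∀ S → S ⊆ Q → (∀ u v → S u ≡ true → S v ≡ true → E G true u v ≡ false) → r * size S + d ≤ size Q)
  (big : suc ((4 * r + 1) * (r * δ + r * ξ)) ≤ d)
  (w : Fin n → ℕ) where

  m : ℕ
  m = size Q

  -- A nearly complete part of L. Its vertices miss at most 2 N / r others for N = r δ + r ξ, and it
  -- has more than 2 N vertices, so up to r labels fit into it greedily.
  Near : Subset n → Set
  Near L = Σ (Subset n) λ P → P ⊆ L ×
    (∀ p → P p ≡ true → ∀ b → r * size (P ∩ A G b p) ≤ 2 * (r * δ + r * ξ)) ×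
    suc (r * (2 * (r * δ + r * ξ))) ≤ r * size P

  module _ (a : ℕ → ℕ) where

    -- After c choices at most c s vertices of Q are excluded, while c s + 1 of them weigh at most
    -- `a c`, so one of these survives.
    ext-greedy : ∀ k c (t : Labelling k) → Anti t → (U : Fin k → Subset n) → (∀ i → U i ⊆ Q) →
      (∀ i → 1 * size (Q ∩ ∁ (U i)) ≤ c * s) → (∀ j → suc j ≤ c + k → suc (j * s) ≤ size (Q ∩ low w (a j))) →
      Ext G w t U (rangeSum a c k)
    ext-greedy zero c t at U sub miss h = [] , ((λ ()) , λ ()) , z≤n
    ext-greedy (suc k) c t at U sub miss h
      with meet G w (Q ∩ low w (a c)) Q (U zero) 1 (c * s) (λ v p → proj₁ (∧-true p)) (miss zero)
             (≤-trans (h c (≤-trans (s≤s (m≤m+n c k)) (≤-reflexive (sym (+-suc c k))))) (≤-reflexive (sym (*-identityˡ _))))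
    ... | v , p with ∧-true {U zero v} p
    ... | u , q = ext-cons G w at U v u (does-yes (w v ≤? a c) (proj₂ (∧-true {Q v} q)))
      (ext-greedy k (suc c) (tail t) (tail-anti at) _ (restrict-⊆ G w {t = t} v sub)
        (restrict-miss G w {t = t} Q 1 c s v (degQ v (sub zero v u)) miss)
        (λ j z → h j (≤-trans z (≤-reflexive (sym (+-suc c k))))))

    module _ (L : Subset n) (L⊆Q : L ⊆ Q) (λ₀ : ℕ) (L-low : ∀ v → L v ≡ true → w v ≤ λ₀) where

      ext-near : ((P , _) : Near L) → ∀ j k c (t : Labelling (j + k)) → Anti t → (U : Fin (j + k) → Subset n) →
        (∀ i → U i ⊆ Q) → (∀ i → 1 * size (Q ∩ ∁ (U i)) ≤ c * s) →
        (∀ i → r * size (P ∩ ∁ (U i)) ≤ c * (2 * (r * δ + r * ξ))) → c + j ≤ r →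
        (∀ i → suc i ≤ c + j + k → suc (i * s) ≤ size (Q ∩ low w (a i))) →
        Ext G w t U (j * λ₀ + rangeSum a (c + j) k)
      ext-near N zero k c t at U sub miss missP c≤r h rewrite +-identityʳ c = ext-greedy k c t at U sub miss h
      ext-near N@(P , P⊆L , near , large) (suc j) k c t at U sub miss missP c≤r h
        with meet G w P P (U zero) r (c * (2 * (r * δ + r * ξ))) (λ v p → p) (missP zero)
               (≤-trans (s≤s (*-monoˡ-≤ (2 * (r * δ + r * ξ)) (≤-trans (m≤m+n c (suc j)) c≤r))) large)
      ... | v , p with ∧-true {U zero v} p
      ... | u , q = subst (Ext G w t U) (trans (sym (+-assoc λ₀ (j * λ₀) _)) (cong (λ z → λ₀ + j * λ₀ + rangeSum a z k) (sym (+-suc c j))))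
        (ext-cons G w at U v u (L-low v (P⊆L v q))
          (ext-near N j k (suc c) (tail t) (tail-anti at) _ (restrict-⊆ G w {t = t} v sub)
            (restrict-miss G w {t = t} Q 1 c s v (degQ v (sub zero v u)) miss)
            (restrict-miss G w {t = t} P r c (2 * (r * δ + r * ξ)) v (near v q) missP)
            (≤-trans (≤-reflexive (sym (+-suc c j))) c≤r)
            (λ i z → h i (≤-trans z (≤-reflexive (cong (_+ k) (sym (+-suc c j))))))))

      base-sizes : ∀ I (U : Subset n) c → suc I * m ≤ r * size L + r * δ → c ≤ I →
        1 * size (Q ∩ ∁ U) ≤ c * s → (suc I ∸ c) * m ≤ r * size (U ∩ L) + (r * δ + c * ξ)
      base-sizes I U c hL c≤I miss = arith I c (I ∸ c) (sym (m+[n∸m]≡n c≤I)) m r s ξ δ (size L) (size (U ∩ L)) (size (Q ∩ ∁ U))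
        hL miss rs≤m (size-cover {S = L} {U ∩ L} {Q ∩ ∁ U} pt)
        where
        pt : ∀ v → L v ≡ true → (U ∩ L) v ≡ true ⊎ (Q ∩ ∁ U) v ≡ true
        pt v p with bool-case (U v)
        ... | inj₁ q = inj₁ (∧-intro q p)
        ... | inj₂ q = inj₂ (∧-intro (L⊆Q v p) (cong not q))
        arith : ∀ I c e → I ≡ c + e → ∀ m r s ξ δ l u x → suc I * m ≤ r * l + r * δ → 1 * x ≤ c * s → r * s ≤ m + ξ → l ≤ u + x →
          (suc I ∸ c) * m ≤ r * u + (r * δ + c * ξ)
        arith .(c + e) c e refl m r s ξ δ l u x h1 h2 h3 h4 rewrite +-∸-assoc 1 (m≤m+n c e) | m+n∸m≡n c e =
          lin 0 (h1 ⊕ mul r h4 ⊕ mul r h2 ⊕ mul c h3) (idt c e m r s ξ δ l u x)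
          where
          idt : ∀ c e m r s ξ δ l u x → suc e * m + (r * l + r * δ + (r * (u + x) + (r * (c * s) + c * (m + ξ)))) + 0 ≡
            r * u + (r * δ + c * ξ) + (suc (c + e) * m + (r * l + (r * (1 * x) + c * (r * s))))
          idt = solve-∀

      d≤m : d ≤ m
      d≤m = ≤-trans (m≤n+m d _) (indep (λ _ → false) (λ _ ()) (λ _ _ ()))

      -- The counterpart of `Cluster` inside Q. With no β-edge from Wa to Wb their intersection is
      -- independent, so by the margin d a sizeable part of Wa lies outside Wb. Each vertex there
      -- misses all of Wb, which nearly exhausts its s non-neighbours, so it misses little else.
      no-edge-near : ∀ β (U U' : Subset n) c → suc c * m ≤ r * size L + r * δ → suc c ≤ r →
        1 * size (Q ∩ ∁ U) ≤ c * s → 1 * size (Q ∩ ∁ U') ≤ c * s →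
        (∀ u v → (U ∩ L) u ≡ true → (U' ∩ L) v ≡ true → E G β u v ≡ false) → Near L
      no-edge-near β U U' c hL c<r miss miss' none = P' , (λ v p → proj₂ (∧-true {U v} (proj₁ (∧-true {Wa v} (P'⊆P v p))))) , near , large
        where
        Wa Wb P : Subset n
        Wa = U ∩ L
        Wb = U' ∩ L
        P = Wa ∩ ∁ Wb
        N = r * δ + r * ξ
        wide : ∀ X → 1 * size (Q ∩ ∁ X) ≤ c * s → m ≤ r * size (X ∩ L) + (r * δ + c * ξ)
        wide X h = ≤-trans (≤-reflexive (trans (sym (+-identityʳ m)) (cong (_* m) (sym (trans (+-∸-assoc 1 (≤-refl {c})) (cong suc (n∸n≡0 c)))))))
          (base-sizes c X c hL ≤-refl h)
        inQ : ∀ v → Wa v ≡ true → Q v ≡ true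
        inQ v p = L⊆Q v (proj₂ (∧-true {U v} p))
        few : ∀ p → P p ≡ true → r * size (P ∩ A G β p) ≤ N
        few p q = arith c m r s ξ δ (size Wb) (size (P ∩ A G β p)) c<r (wide U' miss') rs≤m
          (≤-trans (≤-trans (+-mono-≤ (size-mono {S = Wb} {(Q ∩ A G β p) ∩ Wb} s₁) (size-mono {S = P ∩ A G β p} {(Q ∩ A G β p) ∩ ∁ Wb} s₂))
            (≤-reflexive (sym (size-split (Q ∩ A G β p) Wb))))
            (≤-trans (m≤m+n _ 0) (degQ p (inQ p (proj₁ (∧-true q))) β)))
          where
          s₁ : Wb ⊆ ((Q ∩ A G β p) ∩ Wb)
          s₁ v h = ∧-intro (∧-intro (L⊆Q v (proj₂ (∧-true {U' v} h))) (cong not (none p v (proj₁ (∧-true q)) h))) h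
          s₂ : (P ∩ A G β p) ⊆ ((Q ∩ A G β p) ∩ ∁ Wb)
          s₂ v h = let (a , b) = ∧-true {P v} h ; (x , y) = ∧-true {Wa v} a in ∧-intro (∧-intro (inQ v x) b) y
          arith : ∀ c m r s ξ δ b p → suc c ≤ r → m ≤ r * b + (r * δ + c * ξ) → r * s ≤ m + ξ → b + p ≤ s → r * p ≤ r * δ + r * ξ
          arith c m r s ξ δ b p h0 h1 h2 h3 = lin 0 (mul ξ h0 ⊕ h1 ⊕ h2 ⊕ mul r h3) (idt c m r s ξ δ b p)
            where
            idt : ∀ c m r s ξ δ b p → r * p + (ξ * r + (r * b + (r * δ + c * ξ) + (m + ξ + r * s))) + 0 ≡
              r * δ + r * ξ + (ξ * suc c + (m + (r * s + r * (b + p))))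
            idt = solve-∀
        nc = near-complete G β P r N few
        P' = proj₁ nc
        P'⊆P = proj₁ (proj₂ nc)
        near = proj₂ (proj₂ (proj₂ nc))
        sparse : r * size (Wa ∩ Wb) + d ≤ m
        sparse = indep (Wa ∩ Wb) (λ v p → inQ v (proj₁ (∧-true p))) edgeless
          where
          edgeless : ∀ u v → (Wa ∩ Wb) u ≡ true → (Wa ∩ Wb) v ≡ true → E G true u v ≡ false
          edgeless u v p q = go β none
            where
            go : ∀ β → (∀ u v → Wa u ≡ true → Wb v ≡ true → E G β u v ≡ false) → E G true u v ≡ false
            go true f = f u v (proj₁ (∧-true {Wa u} p)) (proj₂ (∧-true {Wa v} q))
            go false f = trans (E-sym G true u v) (f v u (proj₁ (∧-true {Wa v} q)) (proj₂ (∧-true {Wa u} p)))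
        large : suc (r * (2 * N)) ≤ r * size P'
        large = *-cancelˡ-< 2 _ _ (arith c m r ξ δ d (size (Wa ∩ Wb)) (size P) (size P')
          c<r (subst (λ z → m ≤ r * z + (r * δ + c * ξ)) (size-split Wa Wb) (wide U miss)) sparse big (proj₁ (proj₂ (proj₂ nc))))
          where
          arith : ∀ c m r ξ δ d i p p' → suc c ≤ r → m ≤ r * (i + p) + (r * δ + c * ξ) → r * i + d ≤ m → suc ((4 * r + 1) * (r * δ + r * ξ)) ≤ d →
            p ≤ 2 * p' → suc (2 * (r * (2 * (r * δ + r * ξ)))) ≤ 2 * (r * p')
          arith c m r ξ δ d i p p' h0 h1 h2 h3 h4 = lin ξ (mul ξ h0 ⊕ h1 ⊕ h2 ⊕ h3 ⊕ mul r h4) (idt c m r ξ δ d i p p')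
            where
            idt : ∀ c m r ξ δ d i p p' → suc (2 * (r * (2 * (r * δ + r * ξ)))) + (ξ * r + (r * (i + p) + (r * δ + c * ξ) + (m + (d + r * (2 * p'))))) + ξ ≡
              2 * (r * p') + (ξ * suc c + (m + (r * i + d + (suc ((4 * r + 1) * (r * δ + r * ξ)) + r * p))))
            idt = solve-∀

      -- L holds about c + j + 1 shares of |Q| / r. The c labels already placed and the next j cost
      -- at most one share each, and an edge inside the remaining share places two labels: one more
      -- light label than there are shares. If that edge is missing, `no-edge-near` gives room for
      -- all of them.
      turan : ∀ j k c (t : Labelling (2 + (j + k))) → Anti t → (U : Fin (2 + (j + k)) → Subset n) →
        suc (c + j) * m ≤ r * size L + r * δ → suc (c + j) ≤ r →
        (∀ i → U i ⊆ Q) → (∀ i → 1 * size (Q ∩ ∁ (U i)) ≤ c * s) →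
        (∀ i → suc i ≤ c + (2 + (j + k)) → suc (i * s) ≤ size (Q ∩ low w (a i))) →
        Ext G w t U ((2 + j) * λ₀ + rangeSum a (c + (2 + j)) k) ⊎ Near L
      turan zero k c t at U hL c<r sub miss h = choose (all-or n (λ u → all-or n (edge? u)))
        where
        Edge : Set
        Edge = Σ (Fin n) λ u → Σ (Fin n) λ v → (U zero ∩ L) u ≡ true × (U (suc zero) ∩ L) v ≡ true × E G (t zero (suc zero)) u v ≡ true
        NoEdge : Fin n → Fin n → Set
        NoEdge u v = (U zero ∩ L) u ≡ true → (U (suc zero) ∩ L) v ≡ true → E G (t zero (suc zero)) u v ≡ false
        edge? : ∀ u v → NoEdge u v ⊎ Edge
        edge? u v with bool-case ((U zero ∩ L) u) | bool-case ((U (suc zero) ∩ L) v) | bool-case (E G (t zero (suc zero)) u v)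
        ... | inj₂ x | _ | _ = inj₁ (λ p _ → ⊥-elim (true≢false p x))
        ... | _ | inj₂ x | _ = inj₁ (λ _ p → ⊥-elim (true≢false p x))
        ... | _ | _ | inj₂ x = inj₁ (λ _ _ → x)
        ... | inj₁ x | inj₁ y | inj₁ z = inj₂ (u , v , x , y , z)
        bound-eq : λ₀ + (λ₀ + rangeSum a (suc (suc c)) k) ≡ 2 * λ₀ + rangeSum a (c + 2) k
        bound-eq = trans (sym (+-assoc λ₀ λ₀ _)) (cong₂ _+_ (cong (λ₀ +_) (sym (+-identityʳ λ₀))) (cong (λ z → rangeSum a z k) (+-comm 2 c)))
        choose : (∀ u v → NoEdge u v) ⊎ Edge → Ext G w t U (2 * λ₀ + rangeSum a (c + 2) k) ⊎ Near L
        choose (inj₁ none) = inj₂ (no-edge-near (t zero (suc zero)) (U zero) (U (suc zero)) c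
          (subst (λ z → suc z * m ≤ r * size L + r * δ) (+-identityʳ c) hL) (subst (λ z → suc z ≤ r) (+-identityʳ c) c<r) (miss zero) (miss (suc zero)) none)
        choose (inj₂ (u , v , p , q , uv)) = inj₁ (subst (Ext G w t U) bound-eq
          (ext-cons G w at U u pu (L-low u pl)
            (ext-cons G w (tail-anti at) (restrict G t U u) v (∧-intro qu uv) (L-low v ql)
              (ext-greedy k (suc (suc c)) (tail (tail t)) (tail-anti (tail-anti at)) (restrict G (tail t) (restrict G t U u) v)
                (restrict-⊆ G w {t = tail t} v (restrict-⊆ G w {t = t} u sub))
                (restrict-miss G w {t = tail t} Q 1 (suc c) s v (degQ v (L⊆Q v ql))
                  (restrict-miss G w {t = t} Q 1 c s u (degQ u (L⊆Q u pl)) miss))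
                (λ i z → h i (≤-trans z (≤-reflexive (sym (trans (+-suc c (suc k)) (cong suc (+-suc c k)))))))))))
          where
          pu = proj₁ (∧-true {U zero u} p)
          pl = proj₂ (∧-true {U zero u} p)
          qu = proj₁ (∧-true {U (suc zero) v} q)
          ql = proj₂ (∧-true {U (suc zero) v} q)
      turan (suc j) k c t at U hL c<r sub miss h = pick (meet G w L Q (U zero) 1 (c * s) L⊆Q (miss zero) (≤-trans
               (*-cancelˡ-< r (c * s) (size L) (arith m r s ξ δ d (c + suc j) c (size L) rs≤m big d≤m hL
                  (≤-trans (s≤s (m≤m+n c (suc j))) c<r) (m≤m+n c (suc j)))) (≤-reflexive (sym (*-identityˡ (size L))))))
        where
        arith : ∀ m r s ξ δ d i c l → r * s ≤ m + ξ → suc ((4 * r + 1) * (r * δ + r * ξ)) ≤ d → d ≤ m → suc i * m ≤ r * l + r * δ → suc c ≤ r → c ≤ i →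
          suc (r * (c * s)) ≤ r * l
        arith m r s ξ δ d i c l h1 h2 h3 h4 h5 h6 = lin (ξ + 4 * r * (r * δ + r * ξ)) (mul c h1 ⊕ h2 ⊕ h3 ⊕ h4 ⊕ mul ξ h5 ⊕ mul m h6) (idt m r s ξ δ d i c l)
          where
          idt : ∀ m r s ξ δ d i c l → suc (r * (c * s)) + (c * (m + ξ) + (d + (m + (r * l + r * δ + (ξ * r + m * i))))) + (ξ + 4 * r * (r * δ + r * ξ)) ≡
            r * l + (c * (r * s) + (suc ((4 * r + 1) * (r * δ + r * ξ)) + (d + (suc i * m + (ξ * suc c + m * c)))))
          idt = solve-∀
        Result : Set
        Result = Ext G w t U ((3 + j) * λ₀ + rangeSum a (c + (3 + j)) k) ⊎ Near L
        pick : (∃ λ v → (U zero ∩ L) v ≡ true) → Result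
        pick (v , p) = extend (turan j k (suc c) (tail t) (tail-anti at) (restrict G t U v)
            (subst (λ z → suc z * m ≤ r * size L + r * δ) (+-suc c j) hL) (subst (λ z → suc z ≤ r) (+-suc c j) c<r)
            (restrict-⊆ G w {t = t} v sub)
            (restrict-miss G w {t = t} Q 1 c s v (degQ v (L⊆Q v (proj₂ (∧-true {U zero v} p)))) miss)
            (λ i z → h i (≤-trans z (≤-reflexive (sym (+-suc c (2 + (j + k))))))))
          where
          extend : Ext G w (tail t) (restrict G t U v) ((2 + j) * λ₀ + rangeSum a (suc c + (2 + j)) k) ⊎ Near L → Result
          extend (inj₂ N) = inj₂ N
          extend (inj₁ X) = inj₁ (subst (Ext G w t U)
              (trans (sym (+-assoc λ₀ ((2 + j) * λ₀) _)) (cong (λ z → λ₀ + (2 + j) * λ₀ + rangeSum a z k) (sym (+-suc c (2 + j)))))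
              (ext-cons G w at U v (proj₁ (∧-true {U zero v} p)) (L-low v (proj₂ (∧-true {U zero v} p))) X))

private
  -- With q = r - 1, each of the r order statistics can be charged to J = m - q s vertices of its own.
  J-exists : ∀ q s m ξ δ → suc q * s ≤ m + ξ → suc (suc q * δ + suc q * ξ) ≤ m → ∃ λ J → q * s + suc J ≡ m
  J-exists q s m ξ δ h1 h2 = m ∸ suc (q * s) , trans (+-suc (q * s) _) (m+[n∸m]≡n strict)
    where
    strict : suc (q * s) ≤ m
    strict = *-cancelˡ-< (suc q) (q * s) m (lin (suc q * δ + ξ) (mul q h1 ⊕ h2) (idt q s m ξ δ))
      where
      idt : ∀ q s m ξ δ → suc (suc q * (q * s)) + (q * (m + ξ) + m) + (suc q * δ + ξ) ≡
        suc q * m + (q * (suc q * s) + suc (suc q * δ + suc q * ξ))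
      idt = solve-∀

  J-δ : ∀ q s m ξ δ J → suc q * s ≤ m + ξ → suc (suc q * δ + suc q * ξ) ≤ m → q * s + J ≡ m → δ ≤ J
  J-δ q s m ξ δ J h1 h2 refl = cancel-mul q δ J (lin (suc ξ) (mul q h1 ⊕ h2) (idt q s ξ δ J))
    where
    idt : ∀ q s ξ δ J → suc q * δ + (q * (q * s + J + ξ) + (q * s + J)) + suc ξ ≡
      suc q * J + (q * (suc q * s) + suc (suc q * δ + suc q * ξ))
    idt = solve-∀

  J-upper : ∀ q s m J → m ≤ suc q * s → q * s + J ≡ m → suc q * J ≤ m
  J-upper q s m J h refl = lin 0 (mul q h) (idt q s J)
    where
    idt : ∀ q s J → suc q * J + q * (suc q * s) + 0 ≡ q * s + J + q * (q * s + J)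
    idt = solve-∀

  J-lower : ∀ q s m ξ J → suc q * s ≤ m + ξ → q * s + J ≡ m → m ≤ suc q * J + suc q * ξ
  J-lower q s m ξ J h refl = lin ξ (mul q h) (idt q s ξ J)
    where
    idt : ∀ q s ξ J → q * s + J + q * (q * s + J + ξ) + ξ ≡ suc q * J + suc q * ξ + q * (suc q * s)
    idt = solve-∀

  block-fits : ∀ q s m J j k c → suc q * J ≤ suc q * s → q * s + J ≡ m → j + suc k ≡ suc q → m ≤ j * s + c → suc k * J ≤ c
  block-fits q s m J j k c h1 refl h2 h3 = lin 0 (mul k (cancel-mul q J s h1) ⊕ h3) (idt q s J j k c (suc-injective (trans (sym (+-suc j k)) h2)))
    where
    idt : ∀ q s J j k c → j + k ≡ q → suc k * J + (k * s + (j * s + c)) + 0 ≡ c + (k * J + (q * s + J))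
    idt .(j + k) s J j k c refl = idt' s J j k c
      where
      idt' : ∀ s J j k c → suc k * J + (k * s + (j * s + c)) + 0 ≡ c + (k * J + ((j + k) * s + J))
      idt' = solve-∀

  high-fits : ∀ m J i k l h δ → 1 ≤ i + k → (i + k) * J ≤ m → (i + k) * l + (i + k) * δ ≤ i * m → m ≡ l + h → k * J + δ ≤ h
  high-fits .(l + h) J i k l h δ pos h1 h2 refl = cancel-pos (i + k) pos (lin 0 (mul k h1 ⊕ h2) (idt J i k l h δ))
    where
    idt : ∀ J i k l h δ → (i + k) * (k * J + δ) + (k * (l + h) + i * (l + h)) + 0 ≡
      (i + k) * h + (k * ((i + k) * J) + ((i + k) * l + (i + k) * δ))
    idt = solve-∀

  low-fits : ∀ q s m J₂ δ J i k j k' c → J₂ + δ ≡ J → suc q * J ≤ suc q * s → q * s + J ≡ m → i + k ≡ suc q → j + suc k' ≡ i →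
    m ≤ j * s + c → k * J + δ + suc k' * J₂ ≤ c
  low-fits q s m J₂ δ .(J₂ + δ) .(j + suc k') k j k' c refl h1 h2 h3 refl h4 =
    ≤-trans (lin (k' * δ) ≤-refl (idt J₂ δ k k'))
      (block-fits q s m (J₂ + δ) j (k + k') c h1 h2 (trans (idt' j k k') h3) h4)
    where
    idt : ∀ J₂ δ k k' → k * (J₂ + δ) + δ + suc k' * J₂ + 0 + k' * δ ≡ suc (k + k') * (J₂ + δ) + 0
    idt = solve-∀
    idt' : ∀ j k k' → j + suc (k + k') ≡ j + suc k' + k
    idt' = solve-∀

  final-flat : ∀ m x T r a p y → a ≡ 0 → x ≤ T → T ≤ r * (a * p) → m * x ≤ y
  final-flat m x T r .0 p y refl h1 h2 = ≤-trans (mul m (≤-trans h1 (≤-trans h2 (≤-reflexive (*-zeroʳ r)))))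
    (≤-trans (≤-reflexive (*-zeroʳ m)) z≤n)

  -- The copy weighs at most S₂ + a / 4, at least 3 a / 4 below the greedy bound S₀ + a + S₂. After
  -- multiplication by m, that bound exceeds the fair share by at most r z (S₀ + a + S₂), which is
  -- at most a d / 8.
  final-turan : ∀ m r j l S₀ a S₂ J z D d x W → x ≤ j * l + S₂ → j ≤ r → 4 * r * l ≤ a → m ≤ r * J + r * z →
    J * (S₀ + (a + S₂)) ≤ W → S₀ + (a + S₂) ≤ r * (a * D) → 8 * (r * r) * D * z ≤ d → d ≤ m → m * x ≤ r * W
  final-turan m r j l S₀ a S₂ J z D d x W h1 h2 h3 h4 h5 h6 h7 h8 = *-cancelˡ-≤ 4
    (lin (4 * (r * r) * D * z * a + 2 * (a * m) + 4 * (S₀ * m))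
      (mul (4 * m) h1 ⊕ mul (4 * m * l) h2 ⊕ mul m h3 ⊕ mul (4 * (S₀ + (a + S₂))) h4 ⊕ mul (4 * r) h5 ⊕ mul (4 * r * z) h6 ⊕ mul a h7 ⊕ mul a h8)
      (idt m r j l S₀ a S₂ J z D d x W))
    where
    idt : ∀ m r j l S₀ a S₂ J z D d x W → 4 * (m * x) + (4 * m * (j * l + S₂) + (4 * m * l * r + (m * a +
        (4 * (S₀ + (a + S₂)) * (r * J + r * z) + (4 * r * W + (4 * r * z * (r * (a * D)) + (a * d + a * m))))))) +
        (4 * (r * r) * D * z * a + 2 * (a * m) + 4 * (S₀ * m)) ≡
      4 * (r * W) + (4 * m * x + (4 * m * l * j + (m * (4 * r * l) + (4 * (S₀ + (a + S₂)) * m +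
        (4 * r * (J * (S₀ + (a + S₂))) + (4 * r * z * (S₀ + (a + S₂)) + (a * (8 * (r * r) * D * z) + a * d)))))))
    idt = solve-∀

  -- In units of 1 / r: the d additional heavy vertices bring more than a d / 4, taking d vertices
  -- from each block of S₀ costs at most a d / 8, and the defect of J₂ + d as a share costs at most
  -- a d / 8.
  final-spread : ∀ m r l S₀ U J₂ z D d a x W → x ≤ S₀ + U → m ≤ r * (J₂ + d) + r * z →
    (J₂ + d) * U + d * suc l + J₂ * S₀ ≤ W → suc a ≤ 4 * r * l + 4 * r → 8 * r * S₀ ≤ a →
    S₀ + U ≤ r * (a * D) → 8 * (r * r) * D * z ≤ d → m * x ≤ r * W
  final-spread m r l S₀ U J₂ z D d a x W h1 h2 h3 h4 h5 h6 h7 = *-cancelˡ-≤ 8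
    (lin (2 * d)
      (mul (8 * m) h1 ⊕ mul (8 * (S₀ + U)) h2 ⊕ mul (8 * r) h3 ⊕ mul (2 * d) h4 ⊕ mul d h5 ⊕ mul (8 * r * z) h6 ⊕ mul a h7)
      (idt m r l S₀ U J₂ z D d a x W))
    where
    idt : ∀ m r l S₀ U J₂ z D d a x W → 8 * (m * x) + (8 * m * (S₀ + U) + (8 * (S₀ + U) * (r * (J₂ + d) + r * z) +
        (8 * r * W + (2 * d * (4 * r * l + 4 * r) + (d * a + (8 * r * z * (r * (a * D)) + a * d)))))) + 2 * d ≡
      8 * (r * W) + (8 * m * x + (8 * (S₀ + U) * m + (8 * r * ((J₂ + d) * U + d * suc l + J₂ * S₀) + (2 * d * suc a +
        (d * (8 * r * S₀) + (8 * r * z * (S₀ + U) + a * (8 * (r * r) * D * z)))))))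
    idt = solve-∀

private
  -- The geometric weights make `a i` control all thresholds: each earlier one is smaller by a
  -- factor D, so their sum is negligible, and each later one is larger by at most a power of D, so
  -- the greedy bound is at most a constant times `a i`.
  module Thresholds (D : ℕ) (1≤D : 1 ≤ D) (a : ℕ → ℕ) (q i : ℕ)
    (mx : ∀ j → j ≤ q → a j * D ^ (suc q ∸ j) ≤ a i * D ^ (suc q ∸ i)) where

    pow-pos : ∀ e → 1 ≤ D ^ e
    pow-pos zero = ≤-refl
    pow-pos (suc e) = *-mono-≤ 1≤D (pow-pos e)

    ratio : ∀ j → suc j ≤ i → i ≤ q → D * a j ≤ a i
    ratio j j<i i≤q = cancel-pos (D ^ x) (pow-pos x) (≤-trans
      (≤-trans (≤-trans (≤-reflexive (idt (D ^ x) D (a j))) (*-monoʳ-≤ (a j) (*-monoˡ-≤ (D ^ x) (m≤m*n' D (D ^ y) (pow-pos y)))))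
        (≤-reflexive (cong (a j *_) (trans (sym (^-distribˡ-+-* D (suc y) x)) (cong (D ^_) exps)))))
      (≤-trans (mx j (≤-trans (<⇒≤ j<i) i≤q)) (≤-reflexive (*-comm (a i) (D ^ x)))))
      where
      x = suc q ∸ i
      y = i ∸ suc j
      m≤m*n' : ∀ m n → 1 ≤ n → m ≤ m * n
      m≤m*n' m n h = ≤-trans (≤-reflexive (sym (*-identityʳ m))) (mul m h)
      idt : ∀ p D a → p * (D * a) ≡ a * (D * p)
      idt = solve-∀
      exps : suc y + x ≡ suc q ∸ j
      exps = +-cancelʳ-≡ j _ _ (trans (idt' y x j) (trans (cong (_+ x) (m∸n+n≡m j<i)) (trans (m+[n∸m]≡n (m≤n⇒m≤1+n i≤q))
        (sym (m∸n+n≡m (≤-trans (<⇒≤ j<i) (m≤n⇒m≤1+n i≤q)))))))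
        where
        idt' : ∀ y x j → suc y + x + j ≡ y + suc j + x
        idt' = solve-∀

    cap : ∀ j → j ≤ q → a j ≤ a i * D ^ suc q
    cap j j≤q = ≤-trans (≤-trans (≤-reflexive (sym (*-identityʳ (a j)))) (mul (a j) (pow-pos (suc q ∸ j))))
      (≤-trans (mx j j≤q) (mul (a i) (^-monoʳ-≤ D {{Data.Nat.>-nonZero 1≤D}} (m∸n≤m (suc q) i))))

module Lossless {n : ℕ} (G : BiGraph n) (Q : Subset n) (q s ξ δ d : ℕ)
  (degQ : ∀ v → Q v ≡ true → ∀ b → 1 * size (Q ∩ A G b v) ≤ s)
  (rs≥m : size Q ≤ suc q * s) (rs≤m : suc q * s ≤ size Q + ξ)
  (indep : ∀ S → S ⊆ Q → (∀ u v → S u ≡ true → S v ≡ true → E G true u v ≡ false) → suc q * size S + d ≤ size Q)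
  (big : suc ((4 * suc q + 1) * (suc q * δ + suc q * ξ)) ≤ d)
  (D : ℕ) (D-def : D ≡ 8 * (suc q * suc q)) (gap : 8 * (suc q * suc q) * D ^ suc q * ξ ≤ δ)
  (t : Labelling (suc q)) (at : Anti t) where

  r m : ℕ
  r = suc q
  m = size Q

  module Normalised (w : Fin n → ℕ) (v₀ : Fin n) (v₀∈Q : Q v₀ ≡ true) (w₀ : w v₀ ≡ 0) where
    open Tile G Q r s ξ δ d degQ rs≥m rs≤m indep big w hiding (m)

    W : ℕ
    W = weightOn w Q

    slack : suc (r * δ + r * ξ) ≤ m
    slack = ≤-trans (s≤s (≤-trans (m≤m+n (r * δ + r * ξ) 0) (*-monoˡ-≤ (r * δ + r * ξ) (m≤n+m 1 (4 * r)))))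
      (≤-trans big (≤-trans (m≤n+m d _) (indep (λ _ → false) (λ _ ()) (λ _ _ ()))))

    J-pair = J-exists q s m ξ δ rs≤m slack
    J : ℕ
    J = suc (proj₁ J-pair)
    J-eq : q * s + J ≡ m
    J-eq = proj₂ J-pair

    room : ∀ j → suc j ≤ r → suc (j * s) ≤ m
    room j h = ≤-trans (s≤s (≤-trans (*-monoˡ-≤ s (≤-pred h)) (m≤m+n (q * s) _)))
      (≤-reflexive (trans (sym (+-suc (q * s) _)) J-eq))

    abstract
      a : ℕ → ℕ
      a j with suc (j * s) ≤? m
      ... | yes p = proj₁ (quantile w Q (j * s) p)
      -- A default for indices beyond the r thresholds: for j < r the inequality j s < m holds by
      -- `room`.
      ... | no _ = 0

      a-low : ∀ j → suc j ≤ r → suc (j * s) ≤ size (Q ∩ low w (a j))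
      a-low j h with suc (j * s) ≤? m
      ... | yes p = proj₁ (proj₂ (quantile w Q (j * s) p))
      ... | no ¬p = ⊥-elim (¬p (room j h))

      a-high : ∀ j → suc j ≤ r → m ≤ j * s + size (Q ∩ λ v → does (a j ≤? w v))
      a-high j h with suc (j * s) ≤? m
      ... | yes p = proj₂ (proj₂ (quantile w Q (j * s) p))
      ... | no ¬p = ⊥-elim (¬p (room j h))

    rJ≤rs : r * J ≤ r * s
    rJ≤rs = ≤-trans (J-upper q s m J rs≥m J-eq) rs≥m

    fits : ∀ end → end ≤ r → ∀ j k → j + suc k ≡ end → suc j ≤ r
    fits end h j k eq = ≤-trans (≤-trans (s≤s (m≤m+n j k)) (≤-reflexive (trans (sym (+-suc j k)) eq))) h

    Θ : ℕ
    Θ = rangeSum a 0 r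

    none : Reserved w Q 0 0
    none = (λ _ → false) , (λ _ ()) , trans (sum-const n 0) (*-zeroʳ n) , z≤n

    lossy : J * Θ ≤ W
    lossy = reserved-≤ w Q a (blocks w Q a J r none r 0 refl
      (λ j k eq → block-fits q s m J j k _ rJ≤rs J-eq eq (a-high j (fits r ≤-refl j k eq))))

    misses : ∀ {k} (i : Fin k) → 1 * size (Q ∩ ∁ Q) ≤ 0 * s
    misses _ = ≤-trans (≤-reflexive (trans (*-identityˡ _) (trans (sum-cong n (λ v → pt (Q v))) (trans (sum-const n 0) (*-zeroʳ n))))) z≤n
      where
      pt : ∀ b → b2n (b ∧ not b) ≡ 0
      pt true = refl
      pt false = refl

    Goal : Set
    Goal = ∃ λ vs → Fits G t (λ _ → Q) vs × m * weight w vs ≤ r * W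

    greedy : Ext G w t (λ _ → Q) Θ
    greedy = ext-greedy a r 0 t at (λ _ → Q) (λ _ _ p → p) misses a-low

    module Indexed (i : ℕ) (i≤q : i ≤ q) (mx : ∀ j → j ≤ q → a j * D ^ (r ∸ j) ≤ a i * D ^ (r ∸ i)) where
      open Thresholds D (≤-trans (s≤s z≤n) (≤-reflexive (sym D-def))) a q i mx

      Θ-cap : Θ ≤ r * (a i * D ^ r)
      Θ-cap = rangeSum-bound a 0 r _ (λ j h → cap j (≤-pred h))

      a-zero : a 0 ≡ 0
      a-zero with a 0 in eq
      ... | zero = refl
      ... | suc x = ⊥-elim (1+n≰n {0} (≤-trans (size-pos {S = Q ∩ ∁ H} v₀ (∧-intro v₀∈Q (cong not (no-does (suc x ≤? w v₀) (λ p → 1+n≰n (≤-trans (s≤s z≤n) (≤-trans p (≤-reflexive w₀)))))))) zero-size))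
        where
        H : Subset n
        H v = does (suc x ≤? w v)
        zero-size : size (Q ∩ ∁ H) ≤ 0
        zero-size = +-cancelˡ-≤ (size (Q ∩ H)) _ _ (≤-trans (≤-reflexive (sym (size-split Q H)))
          (≤-trans (subst (λ z → m ≤ size (Q ∩ λ v → does (z ≤? w v))) eq (a-high 0 (s≤s z≤n))) (≤-reflexive (sym (+-identityʳ _)))))

      flat : a i ≡ 0 → Goal
      flat a0 = let (vs , f , h) = greedy in vs , f , final-flat m (weight w vs) Θ r (a i) (D ^ r) (r * W) a0 h Θ-cap

      m≤rJ : m ≤ r * J + r * ξ
      m≤rJ = J-lower q s m ξ J rs≤m J-eq

      module _ (i' k : ℕ) (i-eq : i ≡ suc i') (q-eq : suc i' + k ≡ q) where

        -- With λ₀ about a i / (4 r), up to r labels of weight at most λ₀ cost at most a i / 4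
        -- together.
        fl = floor (a i) (4 * r) (s≤s z≤n)
        λ₀ = proj₁ fl
        λ₀-low : 4 * r * λ₀ ≤ a i
        λ₀-low = proj₁ (proj₂ fl)
        λ₀-high : suc (a i) ≤ 4 * r * λ₀ + 4 * r
        λ₀-high = proj₂ (proj₂ fl)

        L : Subset n
        L = Q ∩ low w λ₀

        S₀ = rangeSum a 0 i
        S₂ = rangeSum a (2 + i') k

        Θ-split : Θ ≡ S₀ + (a i + S₂)
        Θ-split = trans (cong (rangeSum a 0) (trans (cong suc (sym q-eq)) (trans (sym (+-suc (suc i') k)) (cong (_+ suc k) (sym i-eq)))))
          (trans (rangeSum-++ a 0 i (suc k)) (cong (λ z → S₀ + (a i + rangeSum a z k)) (cong suc i-eq)))

        S₀-small : 8 * r * S₀ ≤ a i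
        S₀-small = cancel-pos r (s≤s z≤n) (≤-trans (≤-reflexive (trans (idt r S₀) (cong (_* S₀) (sym D-def)))) (≤-trans
          (≤-trans (≤-reflexive (rangeSum-* D a 0 i)) (rangeSum-bound (λ j → D * a j) 0 i (a i) (λ j h → ratio j h i≤q)))
          (*-monoˡ-≤ (a i) (m≤n⇒m≤1+n i≤q))))
          where
          idt : ∀ r x → r * (8 * r * x) ≡ 8 * (r * r) * x
          idt = solve-∀

        relabel : ∀ N → 2 + (i' + k) ≡ N → (t : Labelling N) → Anti t → (∀ j → suc j ≤ N → suc (j * s) ≤ size (Q ∩ low w (a j))) →
          suc i' ≤ r → 2 + i' ≤ r → suc i' * m ≤ r * size L + r * δ → Ext G w t (λ _ → Q) ((2 + i') * λ₀ + S₂)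
        relabel .(2 + (i' + k)) refl t at al h1 h2 hL
          with turan a L (λ v p → proj₁ (∧-true p)) λ₀ (λ v p → does-yes (w v ≤? λ₀) (proj₂ (∧-true {Q v} p)))
                 i' k 0 t at (λ _ → Q) hL h1 (λ _ _ p → p) misses al
        ... | inj₁ X = X
        ... | inj₂ N@(P , P⊆L , _) = ext-near a L (λ v p → proj₁ (∧-true p)) λ₀ (λ v p → does-yes (w v ≤? λ₀) (proj₂ (∧-true {Q v} p)))
                 N (2 + i') k 0 t at (λ _ → Q) (λ _ _ p → p) misses
                 (λ _ → ≤-trans (≤-reflexive (trans (cong (r *_) (trans (sum-cong n (λ v → pt (P v) (Q v) (λ p → proj₁ (∧-true (P⊆L v p))))) (trans (sum-const n 0) (*-zeroʳ n)))) (*-zeroʳ r))) z≤n) h2 al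
          where
          pt : ∀ b c → (b ≡ true → c ≡ true) → b2n (b ∧ not c) ≡ 0
          pt false c h = refl
          pt true c h rewrite h refl = refl

        dense : i * m ≤ r * size L + r * δ → Goal
        dense le = let (vs , f , h) = relabel r (cong suc q-eq) t at a-low (≤-trans (≤-trans (≤-reflexive (sym i-eq)) i≤q) (n≤1+n q))
                            (s≤s (≤-trans (≤-reflexive (sym i-eq)) i≤q)) (subst (λ z → z * m ≤ r * size L + r * δ) i-eq le) in
          vs , f , final-turan m r (2 + i') λ₀ S₀ (a i) S₂ J ξ (D ^ r) δ (weight w vs) W h
                (s≤s (≤-trans (≤-reflexive (sym i-eq)) i≤q)) λ₀-low m≤rJ (subst (λ z → J * z ≤ W) Θ-split lossy)
                (subst (_≤ r * (a i * D ^ r)) Θ-split Θ-cap) gap δ≤m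
          where
          δ≤m : δ ≤ m
          δ≤m = ≤-trans (≤-trans (≤-trans (m≤m+n δ (q * δ)) (m≤m+n (r * δ) (r * ξ))) (n≤1+n _)) slack

        spread : ¬ (i * m ≤ r * size L + r * δ) → Goal
        spread ¬le = let (vs , f , h) = greedy in vs , f , final-spread m r λ₀ S₀ U J₂ ξ (D ^ r) δ (a i) (weight w vs) W
                (subst (weight w vs ≤_) Θ-U h) (subst (λ z → m ≤ r * z + r * ξ) (sym J₂-eq) m≤rJ)
                (subst (λ z → z * U + δ * suc λ₀ + J₂ * S₀ ≤ W) (sym J₂-eq) total) λ₀-high S₀-small
                (subst (_≤ r * (a i * D ^ r)) Θ-U Θ-cap) gap
          where
          U = rangeSum a i (suc k)
          Θ-U : Θ ≡ S₀ + U
          Θ-U = trans Θ-split (cong (λ z → S₀ + (a i + rangeSum a z k)) (sym (cong suc i-eq)))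
          J₂ = J ∸ δ
          J₂-eq : J₂ + δ ≡ J
          J₂-eq = m∸n+n≡m (J-δ q s m ξ δ J rs≤m slack J-eq)
          ik : i + suc k ≡ r
          ik = trans (cong (_+ suc k) i-eq) (trans (+-suc (suc i') k) (cong suc q-eq))
          upper : Reserved w Q (suc k * J) (J * U)
          upper = blocks w Q a J r none (suc k) i ik
            (λ j k eq → block-fits q s m J j k _ rJ≤rs J-eq eq (a-high j (fits r ≤-refl j k eq)))
          size-L : m ≡ size L + size (Q ∩ λ v → does (suc λ₀ ≤? w v))
          size-L = trans (size-split Q (low w λ₀)) (cong (size L +_) (sum-cong n (λ v → cong (λ z → b2n (Q v ∧ z)) (pt (w v)))))
            where
            pt : ∀ x → not (does (x ≤? λ₀)) ≡ does (suc λ₀ ≤? x)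
            pt x with bool-case (does (x ≤? λ₀))
            ... | inj₁ y = trans (cong not y) (sym (no-does (suc λ₀ ≤? x) (λ p → 1+n≰n (≤-trans p (does-yes (x ≤? λ₀) y)))))
            ... | inj₂ y = trans (cong not y) (sym (yes-does (suc λ₀ ≤? x) (≰⇒> (does-no (x ≤? λ₀) y))))
          -- L is smaller than i |Q| / r - δ, so the vertices above λ₀ exceed those in the upper
          -- blocks by δ.
          middle : Reserved w Q (suc k * J + δ) (J * U + δ * suc λ₀)
          middle = reserve w Q δ (suc λ₀) upper (high-fits m J i (suc k) (size L) _ δ (≤-trans (s≤s z≤n) (≤-reflexive (sym ik)))
            (subst (λ z → z * J ≤ m) (sym ik) (J-upper q s m J rs≥m J-eq))
            (subst (λ z → z * size L + z * δ ≤ i * m) (sym ik) (<⇒≤ (≰⇒> ¬le))) size-L)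
          total : J * U + δ * suc λ₀ + J₂ * S₀ ≤ W
          total = reserved-≤ w Q a (blocks w Q a J₂ i middle i 0 refl
            (λ j k' eq → low-fits q s m J₂ δ J i (suc k) j k' _ J₂-eq rJ≤rs J-eq ik eq (a-high j (fits i (m≤n⇒m≤1+n i≤q) j k' eq))))

        steep : Goal
        steep = choose (i * m ≤? r * size L + r * δ)
          where
          choose : Dec (i * m ≤ r * size L + r * δ) → Goal
          choose (yes le) = dense le
          choose (no ¬le) = spread ¬le

      conclude : Goal
      conclude = split i refl
        where
        split : ∀ j → i ≡ j → Goal
        -- The minimum weight is 0, so `a 0` vanishes. If the maximum is attained at index 0, all
        -- thresholds vanish and the greedy copy weighs nothing.
        split zero i0 = flat (trans (cong a i0) a-zero)
        split (suc i') i-eq = steep i' (q ∸ suc i') i-eq (m+[n∸m]≡n (≤-trans (≤-reflexive (sym i-eq)) i≤q))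

    normalised : Goal
    normalised = let (i , i≤q , mx) = argmax (λ j → a j * D ^ (r ∸ j)) q in Indexed.conclude i i≤q mx

weight-shift : ∀ {n k} (w : Fin n → ℕ) (S : Subset n) c (vs : Vec (Fin n) k) → (∀ i → S (lookup vs i) ≡ true) →
  (∀ v → S v ≡ true → c ≤ w v) → weight w vs ≡ weight (λ v → w v ∸ c) vs + k * c
weight-shift w S c [] h le = refl
weight-shift {k = suc k} w S c (v ∷ vs) h le
  rewrite weight-shift w S c vs (λ i → h (suc i)) le =
  trans (cong (_+ (weight (λ v → w v ∸ c) vs + k * c)) (sym (m∸n+n≡m (le v (h zero)))))
    (idt (w v ∸ c) c (weight (λ v → w v ∸ c) vs) (k * c))
  where
  idt : ∀ x c y z → x + c + (y + z) ≡ x + y + (c + z)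
  idt = solve-∀

weightOn-shift : ∀ {n} (w : Fin n → ℕ) (S : Subset n) c → (∀ v → S v ≡ true → c ≤ w v) →
  weightOn w S ≡ weightOn (λ v → w v ∸ c) S + c * size S
weightOn-shift {n} w S c le = trans (sum-cong n pt) (trans (sum-+ n _ _) (cong (weightOn (λ v → w v ∸ c) S +_) (sum-* n c _)))
  where
  pt : ∀ v → b2n (S v) * w v ≡ b2n (S v) * (w v ∸ c) + c * b2n (S v)
  pt v with S v in eq
  ... | false = sym (*-zeroʳ c)
  ... | true rewrite +-identityʳ (w v) | +-identityʳ (w v ∸ c) | *-identityʳ c = sym (m∸n+n≡m (le v eq))

-- Shift w to have minimum 0 and let a j be its (j s + 1)-th smallest value on Q. A greedy copy weighs at most
-- Θ = a 0 + ... + a q, which may exceed the fair share slightly. Let i maximise a i * D ^ (r - i). If nearly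
-- i |Q| / r vertices are much lighter than a i, then i + 1 labels fit among them (Turán) and a i is saved;
-- otherwise more vertices than expected are heavy and the bound on Θ improves.
light-copy : ∀ {n : ℕ} (G : BiGraph n) (Q : Subset n) (q s ξ δ d D : ℕ) → D ≡ 8 * (suc q * suc q) →
  (∀ v → Q v ≡ true → ∀ b → size (Q ∩ A G b v) ≤ s) →
  size Q ≤ suc q * s → suc q * s ≤ size Q + ξ →
  (∀ S → S ⊆ Q → (∀ u v → S u ≡ true → S v ≡ true → E G true u v ≡ false) → suc q * size S + d ≤ size Q) →
  suc ((4 * suc q + 1) * (suc q * δ + suc q * ξ)) ≤ d →
  8 * (suc q * suc q) * D ^ suc q * ξ ≤ δ →
  (t : Labelling (suc q)) → Anti t → (w : Fin n → ℕ) →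
  ∃ λ vs → Fits G t (λ _ → Q) vs × size Q * weight w vs ≤ suc q * weightOn w Q
light-copy {n} G Q q s ξ δ d D D-def degQ h1 h2 indep big gap t at w =
  let (vs , f , le) = normalised in vs , f , shift vs f le
  where
  m-pos : 1 ≤ size Q
  m-pos = ≤-trans (≤-trans (s≤s z≤n) big) (≤-trans (m≤n+m d _) (indep (λ _ → false) (λ _ ()) (λ _ _ ())))
  mn = argmin w Q m-pos
  v₀ = proj₁ mn
  c = w v₀
  open Lossless G Q q s ξ δ d (λ v p b → ≤-trans (≤-reflexive (*-identityˡ _)) (degQ v p b)) h1 h2 indep big D D-def gap t at
  open Normalised (λ v → w v ∸ c) v₀ (proj₁ (proj₂ mn)) (n∸n≡0 c)
  shift : ∀ vs → Fits G t (λ _ → Q) vs → size Q * weight (λ v → w v ∸ c) vs ≤ suc q * weightOn (λ v → w v ∸ c) Q →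
    size Q * weight w vs ≤ suc q * weightOn w Q
  shift vs f le rewrite weight-shift w Q c vs (proj₁ f) (proj₂ (proj₂ mn)) | weightOn-shift w Q c (proj₂ (proj₂ mn)) =
    lin 0 le (idt (size Q) (weight (λ v → w v ∸ c) vs) (suc q) c (weightOn (λ v → w v ∸ c) Q))
    where
    idt : ∀ m x r c W → m * (x + r * c) + r * W + 0 ≡ r * (W + c * m) + m * x
    idt = solve-∀

-- Shrinking the uncovered set

δ : ∀ {n} → Fin n → Fin n → ℕ
δ u v = b2n (does (u Fin.≟ v))

-- Tuples are compared as multisets through their multiplicity functions; disjointness and covering
-- become pointwise equations, and the order inside a tuple drops out.
occ : ∀ {n k} → Vec (Fin n) k → Fin n → ℕ
occ [] v = 0
occ (u ∷ us) v = δ u v + occ us v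

occs : ∀ {n k} → List (Vec (Fin n) k) → Fin n → ℕ
occs [] v = 0
occs (x ∷ xs) v = occ x v + occs xs v

δ-refl : ∀ {n} (u : Fin n) → δ u u ≡ 1
δ-refl u = cong b2n (yes-does (u Fin.≟ u) refl)

sum-δ : ∀ n (u : Fin n) (f : Fin n → ℕ) → sumFin n (λ v → δ u v * f v) ≡ f u
sum-δ (suc n) zero f rewrite sum-const n 0 | *-zeroʳ n | +-identityʳ (f zero) = +-identityʳ (f zero)
sum-δ (suc n) (suc u) f = sum-δ n u (λ v → f (suc v))

weight-occ : ∀ {n k} (w : Fin n → ℕ) (vs : Vec (Fin n) k) → weight w vs ≡ sumFin n (λ v → occ vs v * w v)
weight-occ {n} w [] = sym (trans (sum-const n 0) (*-zeroʳ n))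
weight-occ {n} w (u ∷ us) = trans (cong₂ _+_ (sym (sum-δ n u w)) (weight-occ w us))
  (trans (sym (sum-+ n _ _)) (sum-cong n (λ v → sym (*-distribʳ-+ (w v) (δ u v) (occ us v)))))

weight-1 : ∀ {n k} (vs : Vec (Fin n) k) → weight (λ _ → 1) vs ≡ k
weight-1 [] = refl
weight-1 (v ∷ vs) = cong suc (weight-1 vs)

occ-member : ∀ {n k} (vs : Vec (Fin n) k) v → 1 ≤ occ vs v → ∃ λ i → lookup vs i ≡ v
occ-member (u ∷ us) v h with u Fin.≟ v
... | yes p = zero , p
... | no _ with occ-member us v h
... | i , p = suc i , p

copy-distinct : ∀ {n k} (G : BiGraph n) {t : Labelling k} vs → Copy G t vs → ∀ v → occ vs v ≤ 1
copy-distinct G [] c v = z≤n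
copy-distinct G {t} (u ∷ us) c v with u Fin.≟ v
... | no _ = copy-distinct G us (λ i j i≢j → c (suc i) (suc j) (λ { refl → i≢j refl })) v
... | yes refl with occ us u in eq
... | zero = ≤-refl
... | suc x with occ-member us u (≤-trans (s≤s z≤n) (≤-reflexive (sym eq)))
... | i , p = ⊥-elim (true≢false (c zero (suc i) (λ ())) (trans (cong (E G (t zero (suc i)) u) p) (E-irr G (t zero (suc i)) u)))

remove : ∀ {n k} → Subset n → Vec (Fin n) k → Subset n
remove U vs v = U v ∧ does (occ vs v ≤? 0)

remove-occ : ∀ {n k} (U : Subset n) (vs : Vec (Fin n) k) → (∀ i → U (lookup vs i) ≡ true) → (∀ v → occ vs v ≤ 1) →
  ∀ v → b2n (U v) ≡ occ vs v + b2n (remove U vs v)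
remove-occ U vs h d v with occ vs v in eq | d v
... | zero | _ rewrite yes-does (0 ≤? 0) z≤n = cong b2n (sym (Bool.∧-identityʳ (U v)))
... | suc zero | _ rewrite no-does (1 ≤? 0) 1+n≰n with occ-member vs v (≤-reflexive (sym eq))
... | i , refl rewrite h i = refl
remove-occ U vs h d v | suc (suc x) | s≤s ()

remove-⊆ : ∀ {n k} (U : Subset n) (vs : Vec (Fin n) k) → remove U vs ⊆ U
remove-⊆ U vs v p = proj₁ (∧-true {U v} p)

remove-meet : ∀ {n k} (U S : Subset n) (vs : Vec (Fin n) k) → (∀ i → U (lookup vs i) ≡ true) → (∀ v → occ vs v ≤ 1) →
  size (S ∩ U) ≡ weight (λ v → b2n (S v)) vs + size (S ∩ remove U vs)
remove-meet {n} U S vs h d = trans (sum-cong n pt) (trans (sum-+ n _ _) (cong (_+ size (S ∩ remove U vs)) (sym (weight-occ _ vs))))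
  where
  b2n-∧ : ∀ a b → b2n (a ∧ b) ≡ b2n b * b2n a
  b2n-∧ true true = refl
  b2n-∧ true false = refl
  b2n-∧ false true = refl
  b2n-∧ false false = refl
  pt : ∀ v → b2n (S v ∧ U v) ≡ occ vs v * b2n (S v) + b2n (S v ∧ remove U vs v)
  pt v = trans (b2n-∧ (S v) (U v)) (trans (cong (_* b2n (S v)) (remove-occ U vs h d v))
    (trans (*-distribʳ-+ (b2n (S v)) (occ vs v) _) (cong (occ vs v * b2n (S v) +_) (sym (b2n-∧ (S v) (remove U vs v))))))

remove-size : ∀ {n k} (U : Subset n) (vs : Vec (Fin n) k) → (∀ i → U (lookup vs i) ≡ true) → (∀ v → occ vs v ≤ 1) →
  size U ≡ k + size (remove U vs)
remove-size U vs h d = trans (remove-meet U full vs h d) (cong (_+ size (remove U vs)) (weight-1 vs))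

weight-≤ : ∀ {n k} (S : Subset n) (vs : Vec (Fin n) k) → weight (λ v → b2n (S v)) vs ≤ k
weight-≤ S [] = z≤n
weight-≤ S (v ∷ vs) = b2n≤1 (S v) ⊕ weight-≤ S vs

-- The quadratic potential

private
  amgm : ∀ x a c → a ≤ c → 2 * (x * a) ≤ x * x + c * c
  amgm x a c h with ≤-total x a
  ... | inj₁ p = lin (e * e) (*-mono-≤ h h) (idt x e c a (sym (m+[n∸m]≡n p)))
    where
    e = a ∸ x
    idt : ∀ x e c a → a ≡ x + e → 2 * (x * a) + c * c + e * e ≡ x * x + c * c + a * a
    idt x e c .(x + e) refl = idt' x e c
      where
      idt' : ∀ x e c → 2 * (x * (x + e)) + c * c + e * e ≡ x * x + c * c + (x + e) * (x + e)
      idt' = solve-∀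
  ... | inj₂ p = lin (e * e) (*-mono-≤ h h) (idt x e c a (sym (m+[n∸m]≡n p)))
    where
    e = x ∸ a
    idt : ∀ x e c a → x ≡ a + e → 2 * (x * a) + c * c + e * e ≡ x * x + c * c + a * a
    idt .(a + e) e c a refl = idt' a e c
      where
      idt' : ∀ a e c → 2 * ((a + e) * a) + c * c + e * e ≡ (a + e) * (a + e) + c * c + a * a
      idt' = solve-∀

private
  -- Without truncation b - a = x - z, and the right side minus the left is c^2 - (x - z)^2. With
  -- truncation z = 0 and x ≤ x + a ≤ b ≤ c.
  square-step : ∀ x z a b c → a ≤ c → b ≤ c → z ≡ (x + a) ∸ b → x * x + 2 * (z * a) ≤ z * z + 2 * (z * b) + c * c
  square-step x z a b c ha hb eq with ≤-total b (x + a)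
  ... | inj₂ small with trans eq (m≤n⇒m∸n≡0 small)
  ... | refl = ≤-trans (≤-reflexive (+-identityʳ (x * x))) (*-mono-≤ x≤c x≤c)
    where
    x≤c : x ≤ c
    x≤c = ≤-trans (m≤m+n x a) (≤-trans small hb)
  square-step x z a b c ha hb eq | inj₁ large with ≤-total a b
  ... | inj₁ a≤b = up (b ∸ a) (sym (m+[n∸m]≡n a≤b)) (+-cancelʳ-≡ a _ _ (trans (sym sum) (trans (cong (z +_) (sym (m∸n+n≡m a≤b))) (sym (+-assoc z (b ∸ a) a)))))
    (≤-trans (m∸n≤m b a) hb)
    where
    sum : z + b ≡ x + a
    sum = trans (cong (_+ b) eq) (m∸n+n≡m large)
    up : ∀ e → b ≡ a + e → x ≡ z + e → e ≤ c → x * x + 2 * (z * a) ≤ z * z + 2 * (z * b) + c * c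
    up e refl refl h = lin 0 (*-mono-≤ h h) (idt z e a c)
      where
      idt : ∀ z e a c → (z + e) * (z + e) + 2 * (z * a) + c * c + 0 ≡ z * z + 2 * (z * (a + e)) + c * c + e * e
      idt = solve-∀
  ... | inj₂ b≤a = down (a ∸ b) (sym (m+[n∸m]≡n b≤a)) (+-cancelʳ-≡ b _ _ (trans sum (trans (cong (x +_) (sym (m∸n+n≡m b≤a))) (sym (+-assoc x (a ∸ b) b)))))
    (≤-trans (m∸n≤m a b) ha)
    where
    sum : z + b ≡ x + a
    sum = trans (cong (_+ b) eq) (m∸n+n≡m large)
    down : ∀ e → a ≡ b + e → z ≡ x + e → e ≤ c → x * x + 2 * (z * a) ≤ z * z + 2 * (z * b) + c * c
    down e refl refl h = lin 0 (*-mono-≤ h h) (idt x e b c)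
      where
      idt : ∀ x e b c → x * x + 2 * ((x + e) * (b + e)) + c * c + 0 ≡ (x + e) * (x + e) + 2 * ((x + e) * b) + c * c + e * e
      idt = solve-∀

-- The shortfall x = p ∸ y of a tracked set, when p drops by a and y by b.
shortfall-step : ∀ p' y' a b c → a ≤ c → b ≤ c →
  let x = (p' + a) ∸ (y' + b) ; x' = p' ∸ y' in
  x' * x' + 2 * (x * a) ≤ x * x + 2 * (x * b) + c * c
shortfall-step p' y' a b c ha hb with ≤-total p' y'
... | inj₁ le rewrite m≤n⇒m∸n≡0 le = lin (2 * (x * b)) (amgm x a c ha) (idt (x * a) (x * x) (x * b) (c * c))
  where
  x = (p' + a) ∸ (y' + b)
  idt : ∀ p q r s → 2 * p + (q + s) + 2 * r ≡ q + 2 * r + s + 2 * p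
  idt = solve-∀
... | inj₂ ge = subst (λ z → x' * x' + 2 * (z * a) ≤ z * z + 2 * (z * b) + c * c) (sym x-eq) (square-step x' ((x' + a) ∸ b) a b c ha hb refl)
  where
  x' = p' ∸ y'
  x-eq : (p' + a) ∸ (y' + b) ≡ (x' + a) ∸ b
  x-eq = trans (cong (λ z → (z + a) ∸ (y' + b)) (sym (m+[n∸m]≡n ge)))
    (trans (cong (_∸ (y' + b)) (+-assoc y' x' a)) ([m+n]∸[m+o]≡n∸o y' (x' + a) b))

-- Families of tracked sets are indexed by a kind and a pair of vertices.
module _ {n : ℕ} where

 abstract

  total : (Fin 4 → Vec (Fin n) 2 → ℕ) → ℕ
  total f = sumFin 4 (λ κ → sumVec 2 (f κ))

  total-mono : ∀ {f g} → (∀ κ p → f κ p ≤ g κ p) → total f ≤ total g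
  total-mono h = sum-mono 4 (λ κ → sumVec-mono 2 (h κ))

  total-cong : ∀ {f g} → (∀ κ p → f κ p ≡ g κ p) → total f ≡ total g
  total-cong h = sum-cong 4 (λ κ → sumVec-cong 2 (h κ))

  total-+ : ∀ f g → total (λ κ p → f κ p + g κ p) ≡ total f + total g
  total-+ f g = trans (sum-cong 4 (λ κ → sumVec-+ 2 (f κ) (g κ))) (sum-+ 4 (λ κ → sumVec 2 (f κ)) (λ κ → sumVec 2 (g κ)))

  total-* : ∀ c f → total (λ κ p → c * f κ p) ≡ c * total f
  total-* c f = trans (sum-cong 4 (λ κ → sumVec-* 2 c (f κ))) (sum-* 4 c (λ κ → sumVec 2 (f κ)))

  total-const : ∀ c → total (λ _ _ → c) ≡ 4 * (n * n * c)
  total-const c = trans (sum-cong 4 (λ _ → sumVec-const {n} 2 c)) (trans (sum-const 4 (n ^ 2 * c))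
    (cong (λ z → 4 * (n * z * c)) (*-identityʳ n)))

  total-swap : ∀ m (f : Fin m → Fin 4 → Vec (Fin n) 2 → ℕ) →
    sumFin m (λ v → total (f v)) ≡ total (λ κ p → sumFin m (λ v → f v κ p))
  total-swap zero f = sym (trans (total-const 0) (trans (cong (4 *_) (*-zeroʳ (n * n))) refl))
  total-swap (suc m) f = trans (cong (total (f zero) +_) (total-swap m (λ v → f (suc v))))
    (sym (total-+ (f zero) (λ κ p → sumFin m (λ v → f (suc v) κ p))))

  total-rows : ∀ f (g : Fin n → ℕ) → (∀ v u → g v ≤ f zero (v ∷ u ∷ []) +
    (f (suc zero) (v ∷ u ∷ []) + (f (suc (suc zero)) (v ∷ u ∷ []) + 0))) → n * sumFin n g ≤ total f
  total-rows f g h = ≤-trans (≤-reflexive (trans (sym (sum-* n n g)) (sum-cong n (λ v → sym (sum-const n (g v))))))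
    (≤-trans (sum-mono n (λ v → sum-mono n (h v)))
    (≤-trans (≤-reflexive (trans (sum-cong n (λ v → trans (sum-+ n (λ u → f zero (v ∷ u ∷ [])) _)
        (cong (sumFin n (λ u → f zero (v ∷ u ∷ [])) +_) (trans (sum-+ n (λ u → f (suc zero) (v ∷ u ∷ [])) _)
          (cong (sumFin n (λ u → f (suc zero) (v ∷ u ∷ [])) +_) (sum-cong n (λ u → +-identityʳ (f (suc (suc zero)) (v ∷ u ∷ [])))))))))
      (trans (sum-+ n (λ v → sumFin n (λ u → f zero (v ∷ u ∷ []))) _)
        (cong (sumVec 2 (f zero) +_) (sum-+ n (λ v → sumFin n (λ u → f (suc zero) (v ∷ u ∷ []))) _)))))
      (+-monoʳ-≤ (sumVec 2 (f zero)) (+-monoʳ-≤ (sumVec 2 (f (suc zero))) (m≤m+n (sumVec 2 (f (suc (suc zero)))) _)))))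

  total-pairs : ∀ f → sumFin n (λ v → sumFin n (λ u → f (suc (suc (suc zero))) (v ∷ u ∷ []))) ≤ total f
  total-pairs f = ≤-trans (m≤m+n _ 0) (≤-trans (m≤n+m _ (sumVec 2 (f (suc (suc zero)))))
    (≤-trans (m≤n+m _ (sumVec 2 (f (suc zero)))) (m≤n+m _ (sumVec 2 (f zero)))))

module Packing {n : ℕ} (G : BiGraph n) (q : ℕ) (t : Labelling (suc q))
  (S : Fin 4 → Vec (Fin n) 2 → Subset n) (target : Fin 4 → Vec (Fin n) 2 → ℕ) (target≤n : ∀ κ p → target κ p ≤ n)
  (B μ : ℕ) (μ-large : suc (B + suc q) ≤ μ) where

  r : ℕ
  r = suc q

  -- The lag behind the proportional share target * |U| / n, multiplied by n to avoid division.
  -- Subtracting B from |U| allows for the vertices of U that the copies must avoid.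
  shortfall : Subset n → Fin 4 → Vec (Fin n) 2 → ℕ
  shortfall U κ p = target κ p * (size U ∸ B) ∸ n * size (S κ p ∩ U)

  Φ : Subset n → ℕ
  Φ U = total (λ κ p → shortfall U κ p * shortfall U κ p)

  C : ℕ
  C = 4 * (n * n * ((n * r) * (n * r)))

  LightCopies : Subset n → Set
  LightCopies U = Σ (Subset n) λ Q → Q ⊆ U × size U ≤ size Q + B ×
    (∀ w → ∃ λ vs → Fits G t (λ _ → Q) vs × size Q * weight w vs ≤ r * weightOn w Q)

  -- A vertex is charged the shortfalls of all tracked sets containing it, so a light copy spares
  -- the sets that lag. A set with positive shortfall has less than its share in U; hence the
  -- fair-share bound makes the expected decrease of the targets pay for the vertices removed, and
  -- only the squares of the changes, collected in C, remain.
  step : ∀ U → μ ≤ size U → LightCopies U → ∃ λ vs → Fits G t (λ _ → U) vs × Φ (remove U vs) ≤ Φ U + C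
  step U μ≤U (Q , Q⊆U , Q-big , light) = vs , fits , drop
    where
    M = size U ∸ B
    x = shortfall U
    w : Fin n → ℕ
    w v = total (λ κ p → x κ p * b2n (S κ p v))
    vs = proj₁ (light w)
    fits : Fits G t (λ _ → U) vs
    fits = (λ i → Q⊆U _ (proj₁ (proj₁ (proj₂ (light w))) i)) , proj₂ (proj₁ (proj₂ (light w)))
    dist : ∀ v → occ vs v ≤ 1
    dist = copy-distinct G vs (proj₂ fits)
    U' = remove U vs
    size-eq : size U ≡ r + size U'
    size-eq = remove-size U vs (proj₁ fits) dist
    M-eq : M ≡ size U' ∸ B + r
    M-eq = trans (cong (_∸ B) (trans size-eq (+-comm r (size U')))) (trans (cong (_∸ B) (+-comm (size U') r))
      (trans (+-∸-assoc r B≤U') (+-comm r _)))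
      where
      B≤U' : B ≤ size U'
      B≤U' = +-cancelˡ-≤ r B (size U') (≤-trans (≤-trans (≤-reflexive (+-comm r B)) (n≤1+n _)) (≤-trans μ-large (≤-trans μ≤U (≤-reflexive size-eq))))
    hits : Fin 4 → Vec (Fin n) 2 → ℕ
    hits κ p = weight (λ v → b2n (S κ p v)) vs
    weight-w : weight w vs ≡ total (λ κ p → x κ p * hits κ p)
    weight-w = trans (weight-occ w vs) (trans (sum-cong n (λ v → sym (total-* (occ vs v) _))) (trans (total-swap n _)
      (total-cong (λ κ p → trans (sum-cong n (λ v → swap (occ vs v) (x κ p) (b2n (S κ p v))))
        (trans (sum-* n (x κ p) _) (cong (x κ p *_) (sym (weight-occ _ vs))))))))
      where
      swap : ∀ a b c → a * (b * c) ≡ b * (a * c)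
      swap = solve-∀
    weightOn-w : weightOn w U ≡ total (λ κ p → x κ p * size (S κ p ∩ U))
    weightOn-w = trans (sum-cong n (λ v → sym (total-* (b2n (U v)) _))) (trans (total-swap n _)
      (total-cong (λ κ p → trans (sum-cong n (λ v → pt (U v) (S κ p v) (x κ p))) (sum-* n (x κ p) _))))
      where
      pt : ∀ a b x → b2n a * (x * b2n b) ≡ x * b2n (b ∧ a)
      pt true true x = +-identityʳ (x * 1)
      pt true false x = +-identityʳ (x * 0)
      pt false true x = sym (*-zeroʳ x)
      pt false false x = sym (*-zeroʳ x)
    Σt = total (λ κ p → x κ p * target κ p)
    deficit : ∀ κ p → n * (x κ p * size (S κ p ∩ U)) ≤ M * (x κ p * target κ p)
    deficit κ p with ≤-total (target κ p * M) (n * size (S κ p ∩ U))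
    ... | inj₁ le rewrite m≤n⇒m∸n≡0 le = ≤-trans (≤-reflexive (*-zeroʳ n)) z≤n
    ... | inj₂ ge = ≤-trans (≤-reflexive (idt n (x κ p) (size (S κ p ∩ U)))) (≤-trans (mul (x κ p) ge) (≤-reflexive (idt' (x κ p) (target κ p) M)))
      where
      idt : ∀ n x s → n * (x * s) ≡ x * (n * s)
      idt = solve-∀
      idt' : ∀ x t m → x * (t * m) ≡ m * (x * t)
      idt' = solve-∀
    weight-bound : n * weight w vs ≤ r * Σt
    weight-bound = cancel-pos M (m<n⇒0<n∸m (≤-trans (s≤s (m≤m+n B r)) (≤-trans μ-large μ≤U)))
      (≤-trans (≤-trans (≤-reflexive (idt M n (weight w vs))) (mul n (≤-trans (*-monoˡ-≤ (weight w vs) M≤Q)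
        (≤-trans (proj₂ (proj₂ (light w))) (mul r (≤-trans (weightOn-mono w Q⊆U) (≤-reflexive weightOn-w)))))))
      (≤-trans (≤-reflexive (idt' n r _)) (≤-trans (mul r (≤-trans (≤-reflexive (sym (total-* n _))) (≤-trans (total-mono deficit) (≤-reflexive (total-* M _)))))
        (≤-reflexive (idt' r M Σt)))))
      where
      M≤Q : M ≤ size Q
      M≤Q = ≤-trans (∸-monoˡ-≤ B Q-big) (≤-reflexive (m+n∸n≡m (size Q) B))
      idt : ∀ m n x → m * (n * x) ≡ n * (m * x)
      idt = solve-∀
      idt' : ∀ n r x → n * (r * x) ≡ r * (n * x)
      idt' = solve-∀
    pointwise : ∀ κ p → shortfall U' κ p * shortfall U' κ p + 2 * r * (x κ p * target κ p) ≤
      x κ p * x κ p + 2 * n * (x κ p * hits κ p) + (n * r) * (n * r)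
    pointwise κ p = ≤-trans (≤-reflexive (cong (shortfall U' κ p * shortfall U' κ p +_) (idt r (x κ p) (target κ p))))
      (≤-trans (subst (λ z → shortfall U' κ p * shortfall U' κ p + 2 * (z * (target κ p * r)) ≤ z * z + 2 * (z * (n * hits κ p)) + (n * r) * (n * r)) (sym x-eq)
        (shortfall-step (target κ p * (size U' ∸ B)) (n * size (S κ p ∩ U')) (target κ p * r) (n * hits κ p) (n * r)
          (*-monoˡ-≤ r (target≤n κ p)) (mul n (weight-≤ (S κ p) vs))))
        (≤-reflexive (cong (λ z → x κ p * x κ p + z + (n * r) * (n * r)) (idt' n (x κ p) (hits κ p)))))
      where
      x-eq : x κ p ≡ (target κ p * (size U' ∸ B) + target κ p * r) ∸ (n * size (S κ p ∩ U') + n * hits κ p)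
      x-eq = cong₂ _∸_ (trans (cong (target κ p *_) M-eq) (*-distribˡ-+ (target κ p) (size U' ∸ B) r))
        (trans (cong (n *_) (trans (remove-meet U (S κ p) vs (proj₁ fits) dist) (+-comm (hits κ p) _))) (*-distribˡ-+ n (size (S κ p ∩ U')) (hits κ p)))
      idt : ∀ r x t → 2 * r * (x * t) ≡ 2 * (x * (t * r))
      idt = solve-∀
      idt' : ∀ n x h → 2 * (x * (n * h)) ≡ 2 * n * (x * h)
      idt' = solve-∀
    drop : Φ U' ≤ Φ U + C
    drop = arith (Φ U') (Φ U) C r n Σt (weight w vs) summed weight-bound
      where
      summed : Φ U' + 2 * r * Σt ≤ Φ U + 2 * n * weight w vs + C
      summed = ≤-trans (≤-reflexive (sym (trans (total-+ _ (λ κ p → 2 * r * (x κ p * target κ p))) (cong (Φ U' +_) (total-* (2 * r) _)))))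
        (≤-trans (total-mono pointwise) (≤-reflexive (trans (total-+ _ (λ _ _ → (n * r) * (n * r))) (cong₂ _+_
          (trans (total-+ _ (λ κ p → 2 * n * (x κ p * hits κ p))) (cong (Φ U +_) (trans (total-* (2 * n) _) (cong (2 * n *_) (sym weight-w)))))
          (total-const _)))))
      arith : ∀ a b c r n s w → a + 2 * r * s ≤ b + 2 * n * w + c → n * w ≤ r * s → a ≤ b + c
      arith a b c r n s w h1 h2 = lin 0 (h1 ⊕ mul 2 h2) (idt a b c r n s w)
        where
        idt : ∀ a b c r n s w → a + (b + 2 * n * w + c + 2 * (r * s)) + 0 ≡ b + c + (a + 2 * r * s + 2 * (n * w))
        idt = solve-∀

  Packed : Subset n → Subset n → Set
  Packed U₀ U = Σ (List (Vec (Fin n) r)) λ L → All (Copy G t) L × (∀ v → occs L v + b2n (U v) ≡ b2n (U₀ v))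

  module _ (U₀ : Subset n) (start : Φ U₀ ≤ 0)
    (light : ∀ U → U ⊆ U₀ → μ ≤ size U → Φ U ≤ n * C → LightCopies U) where

    -- Here k counts the copies removed. Each removes at least one vertex, so k + |U| ≤ n persists
    -- and the potential never exceeds n C.
    run : ∀ fuel k U → size U ≤ fuel → U ⊆ U₀ → k + size U ≤ n → Φ U ≤ k * C → Packed U₀ U →
      ∃ λ U' → Packed U₀ U' × suc (size U') ≤ μ
    run fuel k U hf sub hk hΦ P with μ ≤? size U
    ... | no small = U , P , ≰⇒> small
    run zero k U hf sub hk hΦ P | yes large = ⊥-elim (1+n≰n (≤-trans (≤-trans (s≤s z≤n) (≤-trans μ-large large)) hf))
    run (suc fuel) k U hf sub hk hΦ (L , cs , os) | yes large
      with step U large (light U sub large (≤-trans hΦ (*-monoˡ-≤ C (≤-trans (m≤m+n k _) hk))))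
    ... | vs , f , h = run fuel (suc k) (remove U vs)
        (≤-pred (≤-trans (s≤s (m≤n+m _ q)) (≤-trans (≤-reflexive (sym size-eq)) hf)))
        (λ v p → sub v (remove-⊆ U vs v p))
        (≤-trans (≤-trans (≤-reflexive (sym (+-suc k _))) (+-monoʳ-≤ k (≤-trans (s≤s (m≤n+m _ q)) (≤-reflexive (sym size-eq))))) hk)
        (≤-trans h (≤-trans (+-monoˡ-≤ C hΦ) (≤-reflexive (+-comm (k * C) C))))
        (vs ∷ L , proj₂ f ∷ cs , λ v → trans (idt (occ vs v) (occs L v) (b2n (remove U vs v)))
          (trans (cong (occs L v +_) (sym (remove-occ U vs (proj₁ f) dist v))) (os v)))
      where
      dist = copy-distinct G vs (proj₂ f)
      size-eq = remove-size U vs (proj₁ f) dist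
      idt : ∀ a b c → a + b + c ≡ b + (a + c)
      idt = solve-∀

    pack : ∃ λ U → Packed U₀ U × suc (size U) ≤ μ
    pack = run (size U₀) 0 U₀ ≤-refl (λ _ p → p) (size≤n U₀) start ([] , [] , λ v → refl)

-- What the tracked sets force on the uncovered set

arith-degree : ∀ n r t f a au eu e B k p m M → 1 ≤ n → n ≤ t + f + a → r * a ≤ n + e → t * M ≤ n * eu + n * k → eu + au ≤ m →
  m ≤ M + B → M ≤ m → (e + r * f) * m ≤ n * p → r * au ≤ m + r * B + r * k + p
arith-degree n r t f a au eu e B k p m M 1≤n h1 h2 h3 h4 h5 h6 h7 = cancel-pos n 1≤n
  (lin 0 (mul M h2 ⊕ mul r h3 ⊕ mul (M * r) h1 ⊕ mul (r * n) h5 ⊕ mul (e + r * f + n) h6 ⊕ h7 ⊕ mul (r * n) h4)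
    (idt n r t f a au eu e B k p m M))
  where
  idt : ∀ n r t f a au eu e B k p m M → n * (r * au) + (M * (n + e) + (r * (n * eu + n * k) + (M * r * (t + f + a) +
      (r * n * (M + B) + ((e + r * f + n) * m + (n * p + r * n * m)))))) + 0 ≡
    n * (m + r * B + r * k + p) + (M * (r * a) + (r * (t * M) + (M * r * n + (r * n * m + ((e + r * f + n) * M + ((e + r * f) * m + r * n * (eu + au)))))))
  idt = solve-∀

arith-member : ∀ n r t f x k su S m M B d z Z → 1 ≤ M → n ≤ t + f + x → t * M ≤ n * su + n * k → su + S ≤ m → m ≤ M + B →
  m ≤ r * S + B + d → M ≤ m → 2 * r * f ≤ z → n ≤ Z * z → 2 * Z * (B + r * B + d + r * k) ≤ M → n ≤ r * x + z
arith-member n r t f x k su S m M B d z Z 1≤M h1 h2 h3 h4 h5 h6 h7 h8 h9 = *-cancelˡ-≤ 2 (cancel-pos M 1≤M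
  (lin 0 (mul (2 * M * r) h1 ⊕ mul (2 * r) h2 ⊕ mul (2 * r * n) h3 ⊕ mul (2 * r * n) h4 ⊕ mul (2 * n) h5 ⊕ mul (2 * n) h6 ⊕
          mul M h7 ⊕ mul (2 * (B + r * B + d + r * k)) h8 ⊕ mul z h9) (idt n r t f x k su S m M B d z Z)))
  where
  idt : ∀ n r t f x k su S m M B d z Z → M * (2 * n) + (2 * M * r * (t + f + x) + (2 * r * (n * su + n * k) + (2 * r * n * m +
      (2 * r * n * (M + B) + (2 * n * (r * S + B + d) + (2 * n * m + (M * z + (2 * (B + r * B + d + r * k) * (Z * z) + z * M)))))))) + 0 ≡
    M * (2 * (r * x + z)) + (2 * M * r * n + (2 * r * (t * M) + (2 * r * n * (su + S) + (2 * r * n * m + (2 * n * m + (2 * n * M +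
      (M * (2 * r * f) + (2 * (B + r * B + d + r * k) * n + z * (2 * Z * (B + r * B + d + r * k))))))))))
  idt = solve-∀

-- Here z is the size of `Z v`, more than l below n / r. Tracking its complement keeps its trace zu
-- on U near z m / n, too small to hold all but C of nearly m / r vertices.
arith-contra : ∀ n r g t f z l k cu zu m M B C d S → 1 ≤ n → 1 ≤ r → n ≤ t + f + z → t * M ≤ n * cu + n * k → zu + cu ≤ m →
  suc (r * (z + l)) ≤ n → S ≤ zu + C → m ≤ r * S + B + d → m ≤ M + B → M ≤ m → n ≤ 16 * g * l → 32 * g * f ≤ n →
  suc (64 * g * (d + B + r * (B + C + k))) ≤ m → ⊥
arith-contra (suc n) (suc r) g t f z l k cu zu m M B C d S _ _ h1 h2 h3 h4 h5 h6 h7 h8 h9 h10 h11 = 1+n≰n {0}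
  (lin (64 * g * m + (2 * r + 1) * m * suc n + n)
    (mul (64 * g * suc r * M) h1 ⊕ mul (64 * g * suc r) h2 ⊕ mul (64 * g * suc r * suc n) h3 ⊕ mul (64 * g * m) h4 ⊕
     mul (64 * g * suc r * suc n) h5 ⊕ mul (64 * g * suc n) h6 ⊕ mul (64 * g * suc r * suc n) h7 ⊕ mul (64 * g * suc r * (z + f)) h8 ⊕
     mul (4 * suc r * m) h9 ⊕ mul (2 * suc r * m) h10 ⊕ mul (suc n) h11) (idt n r g t f z l k cu zu m M B C d S))
  where
  idt : ∀ n r g t f z l k cu zu m M B C d S → 1 + (64 * g * suc r * M * (t + f + z) + (64 * g * suc r * (suc n * cu + suc n * k) +
      (64 * g * suc r * suc n * m + (64 * g * m * suc n + (64 * g * suc r * suc n * (zu + C) + (64 * g * suc n * (suc r * S + B + d) +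
      (64 * g * suc r * suc n * (M + B) + (64 * g * suc r * (z + f) * m + (4 * suc r * m * (16 * g * l) + (2 * suc r * m * suc n + suc n * m)))))))))) +
      (64 * g * m + (2 * r + 1) * m * suc n + n) ≡
    0 + (64 * g * suc r * M * suc n + (64 * g * suc r * (t * M) + (64 * g * suc r * suc n * (zu + cu) + (64 * g * m * suc (suc r * (z + l)) +
      (64 * g * suc r * suc n * S + (64 * g * suc n * m + (64 * g * suc r * suc n * m + (64 * g * suc r * (z + f) * M + (4 * suc r * m * suc n +
      (2 * suc r * m * (32 * g * f) + suc n * suc (64 * g * (d + B + suc r * (B + C + k)))))))))))))
  idt = solve-∀

private
  -- Each of the t lagging sets contributes (n k)^2, of order n^4, to a potential of order n^5.
  count-bound : ∀ n r k K₂ t → 1 ≤ n → n ≤ K₂ * k → (n * k) * (n * k) * t ≤ n * (4 * (n * n * ((n * r) * (n * r)))) →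
    t ≤ 4 * (r * K₂ * (r * K₂)) * n
  count-bound n r k K₂ t 1≤n h1 h2 = cancel-pos n 1≤n (cancel-pos n 1≤n (cancel-pos n 1≤n (cancel-pos n 1≤n
    (≤-trans (≤-reflexive (idt₁ n t)) (≤-trans (mul (n * n * t) (*-mono-≤ h1 h1))
      (≤-trans (≤-reflexive (idt₂ n t K₂ k)) (≤-trans (mul (K₂ * K₂) h2) (≤-reflexive (idt₃ n r K₂)))))))))
    where
    idt₁ : ∀ n t → n * (n * (n * (n * t))) ≡ n * n * t * (n * n)
    idt₁ = solve-∀
    idt₂ : ∀ n t K k → n * n * t * (K * k * (K * k)) ≡ K * K * ((n * k) * (n * k) * t)
    idt₂ = solve-∀
    idt₃ : ∀ n r K → K * K * (n * (4 * (n * n * ((n * r) * (n * r))))) ≡ n * (n * (n * (n * (4 * (r * K * (r * K)) * n))))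
    idt₃ = solve-∀

  ξ-bound : ∀ r B k ρ τ C → B + (C + (k + (ρ + 1))) ≡ τ → suc r * B + r * k + ρ + suc r ≤ suc r * τ
  ξ-bound r B k ρ .(B + (C + (k + (ρ + 1)))) C refl = lin (suc r * C + k + r * ρ) (≤-refl {0}) (idt r B k ρ C)
    where
    idt : ∀ r B k ρ C → suc r * B + r * k + ρ + suc r + 0 + (suc r * C + k + r * ρ) ≡ suc r * (B + (C + (k + (ρ + 1)))) + 0
    idt = solve-∀

  d-bound : ∀ q G₀ ξ τ → 1 ≤ τ → ξ ≤ suc (suc q) * τ → suc ((4 * suc q + 1) * (suc q * (G₀ * ξ) + suc q * ξ)) ≤
    (1 + (4 * suc q + 1) * (suc q * G₀ + suc q) * suc (suc q)) * τ
  d-bound q G₀ ξ τ h1 h2 = lin 0 (h1 ⊕ mul ((4 * suc q + 1) * (suc q * G₀ + suc q)) h2) (idt q G₀ ξ τ)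
    where
    idt : ∀ q G₀ ξ τ → suc ((4 * suc q + 1) * (suc q * (G₀ * ξ) + suc q * ξ)) + (τ + (4 * suc q + 1) * (suc q * G₀ + suc q) * (suc (suc q) * τ)) + 0 ≡
      (1 + (4 * suc q + 1) * (suc q * G₀ + suc q) * suc (suc q)) * τ + (1 + (4 * suc q + 1) * (suc q * G₀ + suc q) * ξ)
    idt = solve-∀

  scale-a : ∀ g r B k τ d G m → B ≤ τ → k ≤ τ → d ≤ G * τ → (64 * g * (G + suc r) + 1) * τ ≤ m →
    2 * (16 * g) * (B + r * B + d + r * k) + B ≤ m
  scale-a g r B k τ d G m h1 h2 h3 h4 =
    lin (32 * (G * τ * g) + 32 * (τ * g)) (mul (32 * g) h3 ⊕ h4 ⊕ mul (32 * g + 32 * g * r + 1) h1 ⊕ mul (32 * g * r) h2) (idt g r B k τ d G m)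
    where
    idt : ∀ g r B k τ d G m → 2 * (16 * g) * (B + r * B + d + r * k) + B + (32 * g * (G * τ) + (m + ((32 * g + 32 * g * r + 1) * τ + 32 * g * r * τ))) +
      (32 * (G * τ * g) + 32 * (τ * g)) ≡ m + (32 * g * d + ((64 * g * (G + suc r) + 1) * τ + ((32 * g + 32 * g * r + 1) * B + 32 * g * r * k)))
    idt = solve-∀

  scale-b : ∀ g r B C k τ d G m → 1 ≤ τ → B ≤ τ → B + C + k ≤ τ → d ≤ G * τ → (64 * g * (G + suc r) + 1) * τ ≤ m →
    suc (64 * g * (d + B + r * (B + C + k))) ≤ m
  scale-b g r B C k τ d G m h0 h1 h2 h3 h4 =
    lin 0 (mul (64 * g) h3 ⊕ h4 ⊕ mul (64 * g) h1 ⊕ mul (64 * g * r) h2 ⊕ h0) (idt g r B C k τ d G m)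
    where
    idt : ∀ g r B C k τ d G m → suc (64 * g * (d + B + r * (B + C + k))) + (64 * g * (G * τ) + (m + (64 * g * τ + (64 * g * r * τ + τ)))) + 0 ≡
      m + (64 * g * d + ((64 * g * (G + suc r) + 1) * τ + (64 * g * B + (64 * g * r * (B + C + k) + 1))))
    idt = solve-∀

  scale-c : ∀ g r B τ d G m → 1 ≤ g → B ≤ τ → d ≤ G * τ → (64 * g * (G + suc r) + 1) * τ ≤ m → 2 * (B + d) ≤ m
  scale-c g r B τ d G m h0 h1 h3 h4 =
    lin (62 * (G * τ * g) + 62 * (τ * g) + 64 * (τ * g * r) + τ) (mul 2 h3 ⊕ h4 ⊕ mul 2 h1 ⊕ mul (2 * τ * (G + 1)) h0) (idt g r B τ d G m)
    where
    idt : ∀ g r B τ d G m → 2 * (B + d) + (2 * (G * τ) + (m + (2 * τ + 2 * τ * (G + 1) * g))) + (62 * (G * τ * g) + 62 * (τ * g) + 64 * (τ * g * r) + τ) ≡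
      m + (2 * d + ((64 * g * (G + suc r) + 1) * τ + (2 * B + 2 * τ * (G + 1) * 1)))
    idt = solve-∀

-- ξ, δ and d of light-copy are all bounded multiples of one small quantity τ.
module Scale (q : ℕ) where

  r D G₀ G₁ G₂ : ℕ
  r = suc q
  D = 8 * (suc q * suc q)
  G₀ = 8 * (suc q * suc q) * D ^ suc q
  G₁ = (4 * suc q + 1) * (suc q * G₀ + suc q)
  G₂ = 1 + G₁ * suc (suc q)

module Tracking {n : ℕ} (G : BiGraph n) (q g e f k K₂ K₄ : ℕ) (t : Labelling (suc q)) (at : Anti t)
  (1≤n : 1 ≤ n) (1≤g : 1 ≤ g)
  (deg : ∀ b v → suc q * size (A G b v) ≤ n + e)
  (ns : NonSparse G (suc q) g)
  (k-large : n ≤ K₂ * k)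
  (n-large : 8 * g ≤ n)
  (e-small : 8 * g * e ≤ n)
  (f-small : 32 * g * (suc q * f) ≤ n) where

  r : ℕ
  r = suc q

  l : ℕ
  l = proj₁ (floor n (8 * g) (≤-trans 1≤g (m≤m+n g _)))
  l-low : 8 * g * l ≤ n
  l-low = proj₁ (proj₂ (floor n (8 * g) (≤-trans 1≤g (m≤m+n g _))))
  l-high : n ≤ 16 * g * l
  l-high = arith n g l n-large (proj₂ (proj₂ (floor n (8 * g) (≤-trans 1≤g (m≤m+n g _)))))
    where
    arith : ∀ n g l → 8 * g ≤ n → suc n ≤ 8 * g * l + 8 * g → n ≤ 16 * g * l
    arith n g zero h1 h2 = ⊥-elim (1+n≰n (≤-trans h2 (≤-trans (≤-reflexive (cong (_+ 8 * g) (*-zeroʳ (8 * g)))) h1)))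
    arith n g (suc l) h1 h2 = lin (8 * g * l + 1) h2 (idt n g l)
      where
      idt : ∀ n g l → n + (8 * g * suc l + 8 * g) + (8 * g * l + 1) ≡ 16 * g * suc l + suc n
      idt = solve-∀

  -- For u in Z v the out-non-neighbourhoods of u and v nearly coincide, so Z v is sparse.
  Z : Fin n → Subset n
  Z v u = A G true v u ∧ does (n ≤? r * size (A G true v ∩ A G true u) + l)

  Z-small : ∀ v → suc (r * (size (Z v) + l)) ≤ n
  Z-small v = nonsparse-small G r g (s≤s z≤n) ns true (Z v) l few l-low
    where
    -- Out-neighbours of u inside `Z v` lie in the out-non-neighbourhood of v but not in that of u,
    -- and the two sets differ little.
    each : ∀ u → Z v u ≡ true → r * size (Z v ∩ E G true u) ≤ e + l
    each u p = arith r n e l (size (A G true v)) (size (A G true v ∩ A G true u)) (size (Z v ∩ E G true u)) (deg true v)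
      (does-yes (n ≤? _) (proj₂ (∧-true {A G true v u} p)))
      (≤-trans (+-monoʳ-≤ (size (A G true v ∩ A G true u)) (size-mono {S = Z v ∩ E G true u} {A G true v ∩ ∁ (A G true u)} sub))
        (≤-reflexive (sym (size-split (A G true v) (A G true u)))))
      where
      sub : (Z v ∩ E G true u) ⊆ (A G true v ∩ ∁ (A G true u))
      sub x h = let (a , b) = ∧-true {Z v x} h in ∧-intro (proj₁ (∧-true a)) (trans (cong (λ z → not (not z)) b) refl)
      arith : ∀ r n e l a i y → r * a ≤ n + e → n ≤ r * i + l → i + y ≤ a → r * y ≤ e + l
      arith r n e l a i y h1 h2 h3 = lin 0 (h1 ⊕ h2 ⊕ mul r h3) (idt r n e l a i y)
        where
        idt : ∀ r n e l a i y → r * y + (n + e + (r * i + l + r * a)) + 0 ≡ e + l + (r * a + (n + r * (i + y)))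
        idt = solve-∀
    few : 4 * g * edges G true (Z v) ≤ n * n
    few = ≤-trans (≤-trans (mul (4 * g) (edges-bound G true (Z v) (λ _ → e + l) (λ u p → ≤-trans (m≤m+n _ (q * _)) (each u p))))
      (≤-reflexive (trans (cong (4 * g *_) (sum-const n (e + l))) (idt g n e l)))) (mul n (arith g n e l e-small l-low))
      where
      idt : ∀ g n e l → 4 * g * (n * (e + l)) ≡ n * (4 * g * (e + l))
      idt = solve-∀
      arith : ∀ g n e l → 8 * g * e ≤ n → 8 * g * l ≤ n → 4 * g * (e + l) ≤ n
      arith g n e l h1 h2 = *-cancelˡ-≤ 2 (lin 0 (h1 ⊕ h2) (idt' g n e l))
        where
        idt' : ∀ g n e l → 2 * (4 * g * (e + l)) + (n + n) + 0 ≡ 2 * n + (8 * g * e + 8 * g * l)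
        idt' = solve-∀

  -- Kinds 0 and 1 control the semidegrees. Kinds 2 and 3 exclude large independent sets I of U: for v in I,
  -- kind 3 forces nearly all of I into Z v, and kind 2 keeps Z v small.
  S : Fin 4 → Vec (Fin n) 2 → Subset n
  S zero (v ∷ u ∷ []) = E G true v
  S (suc zero) (v ∷ u ∷ []) = E G false v
  S (suc (suc zero)) (v ∷ u ∷ []) = ∁ (Z v)
  S (suc (suc (suc zero))) (v ∷ u ∷ []) x = E G true v x ∨ E G true u x

  -- Lowered by f, a bound for the number of vertices taken by the absorbing family, so that no set
  -- lags at the start.
  target : Fin 4 → Vec (Fin n) 2 → ℕ
  target κ p = size (S κ p) ∸ f

  target≤n : ∀ κ p → target κ p ≤ n
  target≤n κ p = ≤-trans (m∸n≤m _ f) (size≤n (S κ p))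

  target-bound : ∀ κ p → size (S κ p) ≤ target κ p + f
  target-bound κ p = ≤-trans (m≤n+m∸n (size (S κ p)) f) (≤-reflexive (+-comm f _))

  -- B bounds the vertices lagging in one of the kinds 0 to 2, and B n bounds the lagging pairs of
  -- kind 3. Averaged over an independent set of at least n / (2 r K₄) vertices, the latter gives at
  -- most B₁ lagging partners for some vertex. Both are independent of n.
  B B₁ : ℕ
  B = 4 * (r * K₂ * (r * K₂))
  B₁ = B * (2 * r * K₄)

  module _ (μ : ℕ) (μ-large : suc (B + suc q) ≤ μ) where

    open Packing G q t S target target≤n B μ μ-large hiding (r)

    start : ∀ U₀ → n ≤ size U₀ + f → Φ U₀ ≤ 0
    start U₀ h = ≤-trans (total-mono pt) (≤-reflexive (trans (total-const 0) (cong (4 *_) (*-zeroʳ (n * n)))))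
      where
      pt : ∀ κ p → shortfall U₀ κ p * shortfall U₀ κ p ≤ 0
      pt κ p = ≤-trans (≤-reflexive (cong (λ z → z * z) (m≤n⇒m∸n≡0 below))) z≤n
        where
        outside : size (S κ p) ≤ size (S κ p ∩ U₀) + f
        outside = ≤-trans (≤-reflexive (size-split (S κ p) U₀)) (+-monoʳ-≤ _
          (≤-trans (size-mono {S = S κ p ∩ ∁ U₀} {∁ U₀} (λ v x → proj₂ (∧-true {S κ p v} x)))
            (+-cancelˡ-≤ (size U₀) _ _ (≤-trans (≤-reflexive (sym (size-∁ U₀))) h))))
        below : target κ p * (size U₀ ∸ B) ≤ n * size (S κ p ∩ U₀)
        below = ≤-trans (*-mono-≤ (≤-trans (∸-monoˡ-≤ f outside) (≤-reflexive (m+n∸n≡m _ f))) (≤-trans (m∸n≤m (size U₀) B) (size≤n U₀)))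
          (≤-reflexive (*-comm (size (S κ p ∩ U₀)) n))

    module Bad (U : Subset n) (potential : Φ U ≤ n * C) where

      bad : Fin 4 → Vec (Fin n) 2 → Bool
      bad κ p = does (n * k ≤? shortfall U κ p)

      bad-total : total (λ κ p → b2n (bad κ p)) ≤ B * n
      bad-total = count-bound n r k K₂ _ 1≤n k-large
        (≤-trans (≤-reflexive (sym (total-* ((n * k) * (n * k)) (λ κ p → b2n (bad κ p))))) (≤-trans (total-mono pt) potential))
        where
        pt : ∀ κ p → (n * k) * (n * k) * b2n (bad κ p) ≤ shortfall U κ p * shortfall U κ p
        pt κ p with bool-case (bad κ p)
        ... | inj₁ y rewrite y = ≤-trans (≤-reflexive (*-identityʳ _)) (*-mono-≤ (does-yes (n * k ≤? _) y) (does-yes (n * k ≤? _) y))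
        ... | inj₂ y rewrite y = ≤-trans (≤-reflexive (*-zeroʳ ((n * k) * (n * k)))) z≤n

      good : ∀ κ p → bad κ p ≡ false → target κ p * (size U ∸ B) ≤ n * size (S κ p ∩ U) + n * k
      good κ p y = ≤-trans (m≤n+m∸n (target κ p * (size U ∸ B)) (n * size (S κ p ∩ U)))
        (+-monoʳ-≤ (n * size (S κ p ∩ U)) (<⇒≤ (≰⇒> (does-no (n * k ≤? shortfall U κ p) y))))

      badV : Subset n
      badV v = bad zero (v ∷ v ∷ []) ∨ (bad (suc zero) (v ∷ v ∷ []) ∨ bad (suc (suc zero)) (v ∷ v ∷ []))

      -- For kinds 0 to 2 the tracked set does not depend on the second vertex, so every vertex of
      -- `badV` accounts for n lagging pairs.
      badV-few : size badV ≤ B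
      badV-few = cancel-pos n 1≤n (≤-trans (total-rows (λ κ p → b2n (bad κ p)) (λ v → b2n (badV v))
          (λ v u → or (bad zero (v ∷ v ∷ [])) (bad (suc zero) (v ∷ v ∷ [])) (bad (suc (suc zero)) (v ∷ v ∷ []))))
        (≤-trans bad-total (≤-reflexive (*-comm B n))))
        where
        or : ∀ a b c → b2n (a ∨ (b ∨ c)) ≤ b2n a + (b2n b + (b2n c + 0))
        or true b c = s≤s z≤n
        or false true c = s≤s z≤n
        or false false c = m≤m+n (b2n c) 0

      partners : Fin n → ℕ
      partners v = size (λ u → bad (suc (suc (suc zero))) (v ∷ u ∷ []))

      partners-few : sumFin n partners ≤ B * n
      partners-few = ≤-trans (total-pairs (λ κ p → b2n (bad κ p))) bad-total

      Q : Subset n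
      Q = U ∩ ∁ badV

      Q-large : size U ≤ size Q + B
      Q-large = ≤-trans (≤-reflexive (size-split U badV)) (≤-trans (≤-reflexive (+-comm _ (size Q)))
        (+-monoʳ-≤ (size Q) (≤-trans (size-mono {S = U ∩ badV} {badV} (λ v x → proj₂ (∧-true {U v} x))) badV-few)))

      Q-good : ∀ v → Q v ≡ true → bad zero (v ∷ v ∷ []) ≡ false × bad (suc zero) (v ∷ v ∷ []) ≡ false × bad (suc (suc zero)) (v ∷ v ∷ []) ≡ false
      Q-good v x = split (bad zero (v ∷ v ∷ [])) _ _ (proj₂ (∧-true {U v} x))
        where
        split : ∀ a b c → not (a ∨ (b ∨ c)) ≡ true → a ≡ false × b ≡ false × c ≡ false
        split false false false _ = refl , refl , refl

      module _ (ρ : ℕ) (ρ-large : (e + r * f) * size U ≤ n * ρ) (n≤K₄m : n ≤ K₄ * size U)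
        (scale : (64 * g * (Scale.G₂ q + suc r) + 1) * (B + (B₁ + (k + (ρ + 1)))) ≤ size U) where

        open Scale q using (D; G₀; G₂)

        m M τ ξ δ' d s : ℕ
        m = size U
        M = m ∸ B
        τ = B + (B₁ + (k + (ρ + 1)))
        -- The terms come from the avoided vertices, the tolerated lag, and the loss in degree; the
        -- last summand absorbs the rounding in `s`.
        ξ = suc r * B + r * k + ρ + suc r
        δ' = G₀ * ξ
        d = suc ((4 * r + 1) * (r * δ' + r * ξ))
        s = proj₁ (floor (size Q + ξ) r (s≤s z≤n))

        M≤m : M ≤ m
        M≤m = m∸n≤m m B

        m≤M+B : m ≤ M + B
        m≤M+B = ≤-trans (m≤n+m∸n m B) (≤-reflexive (+-comm B M))

        B≤τ : B ≤ τ
        B≤τ = m≤m+n B _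

        k≤τ : k ≤ τ
        k≤τ = ≤-trans (m≤m+n k _) (≤-trans (m≤n+m _ B₁) (m≤n+m _ B))

        1≤τ : 1 ≤ τ
        1≤τ = ≤-trans (m≤n+m 1 ρ) (≤-trans (m≤n+m _ k) (≤-trans (m≤n+m _ B₁) (m≤n+m _ B)))

        BCk≤τ : B + B₁ + k ≤ τ
        BCk≤τ = ≤-trans (m≤m+n _ (ρ + 1)) (≤-reflexive (idt B B₁ k (ρ + 1)))
          where
          idt : ∀ a b c x → a + b + c + x ≡ a + (b + (c + x))
          idt = solve-∀

        d≤ : d ≤ G₂ * τ
        d≤ = d-bound q G₀ ξ τ 1≤τ (ξ-bound r B k ρ τ B₁ refl)

        half : 2 * (B + d) ≤ m
        half = scale-c g r B τ d G₂ m 1≤g B≤τ d≤ scale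

        1≤M : 1 ≤ M
        1≤M = m<n⇒0<n∸m (≤-trans (≤-trans (≤-reflexive (+-comm 1 B)) (+-monoʳ-≤ B (s≤s z≤n))) (≤-trans (m≤m+n (B + d) _) half))

        degU : ∀ v → Q v ≡ true → ∀ b → r * size (A G b v ∩ U) ≤ m + r * B + r * k + ρ
        degU v h true = arith-degree n r (target zero (v ∷ v ∷ [])) f (size (A G true v)) (size (A G true v ∩ U)) (size (E G true v ∩ U)) e B k ρ m M 1≤n
          (≤-trans (≤-reflexive (size-∁ (E G true v))) (+-monoˡ-≤ _ (target-bound zero (v ∷ v ∷ [])))) (deg true v)
          (good zero (v ∷ v ∷ []) (proj₁ (Q-good v h))) (inside true v) m≤M+B M≤m ρ-large
          where
          inside : ∀ b v → size (E G b v ∩ U) + size (A G b v ∩ U) ≤ m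
          inside b v = ≤-reflexive (trans (cong₂ _+_ (∩-comm-size (E G b v) U) (∩-comm-size (A G b v) U)) (sym (size-split U (E G b v))))
        degU v h false = arith-degree n r (target (suc zero) (v ∷ v ∷ [])) f (size (A G false v)) (size (A G false v ∩ U)) (size (E G false v ∩ U)) e B k ρ m M 1≤n
          (≤-trans (≤-reflexive (size-∁ (E G false v))) (+-monoˡ-≤ _ (target-bound (suc zero) (v ∷ v ∷ [])))) (deg false v)
          (good (suc zero) (v ∷ v ∷ []) (proj₁ (proj₂ (Q-good v h)))) (inside false v) m≤M+B M≤m ρ-large
          where
          inside : ∀ b v → size (E G b v ∩ U) + size (A G b v ∩ U) ≤ m
          inside b v = ≤-reflexive (trans (cong₂ _+_ (∩-comm-size (E G b v) U) (∩-comm-size (A G b v) U)) (sym (size-split U (E G b v))))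

        rs-low : r * s ≤ size Q + ξ
        rs-low = proj₁ (proj₂ (floor (size Q + ξ) r (s≤s z≤n)))

        rs-high : suc (size Q + ξ) ≤ r * s + r
        rs-high = proj₂ (proj₂ (floor (size Q + ξ) r (s≤s z≤n)))

        degQ : ∀ v → Q v ≡ true → ∀ b → size (Q ∩ A G b v) ≤ s
        degQ v h b = *-cancelˡ-≤ r (arith r B k ρ m (size Q) (size (Q ∩ A G b v)) s
          (≤-trans (mul r (size-mono {S = Q ∩ A G b v} {A G b v ∩ U} (λ x y → let (a , c) = ∧-true {Q x} y in ∧-intro c (proj₁ (∧-true {U x} a))))) (degU v h b))
          Q-large rs-high)
          where
          arith : ∀ r B k ρ m x y s → r * y ≤ m + r * B + r * k + ρ → m ≤ x + B → suc (x + (suc r * B + r * k + ρ + suc r)) ≤ r * s + r → r * y ≤ r * s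
          arith r B k ρ m x y s h1 h2 h3 = lin 2 (h1 ⊕ h2 ⊕ h3) (idt r B k ρ m x y s)
            where
            idt : ∀ r B k ρ m x y s → r * y + (m + r * B + r * k + ρ + (x + B + (r * s + r))) + 2 ≡
              r * s + (r * y + (m + suc (x + (suc r * B + r * k + ρ + suc r))))
            idt = solve-∀

        Q≤rs : size Q ≤ r * s
        Q≤rs = +-cancelʳ-≤ r _ _ (≤-trans (+-monoʳ-≤ (size Q) (≤-trans (n≤1+n r) (m≤n+m (suc r) _))) (≤-trans (n≤1+n _) rs-high))

        indep : ∀ X → X ⊆ Q → (∀ u v → X u ≡ true → X v ≡ true → E G true u v ≡ false) → r * size X + d ≤ size Q
        indep X X⊆Q edgeless = choose (r * size X + d ≤? size Q)
          where
          module _ (fail : ¬ (r * size X + d ≤ size Q)) where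
            m-bound : m ≤ r * size X + B + d
            m-bound = arith m (size Q) B (r * size X) d Q-large (<⇒≤ (≰⇒> fail))
              where
              arith : ∀ m x B y d → m ≤ x + B → x ≤ y + d → m ≤ y + B + d
              arith m x B y d h1 h2 = lin 0 (h1 ⊕ h2) (idt m x B y d)
                where
                idt : ∀ m x B y d → m + (x + B + (y + d)) + 0 ≡ y + B + d + (m + x)
                idt = solve-∀
            X-large : n ≤ 2 * r * K₄ * size X
            X-large = arith n K₄ m r (size X) B d n≤K₄m m-bound half
              where
              arith : ∀ n K m r x B d → n ≤ K * m → m ≤ r * x + B + d → 2 * (B + d) ≤ m → n ≤ 2 * r * K * x
              arith n K m r x B d h1 h2 h3 = lin 0 (h1 ⊕ mul (2 * K) h2 ⊕ mul K h3) (idt n K m r x B d)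
                where
                idt : ∀ n K m r x B d → n + (K * m + (2 * K * (r * x + B + d) + K * m)) + 0 ≡ 2 * r * K * x + (n + (2 * K * m + K * (2 * (B + d))))
                idt = solve-∀
            1≤X : 1 ≤ size X
            1≤X = pos (size X) (≤-trans 1≤n X-large)
              where
              pos : ∀ x → 1 ≤ 2 * r * K₄ * x → 1 ≤ x
              pos zero h = ≤-trans h (≤-reflexive (*-zeroʳ (2 * r * K₄)))
              pos (suc x) h = s≤s z≤n
            -- Pairs can lag even between vertices of Q, so the reference vertex v is one with the
            -- fewest lagging partners; the average over X bounds their number by B₁.
            mn = argmin partners X 1≤X
            few : partners (proj₁ mn) ≤ B₁
            few = cancel-pos (size X) 1≤X (≤-trans (≤-reflexive (*-comm (size X) (partners (proj₁ mn))))
              (≤-trans (markov X partners (partners (proj₁ mn)) (proj₂ (proj₂ mn)))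
              (≤-trans partners-few (≤-trans (mul B X-large) (≤-reflexive (idt B (2 * r * K₄) (size X)))))))
              where
              idt : ∀ B c x → B * (c * x) ≡ x * (B * c)
              idt = solve-∀
            module At (v : Fin n) (v∈X : X v ≡ true) (few : partners v ≤ B₁) where
              -- X avoids the out-neighbourhoods of v and u, so their union takes at most |U| - |X|
              -- vertices of U and, being well tracked, not much more than n - n / r of all
              -- vertices. Its complement is the intersection of the two non-neighbourhoods.
              in-Z : ∀ u → X u ≡ true → bad (suc (suc (suc zero))) (v ∷ u ∷ []) ≡ false → Z v u ≡ true
              in-Z u u∈X g₃ = ∧-intro (cong not (edgeless v u v∈X u∈X)) (yes-does (n ≤? _)
                (arith-member n r (target κ p) f (size (A G true v ∩ A G true u)) k (size (S κ p ∩ U)) (size X) m M B d l (16 * g) 1≤M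
                  (≤-trans (≤-reflexive (size-∁ (S κ p))) (target-bound κ p ⊕ size-mono {S = ∁ (S κ p)} {A G true v ∩ A G true u} (λ x → dm (E G true v x) (E G true u x))))
                  (good κ p g₃)
                  (≤-trans (+-monoʳ-≤ _ (size-mono {S = X} {U ∩ ∁ (S κ p)} X-out)) (≤-reflexive (trans (cong (_+ size (U ∩ ∁ (S κ p))) (∩-comm-size (S κ p) U)) (sym (size-split U (S κ p))))))
                  m≤M+B m-bound M≤m f-l l-high
                  (+-cancelʳ-≤ B _ _ (≤-trans (scale-a g r B k τ d G₂ m B≤τ k≤τ d≤ scale) m≤M+B))))
                where
                κ : Fin 4
                κ = suc (suc (suc zero))
                p : Vec (Fin n) 2
                p = v ∷ u ∷ []
                dm : ∀ a b → not (a ∨ b) ≡ true → not a ∧ not b ≡ true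
                dm false false _ = refl
                X-out : X ⊆ (U ∩ ∁ (S κ p))
                X-out x h = ∧-intro (proj₁ (∧-true {U x} (X⊆Q x h))) (cong₂ (λ a b → not (a ∨ b)) (edgeless v x v∈X h) (edgeless u x u∈X h))
                f-l : 2 * r * f ≤ l
                f-l = cancel-pos (16 * g) (≤-trans 1≤g (m≤m+n g _)) (≤-trans (≤-reflexive (idt g r f)) (≤-trans f-small l-high))
                  where
                  idt : ∀ g r f → 16 * g * (2 * r * f) ≡ 32 * g * (r * f)
                  idt = solve-∀
              X-cover : size X ≤ size (Z v ∩ U) + B₁
              X-cover = ≤-trans (size-cover {S = X} {Z v ∩ U} {λ u → bad (suc (suc (suc zero))) (v ∷ u ∷ [])} pt) (+-monoʳ-≤ _ few)
                where
                pt : ∀ u → X u ≡ true → (Z v ∩ U) u ≡ true ⊎ bad (suc (suc (suc zero))) (v ∷ u ∷ []) ≡ true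
                pt u h = [ inj₂ , (λ b → inj₁ (∧-intro (in-Z u h b) (proj₁ (∧-true {U u} (X⊆Q u h))))) ]′
                  (bool-case (bad (suc (suc (suc zero))) (v ∷ u ∷ [])))
              absurd : ⊥
              absurd = arith-contra n r g (target κ p) f (size (Z v)) l k (size (S κ p ∩ U)) (size (Z v ∩ U)) m M B B₁ d (size X) 1≤n (s≤s z≤n)
                (≤-trans (≤-reflexive (trans (size-∁ (Z v)) (+-comm (size (Z v)) _))) (+-monoˡ-≤ (size (Z v)) (target-bound κ p)))
                (good κ p (proj₂ (proj₂ (Q-good v (X⊆Q v v∈X)))))
                (≤-reflexive (trans (cong₂ _+_ (∩-comm-size (Z v) U) (∩-comm-size (∁ (Z v)) U)) (sym (size-split U (Z v)))))
                (Z-small v) X-cover m-bound m≤M+B M≤m l-high f-small'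
                (scale-b g r B B₁ k τ d G₂ m 1≤τ B≤τ BCk≤τ d≤ scale)
                where
                κ : Fin 4
                κ = suc (suc zero)
                p : Vec (Fin n) 2
                p = v ∷ v ∷ []
                f-small' : 32 * g * f ≤ n
                f-small' = ≤-trans (mul (32 * g) (m≤m+n f (q * f))) f-small
          choose : Dec (r * size X + d ≤ size Q) → r * size X + d ≤ size Q
          choose (yes p) = p
          choose (no ¬p) = ⊥-elim (At.absurd ¬p (proj₁ (mn ¬p)) (proj₁ (proj₂ (mn ¬p))) (few ¬p))

        light-copies : LightCopies U
        light-copies = Q , (λ v h → proj₁ (∧-true {U v} h)) , Q-large , λ w →
          light-copy G Q q s ξ δ' d D refl degQ Q≤rs rs-low indep ≤-refl ≤-refl t at w

-- Shapes of tournaments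

relabel : ∀ {k} → Permutation′ k → Labelling k → Labelling k
relabel π t i j = t (π ⟨$⟩ʳ i) (π ⟨$⟩ʳ j)

⟨$⟩ʳ-injective : ∀ {k} (π : Permutation′ k) {i j} → π ⟨$⟩ʳ i ≡ π ⟨$⟩ʳ j → i ≡ j
⟨$⟩ʳ-injective π eq = trans (sym (inverseˡ π)) (trans (cong (π ⟨$⟩ˡ_) eq) (inverseˡ π))

relabel-anti : ∀ {k} (π : Permutation′ k) {t : Labelling k} → Anti t → Anti (relabel π t)
relabel-anti π at i j i≢j = at (π ⟨$⟩ʳ i) (π ⟨$⟩ʳ j) (λ eq → i≢j (⟨$⟩ʳ-injective π eq))

occ-sum : ∀ {n k} (vs : Vec (Fin n) k) v → occ vs v ≡ sumFin k (λ i → δ (lookup vs i) v)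
occ-sum [] v = refl
occ-sum (u ∷ us) v = cong (δ u v +_) (occ-sum us v)

δ-cong : ∀ {m n} {i j : Fin m} {i' j' : Fin n} → (i ≡ j → i' ≡ j') → (i' ≡ j' → i ≡ j) → δ i j ≡ δ i' j'
δ-cong {i = i} {j} {i'} {j'} f g with i Fin.≟ j
... | yes p = cong b2n (sym (yes-does (i' Fin.≟ j') (f p)))
... | no ¬p = cong b2n (sym (no-does (i' Fin.≟ j') (λ q → ¬p (g q))))

sum-permute : ∀ {k} (π : Permutation′ k) (f : Fin k → ℕ) → sumFin k (λ i → f (π ⟨$⟩ˡ i)) ≡ sumFin k f
sum-permute {k} π f = trans (sum-cong k (λ i → sym (sum-δ k (π ⟨$⟩ˡ i) f)))
  (trans (sum-swap k k _) (sum-cong k (λ j → trans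
    (sum-cong k (λ i → trans (cong (_* f j) (δ-cong (λ p → trans (cong (π ⟨$⟩ʳ_) (sym p)) (inverseʳ π)) (λ p → trans (cong (π ⟨$⟩ˡ_) (sym p)) (inverseˡ π))))
                             (*-comm (δ (π ⟨$⟩ʳ j) i) (f j))))
    (trans (sum-* k (f j) _) (trans (cong (f j *_) (trans (sum-cong k (λ i → sym (*-identityʳ _))) (sum-δ k (π ⟨$⟩ʳ j) (λ _ → 1)))) (*-identityʳ (f j)))))))

unlabel : ∀ {n k} (G : BiGraph n) (π : Permutation′ k) {t : Labelling k} vs → Copy G (relabel π t) vs →
  Σ (Vec (Fin n) k) λ ws → Copy G t ws × (∀ v → occ ws v ≡ occ vs v)
unlabel {n} {k} G π {t} vs c = ws , copy , λ v → trans (occ-sum ws v) (trans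
    (sum-cong k (λ i → cong (λ z → δ z v) (lookup∘tabulate _ i)))
    (trans (sum-permute π (λ i → δ (lookup vs i) v)) (sym (occ-sum vs v))))
  where
  ws : Vec (Fin n) k
  ws = tabulate (λ i → lookup vs (π ⟨$⟩ˡ i))
  copy : Copy G t ws
  copy i j i≢j rewrite lookup∘tabulate (λ i → lookup vs (π ⟨$⟩ˡ i)) i | lookup∘tabulate (λ i → lookup vs (π ⟨$⟩ˡ i)) j =
    subst (λ b → E G b (lookup vs (π ⟨$⟩ˡ i)) (lookup vs (π ⟨$⟩ˡ j)) ≡ true) (cong₂ t (inverseʳ π) (inverseʳ π))
      (c (π ⟨$⟩ˡ i) (π ⟨$⟩ˡ j) (λ eq → i≢j (trans (sym (inverseʳ π)) (trans (cong (π ⟨$⟩ʳ_) eq) (inverseʳ π)))))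

transposeˡ : ∀ {k} (i j : Fin k) → transpose i j ⟨$⟩ʳ i ≡ j
transposeˡ i j rewrite yes-does (i Fin.≟ i) refl = refl

transpose-other : ∀ {k} (i j l : Fin k) → l ≢ i → l ≢ j → transpose i j ⟨$⟩ʳ l ≡ l
transpose-other i j l l≢i l≢j rewrite no-does (l Fin.≟ i) l≢i | no-does (l Fin.≟ j) l≢j = refl

-- One transposition per prescribed value; injectivity of p and q keeps the values already arranged
-- fixed.
align : ∀ {r} m (p q : Fin m → Fin r) → (∀ {i j} → p i ≡ p j → i ≡ j) → (∀ {i j} → q i ≡ q j → i ≡ j) →
  Σ (Permutation′ r) λ π → ∀ k → π ⟨$⟩ʳ (p k) ≡ q k
align zero p q hp hq = Perm.id , λ ()
align (suc m) p q hp hq with align m (λ i → p (suc i)) (λ i → q (suc i)) (λ e → suc-inj (hp e)) (λ e → suc-inj (hq e))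
  where
  suc-inj : ∀ {m} {i j : Fin m} → Fin.suc i ≡ suc j → i ≡ j
  suc-inj refl = refl
... | π , h = π ∘ₚ transpose (π ⟨$⟩ʳ p zero) (q zero) , λ
  { zero → transposeˡ (π ⟨$⟩ʳ p zero) (q zero)
  ; (suc k) → trans (transpose-other _ _ _
      (λ e → 0≢suc (hp (⟨$⟩ʳ-injective π (sym e)))) (λ e → 0≢suc (hq (sym (trans (sym (h k)) e))))) (h k) }
  where
  0≢suc : ∀ {m} {i : Fin m} → Fin.zero ≡ suc i → ⊥
  0≢suc ()

-- In `Twins`, i is the label whose vertex is exchanged, a and b are placed inside a cluster, and c
-- is the label whose candidate set the cluster protects. The direction between i and c is free.
Source Sink Twins : ∀ {r} → Labelling r → Set
Source {r} t = ∃ λ i → ∀ j → i ≢ j → t i j ≡ true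
Sink {r} t = ∃ λ i → ∀ j → i ≢ j → t i j ≡ false
Twins {r} t = ∃ λ (i : Fin r) → ∃ λ a → ∃ λ b → ∃ λ c →
  ((i ≢ a × i ≢ b × i ≢ c) × (a ≢ b × a ≢ c) × b ≢ c) ×
  (t i a ≡ true × t i b ≡ true) × t a b ≡ true × t a c ≡ true × t b c ≡ true

anyFin allFin : ∀ m → (Fin m → Bool) → Bool
anyFin zero f = false
anyFin (suc m) f = f zero ∨ anyFin m (λ i → f (suc i))
allFin zero f = true
allFin (suc m) f = f zero ∧ allFin m (λ i → f (suc i))

anyFin-sound : ∀ m f → anyFin m f ≡ true → ∃ λ i → f i ≡ true
anyFin-sound (suc m) f h with f zero in eq
... | true = zero , eq
... | false with anyFin-sound m (λ i → f (suc i)) h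
... | i , p = suc i , p

allFin-sound : ∀ m f → allFin m f ≡ true → ∀ i → f i ≡ true
allFin-sound (suc m) f h zero = proj₁ (∧-true h)
allFin-sound (suc m) f h (suc i) = allFin-sound m (λ i → f (suc i)) (proj₂ (∧-true h)) i

-- The entries above the diagonal, as data: statements about all small tournaments become Boolean
-- values that can be evaluated.
Triangle : ℕ → Set
Triangle zero = ⊤
Triangle (suc m) = Vec Bool m × Triangle m

decode : ∀ {m} → Triangle m → Labelling m
decode {suc m} (row , rest) zero zero = false
decode {suc m} (row , rest) zero (suc j) = lookup row j
decode {suc m} (row , rest) (suc i) zero = not (lookup row i)
decode {suc m} (row , rest) (suc i) (suc j) = decode rest i j

encode : ∀ {m} → Labelling m → Triangle m
encode {zero} t = tt
encode {suc m} t = tabulate (λ j → t zero (suc j)) , encode (tail t)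

decode-encode : ∀ {m} {t : Labelling m} → Anti t → ∀ i j → i ≢ j → decode (encode t) i j ≡ t i j
decode-encode {suc m} at zero zero i≢j = ⊥-elim (i≢j refl)
decode-encode {suc m} at zero (suc j) i≢j = lookup∘tabulate _ j
decode-encode {suc m} {t} at (suc i) zero i≢j = trans (cong not (lookup∘tabulate _ i)) (sym (at zero (suc i) (λ ())))
decode-encode {suc m} at (suc i) (suc j) i≢j = decode-encode (tail-anti at) i j (λ { refl → i≢j refl })

allVec : ∀ m → (Vec Bool m → Bool) → Bool
allVec zero f = f []
allVec (suc m) f = allVec m (λ v → f (true ∷ v)) ∧ allVec m (λ v → f (false ∷ v))

allVec-sound : ∀ m f → allVec m f ≡ true → ∀ v → f v ≡ true
allVec-sound zero f h [] = h
allVec-sound (suc m) f h (true ∷ v) = allVec-sound m _ (proj₁ (∧-true h)) v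
allVec-sound (suc m) f h (false ∷ v) = allVec-sound m _ (proj₂ (∧-true {allVec m (λ v → f (true ∷ v))} h)) v

allTriangle : ∀ m → (Triangle m → Bool) → Bool
allTriangle zero f = f tt
allTriangle (suc m) f = allVec m (λ row → allTriangle m (λ rest → f (row , rest)))

allTriangle-sound : ∀ m f → allTriangle m f ≡ true → ∀ x → f x ≡ true
allTriangle-sound zero f h tt = h
allTriangle-sound (suc m) f h (row , rest) = allTriangle-sound m _ (allVec-sound m _ h row) rest

_≢ᵇ_ : ∀ {m} → Fin m → Fin m → Bool
i ≢ᵇ j = not (does (i Fin.≟ j))

≢ᵇ-sound : ∀ {m} {i j : Fin m} → i ≢ᵇ j ≡ true → i ≢ j
≢ᵇ-sound {i = i} {j} h = does-no (i Fin.≟ j) (not-true h)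

source? sink? twins? : ∀ {m} → Labelling m → Bool
source? {m} t = anyFin m λ i → allFin m λ j → does (i Fin.≟ j) ∨ t i j
sink? {m} t = anyFin m λ i → allFin m λ j → does (i Fin.≟ j) ∨ not (t i j)
twins? {m} t = anyFin m λ i → anyFin m λ a → (i ≢ᵇ a ∧ t i a) ∧ (anyFin m λ b →
  ((i ≢ᵇ b ∧ a ≢ᵇ b) ∧ (t i b ∧ t a b)) ∧ (anyFin m λ c → (i ≢ᵇ c ∧ (a ≢ᵇ c ∧ b ≢ᵇ c)) ∧ (t a c ∧ t b c)))

or-false : ∀ {a b} → a ∨ b ≡ true → a ≡ false → b ≡ true
or-false {false} h _ = h

source?-sound : ∀ {m} (t : Labelling m) → source? t ≡ true → Source t
source?-sound {m} t h with anyFin-sound m _ h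
... | i , p = i , λ j i≢j → or-false (allFin-sound m _ p j) (no-does (i Fin.≟ j) i≢j)

sink?-sound : ∀ {m} (t : Labelling m) → sink? t ≡ true → Sink t
sink?-sound {m} t h with anyFin-sound m _ h
... | i , p = i , λ j i≢j → not-true (or-false (allFin-sound m _ p j) (no-does (i Fin.≟ j) i≢j))

twins?-sound : ∀ {m} (t : Labelling m) → twins? t ≡ true → Twins t
twins?-sound {m} t h with anyFin-sound m _ h
... | i , p with anyFin-sound m _ p
... | a , p₁ with ∧-true {i ≢ᵇ a ∧ t i a} p₁
... | x , p₂ with anyFin-sound m _ p₂
... | b , p₃ with ∧-true {(i ≢ᵇ b ∧ a ≢ᵇ b) ∧ (t i b ∧ t a b)} p₃
... | y , p₄ with anyFin-sound m _ p₄
... | c , p₅ with ∧-true {i ≢ᵇ a} x | ∧-true {i ≢ᵇ b ∧ a ≢ᵇ b} y | ∧-true {i ≢ᵇ c ∧ (a ≢ᵇ c ∧ b ≢ᵇ c)} p₅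
... | ia , tia | y₁ , y₂ | z₁ , z₂ with ∧-true {i ≢ᵇ b} y₁ | ∧-true {t i b} y₂ | ∧-true {i ≢ᵇ c} z₁ | ∧-true {t a c} z₂
... | ib , ab | tib , tab | ic , z₃ | tac , tbc with ∧-true {a ≢ᵇ c} z₃
... | ac , bc = i , a , b , c , ((≢ᵇ-sound ia , ≢ᵇ-sound ib , ≢ᵇ-sound ic) , (≢ᵇ-sound ab , ≢ᵇ-sound ac) , ≢ᵇ-sound bc) ,
  (tia , tib) , tab , tac , tbc

-- Evaluation over all 2^10 orientations.
tournaments-5 : allTriangle 5 (λ x → twins? (decode x)) ≡ true
tournaments-5 = refl

-- A source dominating a cyclic triangle, or a sink dominated by one, lacks the `Twins` pattern, so
-- four vertices need the other two alternatives.
tournaments-4 : allTriangle 4 (λ x → source? (decode x) ∨ (sink? (decode x) ∨ twins? (decode x))) ≡ true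
tournaments-4 = refl

twins-transfer : ∀ {m r} {s : Labelling m} {t : Labelling r} (f : Fin m → Fin r) → (∀ {i j} → f i ≡ f j → i ≡ j) →
  (∀ i j → i ≢ j → s i j ≡ t (f i) (f j)) → Twins s → Twins t
twins-transfer f inj eq (i , a , b , c , ((ia , ib , ic) , (ab , ac) , bc) , (h₁ , h₂) , h₃ , h₄ , h₅) =
  f i , f a , f b , f c , (((λ e → ia (inj e)) , (λ e → ib (inj e)) , (λ e → ic (inj e))) , ((λ e → ab (inj e)) , (λ e → ac (inj e))) , (λ e → bc (inj e))) ,
  (trans (sym (eq i a ia)) h₁ , trans (sym (eq i b ib)) h₂) , trans (sym (eq a b ab)) h₃ , trans (sym (eq a c ac)) h₄ , trans (sym (eq b c bc)) h₅

-- `Twins` passes from a subtournament to the whole, while a source or a sink does not. Hence the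
-- first five vertices settle every larger order and four vertices are treated separately.
classify : ∀ k (t : Labelling (4 + k)) → Anti t → Source t ⊎ (Sink t ⊎ Twins t)
classify zero t at = cases (source? s) (sink? s) refl refl (allTriangle-sound 4 (λ x → source? (decode x) ∨ (sink? (decode x) ∨ twins? (decode x))) tournaments-4 (encode t))
  where
  s = decode (encode t)
  cases : ∀ a b → source? s ≡ a → sink? s ≡ b → a ∨ (b ∨ twins? s) ≡ true → Source t ⊎ (Sink t ⊎ Twins t)
  cases true b e _ h = let (i , p) = source?-sound s e in inj₁ (i , λ j i≢j → trans (sym (decode-encode at i j i≢j)) (p j i≢j))
  cases false true _ e h = let (i , p) = sink?-sound s e in inj₂ (inj₁ (i , λ j i≢j → trans (sym (decode-encode at i j i≢j)) (p j i≢j)))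
  cases false false _ _ h = inj₂ (inj₂ (twins-transfer (λ i → i) (λ e → e) (decode-encode at) (twins?-sound s h)))
classify (suc k) t at = inj₂ (inj₂ (twins-transfer {t = t} (Fin._↑ˡ k) (λ {i} {j} → ↑ˡ-injective k i j) (decode-encode at')
    (twins?-sound (decode (encode s)) (allTriangle-sound 5 (λ x → twins? (decode x)) tournaments-5 (encode s)))))
  where
  s : Labelling 5
  s i j = t (i Fin.↑ˡ k) (j Fin.↑ˡ k)
  at' : Anti s
  at' i j i≢j = at (i Fin.↑ˡ k) (j Fin.↑ˡ k) (λ e → i≢j (↑ˡ-injective k i j e))

cyclic-or-source : (D : Digraph 3) → Anti (adj D) → IsoToC3 D ⊎ Source (adj D)
cyclic-or-source D at = cases (adj D zero (suc zero)) (adj D zero (suc (suc zero))) (adj D (suc zero) (suc (suc zero))) refl refl refl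
  where
  flip : ∀ {i j b} → i ≢ j → adj D i j ≡ b → adj D j i ≡ not b
  flip {i} {j} i≢j e = trans (at i j i≢j) (cong not e)
  cases : ∀ a b c → adj D zero (suc zero) ≡ a → adj D zero (suc (suc zero)) ≡ b → adj D (suc zero) (suc (suc zero)) ≡ c →
    IsoToC3 D ⊎ Source (adj D)
  cases true true c p q s = inj₂ (zero , λ { zero h → ⊥-elim (h refl) ; (suc zero) _ → p ; (suc (suc zero)) _ → q })
  cases false b true p q s = inj₂ (suc zero , λ { zero _ → flip (λ ()) p ; (suc zero) h → ⊥-elim (h refl) ; (suc (suc zero)) _ → s })
  cases a false false p q s = inj₂ (suc (suc zero) , λ { zero _ → flip (λ ()) q ; (suc zero) _ → flip (λ ()) s ; (suc (suc zero)) h → ⊥-elim (h refl) })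
  cases true false true p q s = inj₁ (Perm.id , λ
    { zero zero → noLoops D zero ; zero (suc zero) → p ; zero (suc (suc zero)) → q
    ; (suc zero) zero → flip (λ ()) p ; (suc zero) (suc zero) → noLoops D _ ; (suc zero) (suc (suc zero)) → s
    ; (suc (suc zero)) zero → flip (λ ()) q ; (suc (suc zero)) (suc zero) → flip (λ ()) s ; (suc (suc zero)) (suc (suc zero)) → noLoops D _ })
  cases false true false p q s = inj₁ (mk↔ₛ′ f f f∘f f∘f , λ
    { zero zero → noLoops D zero ; zero (suc zero) → p ; zero (suc (suc zero)) → q
    ; (suc zero) zero → flip (λ ()) p ; (suc zero) (suc zero) → noLoops D _ ; (suc zero) (suc (suc zero)) → s
    ; (suc (suc zero)) zero → flip (λ ()) q ; (suc (suc zero)) (suc zero) → flip (λ ()) s ; (suc (suc zero)) (suc (suc zero)) → noLoops D _ })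
    where
    f : Fin 3 → Fin 3
    f zero = zero
    f (suc zero) = suc (suc zero)
    f (suc (suc zero)) = suc zero
    f∘f : ∀ i → f (f i) ≡ i
    f∘f zero = refl
    f∘f (suc zero) = refl
    f∘f (suc (suc zero)) = refl

data Shape : (k : ℕ) → Labelling (3 + k) → Set where
  source : ∀ {k t} → Source t → Shape k t
  sink : ∀ {k t} → Sink t → Shape k t
  twins : ∀ {k t} → Twins t → Shape (suc k) t

Tiles : ∀ {n r} → BiGraph n → Labelling r → Vec (Fin n) r → Set
Tiles G t vs = ∃ λ ws → Copy G t ws × (∀ v → occ ws v ≡ occ vs v)

align-vec : ∀ {m r} (p q : Vec (Fin r) m) → Unique p → Unique q → Σ (Permutation′ r) λ π → ∀ k → π ⟨$⟩ʳ lookup p k ≡ lookup q k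
align-vec {m} p q up uq = align m (lookup p) (lookup q) (λ {i} {j} → lookup-injective up i j) (λ {i} {j} → lookup-injective uq i j)

module Exchanges {n : ℕ} (G : BiGraph n) (k g e : ℕ) (1≤g : 1 ≤ g)
  (deg : ∀ b v → (3 + k) * size (A G b v) ≤ n + e)
  (ns : NonSparse G (3 + k) g)
  (small : 4 * (128 * (g * (3 + k)) * ((3 + k) * e)) ≤ n)
  (t : Labelling (3 + k)) (at : Anti t) where

  r K : ℕ
  r = 3 + k
  K = 128 * (g * r)

  Swap : Fin n → Fin n → Vec (Fin n) (2 + k) → Set
  Swap x y vs = Tiles G t (x ∷ vs) × Tiles G t (y ∷ vs)

  ManySwaps : Set
  ManySwaps = ∀ x y → ManyT K (2 + k) (Swap x y)

  module _ (π : Permutation′ r) where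

    toSwap : ∀ x y vs → Copy G (relabel π t) (x ∷ vs) × Copy G (relabel π t) (y ∷ vs) → Swap x y vs
    toSwap x y vs (c , d) = unlabel G π (x ∷ vs) c , unlabel G π (y ∷ vs) d

  source-swaps : Source t → ManySwaps
  source-swaps (i , out) x y = ManyT-map (2 + k) (toSwap π x y)
      (R.reach-source x y k (relabel π t) (relabel-anti π at) refl
        (λ d → subst (λ z → t z (π ⟨$⟩ʳ suc d) ≡ true) (sym (h zero)) (out (π ⟨$⟩ʳ suc d)
          (λ eq → 0≢suc (⟨$⟩ʳ-injective π (trans (h zero) eq))))))
    where
    module R = Reach G r g e (s≤s z≤n) 1≤g deg ns small
    pr = align-vec {1} (zero ∷ []) (i ∷ []) ([] ∷ []) ([] ∷ [])
    π = proj₁ pr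
    h = proj₂ pr
    0≢suc : ∀ {m} {i : Fin m} → Fin.zero ≡ suc i → ⊥
    0≢suc ()

  -- Reversing all edges of the graph and of T turns the sink into a source and preserves the
  -- hypotheses.
  sink-swaps : Sink t → ManySwaps
  sink-swaps (i , out) x y = ManyT-map (2 + k) back
      (R.reach-source x y k t' at' refl
        (λ d → cong not (subst (λ z → t z (π ⟨$⟩ʳ suc d) ≡ false) (sym (h zero)) (out (π ⟨$⟩ʳ suc d)
          (λ eq → 0≢suc (⟨$⟩ʳ-injective π (trans (h zero) eq)))))))
    where
    module R = Reach (op G) r g e (s≤s z≤n) 1≤g (λ b → deg (not b)) (λ b → ns (not b)) small
    pr = align-vec {1} (zero ∷ []) (i ∷ []) ([] ∷ []) ([] ∷ [])
    π = proj₁ pr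
    h = proj₂ pr
    t' : Labelling r
    t' i j = not (relabel π t i j)
    at' : Anti t'
    at' i j i≢j = cong not (relabel-anti π at i j i≢j)
    unop : ∀ {vs} → Copy (op G) t' vs → Copy G (relabel π t) vs
    unop {vs} c i j i≢j = subst (λ b → E G b (lookup vs i) (lookup vs j) ≡ true) (Bool.not-involutive (relabel π t i j)) (c i j i≢j)
    back : ∀ vs → Copy (op G) t' (x ∷ vs) × Copy (op G) t' (y ∷ vs) → Swap x y vs
    back vs (c , d) = toSwap π x y vs (unop {x ∷ vs} c , unop {y ∷ vs} d)
    0≢suc : ∀ {m} {i : Fin m} → Fin.zero ≡ suc i → ⊥
    0≢suc ()

-- Two arrangements of the labels are used. With a and b last, either the exchange succeeds or a
-- cluster appears; it consists of common out-neighbours of x and y because i → a, and its direction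
-- is outgoing because a → b. The second arrangement places a and b first, inside that cluster, and
-- c last.
twin-swaps : ∀ {n : ℕ} (G : BiGraph n) (k g e : ℕ) (1≤g : 1 ≤ g)
  (deg : ∀ b v → (4 + k) * size (A G b v) ≤ n + e) (ns : NonSparse G (4 + k) g)
  (small : 4 * (128 * (g * (4 + k)) * ((4 + k) * e)) ≤ n) (t : Labelling (4 + k)) (at : Anti t) →
  Twins t → ∀ x y → ManyT (128 * (g * (4 + k))) (3 + k) (λ vs → Tiles G t (x ∷ vs) × Tiles G t (y ∷ vs))
twin-swaps {n} G k g e 1≤g deg ns small t at (i , a , b , c , ((ia , ib , ic) , (ab , ac) , bc) , (tia , tib) , tab , tac , tbc) x y =
  [ ManyT-map (3 + k) (X.toSwap π x y) , (λ cl → ManyT-map (3 + k) (X.toSwap ρ x y) (second cl)) ]′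
    (R.first x y (suc k) (relabel π t) (relabel-anti π at) refl)
  where
  module X = Exchanges G (suc k) g e 1≤g deg ns small t at
  module R = Reach G (4 + k) g e (s≤s z≤n) 1≤g deg ns small
  la lb : Fin (4 + k)
  la = suc (R.sub-last (suc k))
  lb = suc (fromℕ (suc (suc k)))
  la≢lb : la ≢ lb
  la≢lb eq = distinct (suc k) (suc-inj eq)
    where
    suc-inj : ∀ {m} {i j : Fin m} → Fin.suc i ≡ suc j → i ≡ j
    suc-inj refl = refl
    distinct : ∀ k → inject₁ (fromℕ k) ≢ fromℕ (suc k)
    distinct zero ()
    distinct (suc k) eq = distinct k (suc-inj eq)
  pr = align-vec (zero ∷ la ∷ lb ∷ []) (i ∷ a ∷ b ∷ [])
    (((λ ()) ∷ (λ ()) ∷ []) ∷ (la≢lb ∷ []) ∷ [] ∷ []) ((ia ∷ ib ∷ []) ∷ (ab ∷ []) ∷ [] ∷ [])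
  π = proj₁ pr
  h = proj₂ pr
  last : Fin (4 + k)
  last = suc (suc (suc (fromℕ k)))
  pr' = align-vec (zero ∷ suc zero ∷ suc (suc zero) ∷ last ∷ []) (i ∷ a ∷ b ∷ c ∷ [])
    (((λ ()) ∷ (λ ()) ∷ (λ ()) ∷ []) ∷ ((λ ()) ∷ (λ ()) ∷ []) ∷ ((λ ()) ∷ []) ∷ [] ∷ [])
    ((ia ∷ ib ∷ ic ∷ []) ∷ (ab ∷ ac ∷ []) ∷ (bc ∷ []) ∷ [] ∷ [])
  ρ = proj₁ pr'
  h' = proj₂ pr'
  at₂ : ∀ {u v u' v' β} → u ≡ u' → v ≡ v' → t u' v' ≡ β → t u v ≡ β
  at₂ refl refl e = e
  second : Cluster G (4 + k) e (R.K) (relabel π t la lb) (R.common x y (relabel π t) (R.sub-last (suc k))) →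
    ManyT R.K (3 + k) (R.Exchange (relabel ρ t) x y)
  second cl = R.reach-twins x y k (relabel ρ t) (relabel-anti ρ at) refl
    (at₂ (h' zero) (h' (suc zero)) tia) (at₂ (h' zero) (h' (suc (suc zero))) tib) (at₂ (h' (suc zero)) (h' (suc (suc zero))) tab)
    (at₂ (h' (suc zero)) (h' (suc (suc (suc zero)))) tac) (at₂ (h' (suc (suc zero))) (h' (suc (suc (suc zero)))) tbc)
    (outgoing (at₂ (h (suc zero)) (h (suc (suc zero))) tab) (at₂ (h zero) (h (suc zero)) tia) cl)
    where
    outgoing : ∀ {β γ} → β ≡ true → γ ≡ true → Cluster G (4 + k) e R.K β (E G γ x ∩ E G γ y) →
      Cluster G (4 + k) e R.K true (E G true x ∩ E G true y)
    outgoing refl refl cl = cl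

many-swaps : ∀ {n : ℕ} (G : BiGraph n) (k g e : ℕ) → 1 ≤ g →
  (∀ b v → (3 + k) * size (A G b v) ≤ n + e) → NonSparse G (3 + k) g →
  4 * (128 * (g * (3 + k)) * ((3 + k) * e)) ≤ n → (t : Labelling (3 + k)) → Anti t → Shape k t →
  ∀ x y → ManyT (128 * (g * (3 + k))) (2 + k) (λ vs → Tiles G t (x ∷ vs) × Tiles G t (y ∷ vs))
many-swaps G k g e 1≤g deg ns small t at (source s) = Exchanges.source-swaps G k g e 1≤g deg ns small t at s
many-swaps G k g e 1≤g deg ns small t at (sink s) = Exchanges.sink-swaps G k g e 1≤g deg ns small t at s
many-swaps G (suc k) g e 1≤g deg ns small t at (twins s) = twin-swaps G k g e 1≤g deg ns small t at s

-- Absorbers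

occs-++ : ∀ {n k} (L M : List (Vec (Fin n) k)) v → occs (L ++ M) v ≡ occs L v + occs M v
occs-++ [] M v = refl
occs-++ (x ∷ L) M v = trans (cong (occ x v +_) (occs-++ L M v)) (sym (+-assoc (occ x v) _ _))

occ-++ : ∀ {n j k} (us : Vec (Fin n) j) (vs : Vec (Fin n) k) v → occ (us Vec.++ vs) v ≡ occ us v + occ vs v
occ-++ [] vs v = refl
occ-++ (u ∷ us) vs v = trans (cong (δ u v +_) (occ-++ us vs v)) (sym (+-assoc (δ u v) _ _))

Packable : ∀ {n r} → BiGraph n → Labelling r → (Fin n → ℕ) → Set
Packable {n} {r} G t m = Σ (List (Vec (Fin n) r)) λ L → All (Copy G t) L × (∀ v → occs L v ≡ m v)

module _ {n r : ℕ} (G : BiGraph n) (t : Labelling r) where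

  packable-cong : ∀ m m' → (∀ v → m v ≡ m' v) → Packable G t m → Packable G t m'
  packable-cong m m' h (L , cs , os) = L , cs , λ v → trans (os v) (h v)

  packable-0 : Packable G t (λ _ → 0)
  packable-0 = [] , [] , λ _ → refl

  packable-+ : ∀ m m' → Packable G t m → Packable G t m' → Packable G t (λ v → m v + m' v)
  packable-+ m m' (L , cs , os) (L' , cs' , os') = L ++ L' , ++⁺ cs cs' , λ v → trans (occs-++ L L' v) (cong₂ _+_ (os v) (os' v))

  packable-tiles : ∀ vs → Tiles G t vs → Packable G t (occ vs)
  packable-tiles vs (ws , c , os) = ws ∷ [] , c ∷ [] , λ v → trans (+-identityʳ _) (os v)

ManyT-bind : ∀ {n K} j k (P : Vec (Fin n) (j + k) → Set) →
  ManyT K j (λ us → ManyT K k (λ vs → P (us Vec.++ vs))) → ManyT K (j + k) P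
ManyT-bind zero k P m = m
ManyT-bind (suc j) k P (S , s , h) = S , s , λ v p → ManyT-bind j k (λ vs → P (v ∷ vs)) (h v p)

module Absorbers {n p : ℕ} (G : BiGraph n) (t : Labelling (suc p)) (K : ℕ)
  (swaps : ∀ x y → ManyT K p (λ vs → Tiles G t (x ∷ vs) × Tiles G t (y ∷ vs))) where

  Parallel : ∀ {m k} → Vec (Fin n) m → Vec (Fin n) m → Vec (Fin n) k → Set
  Parallel xs ys ss = Packable G t (λ v → occ xs v + occ ss v) × Packable G t (λ v → occ ys v + occ ss v)

  many-parallel : ∀ m (xs ys : Vec (Fin n) m) → ManyT K (m * p) (Parallel xs ys)
  many-parallel zero [] [] = packable-0 G t , packable-0 G t
  many-parallel (suc m) (x ∷ xs) (y ∷ ys) = ManyT-bind p (m * p) (Parallel (x ∷ xs) (y ∷ ys)) (ManyT-map p extend (swaps x y))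
    where
    join : ∀ x (xs : Vec (Fin n) m) (s : Vec (Fin n) p) (ss : Vec (Fin n) (m * p)) → Tiles G t (x ∷ s) →
      Packable G t (λ v → occ xs v + occ ss v) → Packable G t (λ v → occ (x ∷ xs) v + occ (s Vec.++ ss) v)
    join x xs s ss c q = packable-cong G t (λ v → occ (x ∷ s) v + (occ xs v + occ ss v)) _
      (λ v → trans (idt (δ x v) (occ s v) (occ xs v) (occ ss v)) (cong (δ x v + occ xs v +_) (sym (occ-++ s ss v))))
      (packable-+ G t (occ (x ∷ s)) (λ v → occ xs v + occ ss v) (packable-tiles G t (x ∷ s) c) q)
      where
      idt : ∀ a b c d → a + b + (c + d) ≡ a + c + (b + d)
      idt = solve-∀
    extend : ∀ s → Tiles G t (x ∷ s) × Tiles G t (y ∷ s) → ManyT K (m * p) (λ ss → Parallel (x ∷ xs) (y ∷ ys) (s Vec.++ ss))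
    extend s (cx , cy) = ManyT-map (m * p) (λ ss (px , py) → join x xs s ss cx px , join y ys s ss cy py) (many-parallel m xs ys)

  Absorbs : ∀ {k} → Vec (Fin n) (suc p) → Vec (Fin n) k → Set
  Absorbs xs z = Packable G t (occ z) × Packable G t (λ v → occ z v + occ xs v)

  -- An absorber is a copy ys of T together with an exchange set for each pair of entries of xs and
  -- ys. Without xs, each y is tiled with its exchange set; with xs, each x takes the place of its y
  -- and ys becomes a tile of its own.
  many-absorbers : ManyT K (suc p) (Copy G t) → ∀ xs → ManyT K (suc p + suc p * p) (Absorbs xs)
  many-absorbers copies xs = ManyT-bind (suc p) (suc p * p) (Absorbs xs) (ManyT-map (suc p) extend copies)
    where
    idt : ∀ y x s → y + (x + s) ≡ y + s + x
    idt = solve-∀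
    absorb : ∀ ys ss → Copy G t ys → Parallel xs ys ss → Absorbs xs (ys Vec.++ ss)
    absorb ys ss c (px , py) =
      packable-cong G t (λ v → occ ys v + occ ss v) _ (λ v → sym (occ-++ ys ss v)) py ,
      packable-cong G t (λ v → occ ys v + (occ xs v + occ ss v)) _
        (λ v → trans (idt (occ ys v) (occ xs v) (occ ss v)) (cong (_+ occ xs v) (sym (occ-++ ys ss v))))
        (packable-+ G t (occ ys) (λ v → occ xs v + occ ss v) (packable-tiles G t ys (ys , c , λ _ → refl)) px)
    extend : ∀ ys → Copy G t ys → ManyT K (suc p * p) (λ ss → Absorbs xs (ys Vec.++ ss))
    extend ys c = ManyT-map (suc p * p) (λ ss → absorb ys ss c) (many-parallel (suc p) xs ys)

many-copies : ∀ {n} (G : BiGraph n) q K e → (∀ b v → suc q * size (A G b v) ≤ n + e) → 2 * (suc q * e) ≤ n → 2 * suc q ≤ K →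
  (t : Labelling (suc q)) → Anti t → ManyT K (suc q) (Copy G t)
many-copies {n} G q K e deg e-small K-large t at = ManyT-map (suc q) {P = Fits G t (λ _ → full)} (λ _ → proj₂)
  (greedy-many G K (2 * suc q) (2 * (n + e)) n full
    (λ v _ b → ≤-trans (≤-reflexive (*-assoc 2 (suc q) _)) (mul 2 (deg b v)))
    (λ S h → ≤-trans h (*-monoˡ-≤ (size S) K-large))
    (suc q) t at (λ _ → full) (λ _ _ _ → refl) (λ d → subst (λ z → toℕ d * (2 * (n + e)) + n ≤ 2 * suc q * z) (sym (size-full n))
      (arith q n e (toℕ d) (toℕ≤pred[n] d) e-small)))
  where
  arith : ∀ q n e d → d ≤ q → 2 * (suc q * e) ≤ n → d * (2 * (n + e)) + n ≤ 2 * suc q * n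
  arith q n e d h1 h2 = lin (2 * e) (mul (2 * (n + e)) h1 ⊕ h2) (idt q n e d)
    where
    idt : ∀ q n e d → d * (2 * (n + e)) + n + (2 * (n + e) * q + n) + 2 * e ≡ 2 * suc q * n + (2 * (n + e) * d + 2 * (suc q * e))
    idt = solve-∀

-- Derandomised choice of the absorbing family

inTree : ∀ {n K} k (P : Vec (Fin n) k → Set) → ManyT K k P → Vec (Fin n) k → Bool
inTree zero P m [] = true
inTree (suc k) P (S , s , h) (v ∷ vs) = [ (λ p → inTree k (λ vs → P (v ∷ vs)) (h v p) vs) , (λ _ → false) ]′ (bool-case (S v))

inTree-sound : ∀ {n K} k (P : Vec (Fin n) k → Set) (m : ManyT K k P) vs → inTree k P m vs ≡ true → P vs
inTree-sound zero P m [] h = m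
inTree-sound (suc k) P (S , s , f) (v ∷ vs) h with bool-case (S v)
... | inj₁ p = inTree-sound k (λ vs → P (v ∷ vs)) (f v p) vs h

-- Averaging needs Boolean hits to sum, and absorption is only a type. Membership in a given tree is
-- Boolean, implies absorption, and still covers a fraction K^(-k) of all tuples.
inTree-count : ∀ {n K} k (P : Vec (Fin n) k → Set) (m : ManyT K k P) → n ^ k ≤ K ^ k * sumVec k (λ vs → b2n (inTree k P m vs))
inTree-count zero P m = ≤-refl
inTree-count {n} {K} (suc k) P (S , s , f) = ≤-trans (*-monoˡ-≤ (n ^ k) s) (≤-trans
  (≤-reflexive (trans (*-assoc K (size S) (n ^ k)) (cong (K *_) (*-comm (size S) (n ^ k)))))
  (≤-trans (mul K (markov S (λ v → K ^ k * count v) (n ^ k) pt)) (≤-reflexive (trans (cong (K *_) (sum-* n (K ^ k) count)) (sym (*-assoc K (K ^ k) _))))))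
  where
  count : Fin n → ℕ
  count v = sumVec k (λ vs → b2n (inTree (suc k) P (S , s , f) (v ∷ vs)))
  pt : ∀ v → S v ≡ true → n ^ k ≤ K ^ k * count v
  pt v p with bool-case (S v)
  ... | inj₁ q = inTree-count k (λ vs → P (v ∷ vs)) (f v q)
  ... | inj₂ q = ⊥-elim (true≢false p q)

Fresh : ∀ {n k} → Subset n → Vec (Fin n) k → Set
Fresh X vs = ∀ v → occ vs v + b2n (X v) ≤ 1

insert : ∀ {n} → Fin n → Subset n → Subset n
insert u X v = does (u Fin.≟ v) ∨ X v

insert-b2n : ∀ {n} u (X : Subset n) → X u ≡ false → ∀ v → b2n (insert u X v) ≡ δ u v + b2n (X v)
insert-b2n u X h v with u Fin.≟ v
... | yes refl rewrite h = refl
... | no _ = refl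

insert-size : ∀ {n} u (X : Subset n) → X u ≡ false → size (insert u X) ≡ suc (size X)
insert-size {n} u X h = trans (sum-cong n (insert-b2n u X h)) (trans (sum-+ n _ _)
  (cong (_+ size X) (trans (sum-cong n (λ v → sym (*-identityʳ _))) (sum-δ n u (λ _ → 1)))))

-- At each level the forbidden vertices are at most half of n / K, so doubling K pays for them.
-- Chosen vertices join X, which also rules out repetitions within the tuple.
ManyT-fresh : ∀ {n K} k (P : Vec (Fin n) k → Set) X → 2 * (K * (size X + k)) ≤ n → ManyT K k P →
  ManyT (2 * K) k (λ vs → P vs × Fresh X vs)
ManyT-fresh zero P X h m = m , λ v → b2n≤1 (X v)
ManyT-fresh {n} {K} (suc k) P X h (S , s , f) = (S ∩ ∁ X) , large , λ v p →
  let (a , b) = ∧-true {S v} p ; Xv = not-true b in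
  ManyT-map k {P = λ vs → P (v ∷ vs) × Fresh (insert v X) vs} (λ vs (c , fr) → c , λ u → ≤-trans (≤-reflexive (trans (idt (δ v u) (occ vs u) (b2n (X u))) (cong (occ vs u +_) (sym (insert-b2n v X Xv u))))) (fr u))
    (ManyT-fresh k (λ vs → P (v ∷ vs)) (insert v X) (≤-trans (≤-reflexive (cong (λ z → 2 * (K * z)) (trans (cong (_+ k) (insert-size v X Xv)) (sym (+-suc (size X) k))))) h) (f v a))
  where
  idt : ∀ a b c → a + b + c ≡ b + (a + c)
  idt = solve-∀
  large : n ≤ 2 * K * size (S ∩ ∁ X)
  large = arith n K (size S) (size X) (size (S ∩ ∁ X)) (suc k) s h
    (≤-trans (≤-reflexive (size-split S X)) (+-monoˡ-≤ _ (size-mono {S = S ∩ X} {X} (λ v p → proj₂ (∧-true {S v} p)))))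
    where
    arith : ∀ n K s x y k → n ≤ K * s → 2 * (K * (x + k)) ≤ n → s ≤ x + y → n ≤ 2 * K * y
    arith n K s x y k h1 h2 h3 = lin (2 * (K * k)) (mul 2 h1 ⊕ h2 ⊕ mul (2 * K) h3) (idt' n K s x y k)
      where
      idt' : ∀ n K s x y k → n + (2 * (K * s) + (n + 2 * K * (x + y))) + 2 * (K * k) ≡ 2 * K * y + (2 * n + (2 * (K * (x + k)) + 2 * K * s))
      idt' = solve-∀

bernoulli : ∀ a m → a ^ m * (a + m) ≤ suc a ^ m * a
bernoulli a zero = ≤-reflexive (cong (λ z → 1 * z) (+-identityʳ a))
bernoulli a (suc m) = ≤-trans (lin (a ^ m * m) (≤-refl {0}) (idt a m (a ^ m))) (≤-trans (mul (suc a) (bernoulli a m))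
  (≤-reflexive (sym (*-assoc (suc a) (suc a ^ m) a))))
  where
  idt : ∀ a m p → a * p * (a + suc m) + 0 + p * m ≡ suc a * (p * (a + m)) + 0
  idt = solve-∀

^-mul : ∀ x y k → (x * y) ^ k ≡ x ^ k * y ^ k
^-mul x y zero = refl
^-mul x y (suc k) rewrite ^-mul x y k = idt x y (x ^ k) (y ^ k)
  where
  idt : ∀ x y p q → x * y * (p * q) ≡ x * p * (y * q)
  idt = solve-∀

-- This is (1 + 1 / a)^(a κ) ≥ 2^κ without fractions.
doubling : ∀ a κ → 1 ≤ a → 2 ^ κ * a ^ (a * κ) ≤ suc a ^ (a * κ)
doubling a κ 1≤a = ≤-trans (≤-reflexive (trans (cong (2 ^ κ *_) (sym (^-*-assoc a a κ))) (sym (^-mul 2 (a ^ a) κ))))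
  (≤-trans (^-monoˡ-≤ κ base) (≤-reflexive (^-*-assoc (suc a) a κ)))
  where
  base : 2 * a ^ a ≤ suc a ^ a
  base = cancel-pos a 1≤a (≤-trans (≤-reflexive (idt a (a ^ a))) (≤-trans (bernoulli a a) (≤-reflexive (*-comm (suc a ^ a) a))))
    where
    idt : ∀ a p → a * (2 * p) ≡ p * (a + a)
    idt = solve-∀

^-pos : ∀ x k → 1 ≤ x → 1 ≤ x ^ k
^-pos x zero h = ≤-refl
^-pos x (suc k) h = *-mono-≤ h (^-pos x k h)

^-2-cancel : ∀ h c → 2 ^ h ≤ 2 ^ c → h ≤ c
^-2-cancel h c le with h ≤? c
... | yes p = p
... | no ¬p = ⊥-elim (1+n≰n (≤-trans (≤-trans (≤-trans (+-monoʳ-≤ 1 (m≤m+n (2 ^ c) 0)) (+-monoˡ-≤ (2 ^ c + 0) (^-pos 2 c (s≤s z≤n)))) (^-monoʳ-≤ 2 (≰⇒> ¬p))) le))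

sum-occ : ∀ {n k} (vs : Vec (Fin n) k) → sumFin n (occ vs) ≡ k
sum-occ {n} {k} vs = trans (sum-cong n (λ v → sym (*-identityʳ (occ vs v)))) (trans (sym (weight-occ (λ _ → 1) vs)) (weight-1 vs))

-- `skip` asks nothing of z, so c is a lower bound for the number of absorbers of t in the list.
data Hits {A B : Set} (Abs : A → B → Set) (t : A) : List B → ℕ → Set where
  none : Hits Abs t [] 0
  skip : ∀ {z F c} → Hits Abs t F c → Hits Abs t (z ∷ F) c
  hit : ∀ {z F c} → Abs t z → Hits Abs t F c → Hits Abs t (z ∷ F) (suc c)

-- The target t has weight 2 ^ (steps - hits of t); the next tuple keeps the total weight below its average.
module Selection {n' r k : ℕ} (Abs : Vec (Fin (suc n')) r → Vec (Fin (suc n')) k → Set) (Self : Vec (Fin (suc n')) k → Set)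
  (self : ∀ t z → Abs t z → Self z) (K : ℕ) (1≤K : 1 ≤ K) (trees : ∀ t → ManyT K k (Abs t))
  (D : ℕ) (D-eq : suc D ≡ 2 * (2 * K) ^ k) where

  n C : ℕ
  n = suc n'
  C = (2 * K) ^ k

  record State (s : ℕ) : Set where
    field
      F : List (Vec (Fin n) k)
      X : Subset n
      wt : Vec (Fin n) r → ℕ
      F-occ : ∀ v → occs F v ≡ b2n (X v)
      F-self : All Self F
      hits : ∀ t → ∃ λ c → Hits Abs t F c × 2 ^ s ≤ wt t * 2 ^ c
      pot : C ^ s * sumVec r wt ≤ D ^ s * n ^ r
      X-size : size X ≤ k * s

  initial : State 0
  initial = record
    { F = [] ; X = λ _ → false ; wt = λ _ → 1 ; F-occ = λ _ → refl ; F-self = []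
    ; hits = λ t → 0 , none , ≤-refl
    ; pot = ≤-reflexive (cong (1 *_) (trans (sumVec-const {n} r 1) (*-identityʳ (n ^ r))))
    ; X-size = ≤-reflexive (trans (trans (sum-const n 0) (*-zeroʳ n)) (sym (*-zeroʳ k))) }

  module Step {s : ℕ} (st : State s) (room : 2 * (K * (size (State.X st) + k)) ≤ n) where
    open State st

    Good : Vec (Fin n) r → Vec (Fin n) k → Set
    Good t z = Abs t z × Fresh X z

    tree : ∀ t → ManyT (2 * K) k (Good t)
    tree t = ManyT-fresh k (Abs t) X room (trees t)

    hit? : Vec (Fin n) r → Vec (Fin n) k → Bool
    hit? t z = inTree k (Good t) (tree t) z

    wt' : Vec (Fin n) k → Vec (Fin n) r → ℕ
    wt' z t = wt t * (2 ∸ b2n (hit? t z))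

    Φ : ℕ
    Φ = sumVec r wt

    -- Every target is hit by a fraction at least 1 / C of all tuples, and a hit saves one doubling.
    -- Averaged over z, the total is multiplied by at most 2 - 1 / C = D / C.
    average : ∃ λ z → C * sumVec r (wt' z) ≤ D * Φ
    average = sumVec-avg k (λ z → C * sumVec r (wt' z)) (λ _ → D * Φ)
      (≤-trans (+-cancelʳ-≤ (n ^ k * Φ) _ _ bound) (≤-reflexive (sym (sumVec-const {n} k (D * Φ)))))
      where
      H : ℕ
      H = sumVec k (λ z → sumVec r (λ t → wt t * b2n (hit? t z)))
      split : sumVec k (λ z → sumVec r (wt' z)) + H ≡ n ^ k * (2 * Φ)
      split = trans (sym (sumVec-+ k _ _)) (trans (sumVec-cong k (λ z → trans (sym (sumVec-+ r (wt' z) (λ t → wt t * b2n (hit? t z))))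
        (trans (sumVec-cong r (λ t → pt (wt t) (hit? t z))) (sumVec-* r 2 wt)))) (sumVec-const {n} k (2 * Φ)))
        where
        pt : ∀ x b → x * (2 ∸ b2n b) + x * b2n b ≡ 2 * x
        pt x true = idt x
          where
          idt : ∀ x → x * 1 + x * 1 ≡ 2 * x
          idt = solve-∀
        pt x false = idt x
          where
          idt : ∀ x → x * 2 + x * 0 ≡ 2 * x
          idt = solve-∀
      many : n ^ k * Φ ≤ C * H
      many = ≤-trans (≤-reflexive (sym (sumVec-* r (n ^ k) wt))) (≤-trans (sumVec-mono r pt)
        (≤-reflexive (trans (sumVec-* r C _) (cong (C *_) (trans (sumVec-cong r (λ t → sym (sumVec-* k (wt t) _))) (sumVec-swap r k _))))))
        where
        pt : ∀ t → n ^ k * wt t ≤ C * (wt t * sumVec k (λ z → b2n (hit? t z)))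
        pt t = ≤-trans (≤-reflexive (*-comm (n ^ k) (wt t))) (≤-trans (mul (wt t) (inTree-count k (Good t) (tree t)))
          (≤-reflexive (idt (wt t) C (sumVec k (λ z → b2n (hit? t z))))))
          where
          idt : ∀ a b c → a * (b * c) ≡ b * (a * c)
          idt = solve-∀
      bound : sumVec k (λ z → C * sumVec r (wt' z)) + n ^ k * Φ ≤ n ^ k * (D * Φ) + n ^ k * Φ
      bound = ≤-trans (≤-reflexive (cong (_+ n ^ k * Φ) (sumVec-* k C _))) (≤-trans (+-monoʳ-≤ (C * sumVec k (λ z → sumVec r (wt' z))) many)
        (≤-reflexive (trans (sym (*-distribˡ-+ C _ H)) (trans (cong (C *_) split) (trans (idt C (n ^ k) Φ) (trans (cong (λ x → n ^ k * (x * Φ)) (sym D-eq)) (idt' D (n ^ k) Φ)))))))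
        where
        idt : ∀ C N Φ → C * (N * (2 * Φ)) ≡ N * (2 * C * Φ)
        idt = solve-∀
        idt' : ∀ D N Φ → N * (suc D * Φ) ≡ N * (D * Φ) + N * Φ
        idt' = solve-∀

    z : Vec (Fin n) k
    z = proj₁ average

    pot' : C ^ suc s * sumVec r (wt' z) ≤ D ^ suc s * n ^ r
    pot' = arith C D (C ^ s) (D ^ s) (sumVec r (wt' z)) Φ (n ^ r) (proj₂ average) pot
      where
      arith : ∀ C D c d w Φ N → C * w ≤ D * Φ → c * Φ ≤ d * N → C * c * w ≤ D * d * N
      arith C D c d w Φ N h1 h2 = lin 0 (mul c h1 ⊕ mul D h2) (idt C D c d w Φ N)
        where
        idt : ∀ C D c d w Φ N → C * c * w + (c * (D * Φ) + D * (d * N)) + 0 ≡ D * d * N + (c * (C * w) + D * (c * Φ))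
        idt = solve-∀

    size-step : k * s ≤ k * suc s
    size-step = *-monoʳ-≤ k (n≤1+n s)

    double : ∀ w b c → 2 ^ s ≤ w * 2 ^ c → 2 ^ suc s ≤ w * (2 ∸ b2n b) * 2 ^ (b2n b + c)
    double w true c h = ≤-trans (mul 2 h) (≤-reflexive (idt w (2 ^ c)))
      where
      idt : ∀ w p → 2 * (w * p) ≡ w * 1 * (2 * p)
      idt = solve-∀
    double w false c h = ≤-trans (mul 2 h) (≤-reflexive (idt w (2 ^ c)))
      where
      idt : ∀ w p → 2 * (w * p) ≡ w * 2 * p
      idt = solve-∀

    stay : (∀ t → hit? t z ≡ false) → State (suc s)
    stay no-hit = record
      { F = F ; X = X ; wt = wt' z ; F-occ = F-occ ; F-self = F-self
      ; hits = λ t → let (c , H , le) = hits t in c , H , subst (λ b → 2 ^ suc s ≤ wt t * (2 ∸ b2n b) * 2 ^ c) (sym (no-hit t)) (double (wt t) false c le)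
      ; pot = pot' ; X-size = ≤-trans X-size size-step }

    move : Fresh X z → Self z → State (suc s)
    move fresh sz = record
      { F = z ∷ F ; X = X' ; wt = wt' z
      ; F-occ = λ v → trans (cong (occ z v +_) (F-occ v)) (sym (X'-b2n v))
      ; F-self = sz ∷ F-self
      ; hits = λ t → let (c , H , le) = hits t in b2n (hit? t z) + c , extend t H (hit? t z) refl , double (wt t) (hit? t z) c le
      ; pot = pot'
      ; X-size = ≤-trans (≤-reflexive (trans (sum-cong n X'-b2n) (trans (sum-+ n (occ z) (λ v → b2n (X v))) (cong (_+ size X) (sum-occ z)))))
          (≤-trans (+-monoʳ-≤ k X-size) (≤-reflexive (sym (*-suc k s)))) }
      where
      X' : Subset n
      X' v = does (1 ≤? occ z v + b2n (X v))
      X'-b2n : ∀ v → b2n (X' v) ≡ occ z v + b2n (X v)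
      X'-b2n v = small (occ z v + b2n (X v)) (fresh v)
        where
        small : ∀ x → x ≤ 1 → b2n (does (1 ≤? x)) ≡ x
        small zero _ = refl
        small (suc zero) _ = refl
        small (suc (suc x)) (s≤s ())
      extend : ∀ t {c} → Hits Abs t F c → ∀ b → hit? t z ≡ b → Hits Abs t (z ∷ F) (b2n b + c)
      extend t H true e = hit (proj₁ (inTree-sound k (Good t) (tree t) z e)) H
      extend t H false e = skip H

    -- A hit certifies that z is fresh and packable. The averaged z may hit nothing; then it is left
    -- out of the family, and the weight bound of the step holds all the same.
    next : State (suc s)
    next = choose (1 ≤? sumVec r (λ t → b2n (hit? t z)))
      where
      true-of : ∀ {b} → 1 ≤ b2n b → b ≡ true
      true-of {true} _ = refl
      false-of : ∀ b → ¬ (1 ≤ b2n b) → b ≡ false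
      false-of true h = ⊥-elim (h ≤-refl)
      false-of false _ = refl
      choose : Dec (1 ≤ sumVec r (λ t → b2n (hit? t z))) → State (suc s)
      choose (yes p) = let (t , q) = sumVec-pos r (λ t → b2n (hit? t z)) p ; (a , fr) = inTree-sound k (Good t) (tree t) z (true-of q) in
        move fr (self t z a)
      choose (no ¬p) = stay (λ t → false-of (hit? t z) (λ q → ¬p (≤-trans q (sumVec-term r (λ t → b2n (hit? t z)) t))))

  iterate : ∀ m → 2 * (K * (k * m + k)) ≤ n → State m
  iterate zero h = initial
  iterate (suc m) h = Step.next st (≤-trans (*-monoʳ-≤ 2 (*-monoʳ-≤ K (+-monoˡ-≤ k (State.X-size st)))) h')
    where
    h' : 2 * (K * (k * m + k)) ≤ n
    h' = ≤-trans (*-monoʳ-≤ 2 (*-monoʳ-≤ K (+-monoˡ-≤ k (*-monoʳ-≤ k (n≤1+n m))))) h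
    st = iterate m h'

  -- After m = 2 h D steps a target with c hits satisfies 2^(m - c) ≤ (D / C)^m n^r. Since 2 C = D +
  -- 1, the factor (2 C / D)^m is at least 2^(2 h), and n^r takes away at most 2^h of it.
  family : ∀ h → n ^ r ≤ 2 ^ h → 2 * (K * (k * (D * (2 * h)) + k)) ≤ n → Σ (State (D * (2 * h))) λ st →
    ∀ t → ∃ λ c → h ≤ c × Hits Abs t (State.F st) c
  family h few room = st , λ t → let (c , H , le) = hits t in c , ^-2-cancel h c (enough t c le) , H
    where
    st = iterate (D * (2 * h)) room
    open State st
    m = D * (2 * h)
    1≤C : 1 ≤ C
    1≤C = ^-pos (2 * K) k (≤-trans 1≤K (m≤m+n K _))
    1≤D : 1 ≤ D
    1≤D = ≤-pred (≤-trans (*-monoʳ-≤ 2 1≤C) (≤-reflexive (sym D-eq)))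
    enough : ∀ t c → 2 ^ m ≤ wt t * 2 ^ c → 2 ^ h ≤ 2 ^ c
    enough t c le = cancel-pos (2 ^ h) (^-pos 2 h (s≤s z≤n)) (cancel-pos (D ^ m) (^-pos D m 1≤D)
      (≤-trans (≤-reflexive (trans (cong (D ^ m *_) (trans (sym (^-distribˡ-+-* 2 h h)) (cong (λ x → 2 ^ (h + x)) (sym (+-identityʳ h))))) (*-comm (D ^ m) (2 ^ (2 * h)))))
      (≤-trans (doubling D (2 * h) 1≤D) (≤-trans (≤-reflexive (trans (cong (_^ m) D-eq) (^-mul 2 C m)))
        (arith (2 ^ m) (C ^ m) (wt t) (2 ^ c) (sumVec r wt) (D ^ m) (n ^ r) (2 ^ h) le (sumVec-term r wt t) pot few)))))
      where
      arith : ∀ a C w p Φ d N h → a ≤ w * p → w ≤ Φ → C * Φ ≤ d * N → N ≤ h → a * C ≤ d * (h * p)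
      arith a C w p Φ d N h h1 h2 h3 h4 = ≤-trans (*-monoˡ-≤ C h1) (≤-trans (≤-reflexive (idt w p C))
        (≤-trans (mul p (≤-trans (mul C h2) (≤-trans h3 (mul d h4)))) (≤-reflexive (idt' p d h))))
        where
        idt : ∀ w p C → w * p * C ≡ p * (C * w)
        idt = solve-∀
        idt' : ∀ p d h → p * (d * h) ≡ d * (h * p)
        idt' = solve-∀

j<2^j : ∀ j → suc j ≤ 2 ^ j
j<2^j zero = ≤-refl
j<2^j (suc j) = lin j (mul 2 (j<2^j j)) (idt j (2 ^ j))
  where
  idt : ∀ j p → suc (suc j) + 2 * p + j ≡ 2 * p + 2 * suc j
  idt = solve-∀

-- With j the integer part of h / (2 r), the size of n gives n ≤ (j + 1)^2, and j + 1 ≤ 2^j, so n^r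
-- ≤ 2^(2 j r) ≤ 2^h.
power-below-exponential : ∀ r Q n h → 1 ≤ r → 1 ≤ Q → Q * (2 * r) * (Q * (2 * r)) ≤ n → suc n ≤ Q * h + Q → n ^ r ≤ 2 ^ h
power-below-exponential r Q n h 1≤r 1≤Q n-large h-large = ≤-trans (^-monoˡ-≤ r n≤sq) (≤-trans (≤-reflexive (^-mul (suc j) (suc j) r))
    (≤-trans (*-mono-≤ (^-monoˡ-≤ r (j<2^j j)) (^-monoˡ-≤ r (j<2^j j))) (≤-trans (≤-reflexive (trans (cong₂ _*_ (^-*-assoc 2 j r) (^-*-assoc 2 j r))
      (trans (sym (^-distribˡ-+-* 2 (j * r) (j * r))) (cong (2 ^_) (idt₀ j r))))) (^-monoʳ-≤ 2 jc≤h))))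
  where
  c = 2 * r
  fl = floor h c (≤-trans 1≤r (m≤m+n r _))
  j = proj₁ fl
  jc≤h : c * j ≤ h
  jc≤h = proj₁ (proj₂ fl)
  idt₀ : ∀ j r → j * r + j * r ≡ 2 * r * j
  idt₀ = solve-∀
  n< : suc n ≤ Q * c * suc j
  n< = ≤-trans h-large (lin 0 (mul Q (proj₂ (proj₂ fl))) (idt Q h c j))
    where
    idt : ∀ Q h c j → Q * h + Q + Q * (c * j + c) + 0 ≡ Q * c * suc j + Q * suc h
    idt = solve-∀
  Qc≤ : Q * c ≤ suc j
  Qc≤ with Q * c ≤? suc j
  ... | yes p = p
  ... | no ¬p = ⊥-elim (1+n≰n (≤-trans n< (≤-trans (mul (Q * c) (<⇒≤ (≰⇒> ¬p))) n-large)))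
  n≤sq : n ≤ suc j * suc j
  n≤sq = ≤-trans (n≤1+n n) (≤-trans n< (*-monoˡ-≤ (suc j) Qc≤))

-- Covering the leftover by the family

data Removal {B : Set} (z : B) : List B → List B → Set where
  here : ∀ {F} → Removal z (z ∷ F) F
  there : ∀ {y F F'} → Removal z F F' → Removal z (y ∷ F) (y ∷ F')

hits-pick : ∀ {A B : Set} {Abs : A → B → Set} {t F c} → 1 ≤ c → Hits Abs t F c → ∃ λ z → Abs t z × ∃ λ F' → Removal z F F'
hits-pick 1≤c (skip H) = let (z , a , F' , R) = hits-pick 1≤c H in z , a , _ , there R
hits-pick 1≤c (hit a H) = _ , a , _ , here

hits-remove : ∀ {A B : Set} {Abs : A → B → Set} {z t F F' c} → Removal z F F' → Hits Abs t F c → ∃ λ c' → c ≤ suc c' × Hits Abs t F' c'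
hits-remove here (skip H) = _ , n≤1+n _ , H
hits-remove here (hit a H) = _ , ≤-refl , H
hits-remove (there R) (skip H) = let (c' , le , H') = hits-remove R H in c' , le , skip H'
hits-remove (there R) (hit a H) = let (c' , le , H') = hits-remove R H in suc c' , s≤s le , hit a H'

occs-remove : ∀ {n k} {z : Vec (Fin n) k} {F F'} → Removal z F F' → ∀ v → occs F v ≡ occ z v + occs F' v
occs-remove here v = refl
occs-remove {z = z} (there {y} {F} {F'} R) v = trans (cong (occ y v +_) (occs-remove R v)) (idt (occ y v) (occ z v) (occs F' v))
  where
  idt : ∀ a b c → a + (b + c) ≡ b + (a + c)
  idt = solve-∀

all-remove : ∀ {B : Set} {P : B → Set} {z F F'} → Removal z F F' → All P F → All P F'
all-remove here (p ∷ ps) = ps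
all-remove (there R) (p ∷ ps) = p ∷ all-remove R ps

module _ {n r k : ℕ} (G : BiGraph n) (t : Labelling r) where

  Absorbing : Vec (Fin n) r → Vec (Fin n) k → Set
  Absorbing xs z = Packable G t (occ z) × Packable G t (λ v → occ z v + occ xs v)

  packable-family : ∀ (F : List (Vec (Fin n) k)) → All (λ z → Packable G t (occ z)) F → Packable G t (occs F)
  packable-family [] [] = packable-0 G t
  packable-family (z ∷ F) (p ∷ ps) = packable-+ G t (occ z) (occs F) p (packable-family F ps)

  -- Spending an absorber on one tuple lowers the count of any other tuple by at most one, so as
  -- many hits as there are tuples suffice.
  absorb-all : ∀ (ts : List (Vec (Fin n) r)) (F : List (Vec (Fin n) k)) → All (λ z → Packable G t (occ z)) F →
    (∀ xs → ∃ λ c → length ts ≤ c × Hits Absorbing xs F c) → Packable G t (λ v → occs F v + occs ts v)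
  absorb-all [] F ps H = packable-cong G t (occs F) _ (λ v → sym (+-identityʳ _)) (packable-family F ps)
  absorb-all (xs ∷ ts) F ps H = packable-cong G t (λ v → (occ z v + occ xs v) + (occs F' v + occs ts v)) _
      (λ v → trans (idt (occ z v) (occ xs v) (occs F' v) (occs ts v)) (cong (_+ (occ xs v + occs ts v)) (sym (occs-remove R v))))
      (packable-+ G t (λ v → occ z v + occ xs v) (λ v → occs F' v + occs ts v) (proj₂ a)
        (absorb-all ts F' (all-remove R ps) (λ ys →
          let (c , le , h) = H ys ; (c' , le' , h') = hits-remove R h in c' , ≤-pred (≤-trans le le') , h')))
    where
    picked = hits-pick (≤-trans (s≤s z≤n) (proj₁ (proj₂ (H xs)))) (proj₂ (proj₂ (H xs)))
    z = proj₁ picked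
    a = proj₁ (proj₂ picked)
    F' = proj₁ (proj₂ (proj₂ picked))
    R = proj₂ (proj₂ (proj₂ picked))
    idt : ∀ a b c d → a + b + (c + d) ≡ a + c + (b + d)
    idt = solve-∀

elements : ∀ {n} m (U : Subset n) → size U ≡ m → Σ (Vec (Fin n) m) λ vs → ∀ v → occ vs v ≡ b2n (U v)
elements {n} zero U h = [] , λ v → sym (n≤0⇒n≡0 (≤-trans (sum-term n (λ v → b2n (U v)) v) (≤-reflexive h)))
elements {n} (suc m) U h = u ∷ proj₁ rest , λ v → trans (cong (δ u v +_) (proj₂ rest v)) (sym (split v))
  where
  mem = member U (≤-trans (s≤s z≤n) (≤-reflexive (sym h)))
  u = proj₁ mem
  U' : Subset n
  U' v = U v ∧ not (does (u Fin.≟ v))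
  split : ∀ v → b2n (U v) ≡ δ u v + b2n (U' v)
  split v with u Fin.≟ v
  ... | yes refl rewrite proj₂ mem = refl
  ... | no _ = cong b2n (sym (Bool.∧-identityʳ (U v)))
  rest = elements m U' (suc-injective (trans (sym (trans (sum-cong n split) (trans (sum-+ n (δ u) _) (cong (_+ size U')
    (trans (sum-cong n (λ v → sym (*-identityʳ (δ u v)))) (sum-δ n u (λ _ → 1))))))) h))

chunks : ∀ {n} l r (vs : Vec (Fin n) (l * r)) → Σ (List (Vec (Fin n) r)) λ ts → length ts ≡ l × (∀ v → occs ts v ≡ occ vs v)
chunks zero r [] = [] , refl , λ _ → refl
chunks (suc l) r vs with Vec.splitAt r vs
... | us , ws , refl = let (ts , len , os) = chunks l r ws in
  us ∷ ts , cong suc len , λ v → trans (cong (occ us v +_) (os v)) (sym (occ-++ us ws v))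

sum-occs : ∀ {n k} (L : List (Vec (Fin n) k)) → sumFin n (occs L) ≡ length L * k
sum-occs {n} [] = trans (sum-const n 0) (*-zeroʳ n)
sum-occs {n} (x ∷ L) = trans (sum-+ n (occ x) (occs L)) (cong₂ _+_ (sum-occ x) (sum-occs L))

-- With r = p + 1, members of the family have r + r p = r^2 entries and copies have r, so r divides
-- |U| because it divides n. As every tuple can be absorbed, U may be cut into tuples arbitrarily.
complete : ∀ {n p} (G : BiGraph n) (t : Labelling (suc p)) (h : ℕ) (X U : Subset n) →
  (F : List (Vec (Fin n) (suc p + suc p * p))) → (∀ v → occs F v ≡ b2n (X v)) → All (λ z → Packable G t (occ z)) F →
  (∀ xs → ∃ λ c → h ≤ c × Hits (Absorbing G t) xs F c) →
  (L : List (Vec (Fin n) (suc p))) → All (Copy G t) L → (∀ v → occs L v + b2n (U v) ≡ b2n (not (X v))) →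
  suc p ∣ n → size U ≤ suc p * h → Packable G t (λ _ → 1)
complete {n} {p} G t h X U F F-occ F-self hits L L-copy L-occ r∣n U-small =
  packable-cong G t (λ v → occs L v + (occs F v + occs ts v)) (λ _ → 1) covered
    (packable-+ G t (occs L) (λ v → occs F v + occs ts v) (L , L-copy , λ _ → refl)
      (absorb-all G t ts F F-self (λ xs → let (c , le , H) = hits xs in c , ≤-trans len≤h le , H)))
  where
  count : length F * (suc p + suc p * p) + length L * suc p + size U ≡ n
  count = trans (cong₂ _+_ (cong₂ _+_ (trans (sym (sum-occs F)) (sum-cong n F-occ)) (sym (sum-occs L))) refl)
    (trans (+-assoc (size X) _ _) (trans (cong (size X +_) (trans (sym (sum-+ n (occs L) (λ v → b2n (U v)))) (sum-cong n L-occ))) (sym (size-∁ X))))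
  r∣U : suc p ∣ size U
  r∣U = ∣m+n∣m⇒∣n (subst (suc p ∣_) (sym count) r∣n)
    (∣m∣n⇒∣m+n (subst (suc p ∣_) (trans (cong (length F *_) refl) refl) (divides (length F * suc p) (idt (length F) (suc p) p))) (n∣m*n (length L)))
    where
    idt : ∀ f r p → f * (r + r * p) ≡ f * (1 + p) * r
    idt = solve-∀
  l = _∣_.quotient r∣U
  U-eq : size U ≡ l * suc p
  U-eq = _∣_.equality r∣U
  el = elements (l * suc p) U U-eq
  ch = chunks l (suc p) (proj₁ el)
  ts = proj₁ ch
  len≤h : length ts ≤ h
  len≤h = ≤-trans (≤-reflexive (proj₁ (proj₂ ch))) (cancel-mul p l h (≤-trans (≤-reflexive (trans (*-comm (suc p) l) (sym U-eq))) U-small))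
  covered : ∀ v → occs L v + (occs F v + occs ts v) ≡ 1
  covered v = trans (cong₂ (λ a b → occs L v + (a + b)) (F-occ v) (trans (proj₂ (proj₂ ch) v) (proj₂ el v)))
    (trans (idt (occs L v) (b2n (X v)) (b2n (U v))) (trans (cong (_+ b2n (X v)) (L-occ v)) (one (X v))))
    where
    idt : ∀ a b c → a + (b + c) ≡ a + c + b
    idt = solve-∀
    one : ∀ b → b2n (not b) + b2n b ≡ 1
    one true = refl
    one false = refl

module Assembly {n' : ℕ} (G : BiGraph (suc n')) (k g e : ℕ) (1≤g : 1 ≤ g)
  (deg : ∀ b v → (3 + k) * size (A G b v) ≤ suc n' + e) (ns : NonSparse G (3 + k) g)
  (t : Labelling (3 + k)) (at : Anti t) (shape : Shape k t) (r∣n : 3 + k ∣ suc n')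
  (K Λ D h κ K₂ K₄ : ℕ)
  (K-def : K ≡ 128 * (g * (3 + k)))
  (Λ-def : Λ ≡ 64 * g * (Scale.G₂ (2 + k) + suc (3 + k)) + 1)
  (D-def : suc D ≡ 2 * (2 * K) ^ (3 + k + (3 + k) * (2 + k)))
  (e-swap : 4 * (K * ((3 + k) * e)) ≤ suc n') (e-copy : 2 * ((3 + k) * e) ≤ suc n') (e-track : 8 * g * e ≤ suc n')
  (h-power : suc n' ^ (3 + k) ≤ 2 ^ h)
  (room : 2 * (K * ((3 + k + (3 + k) * (2 + k)) * (D * (2 * h)) + (3 + k + (3 + k) * (2 + k)))) ≤ suc n')
  (f-track : 32 * g * ((3 + k) * ((3 + k + (3 + k) * (2 + k)) * (D * (2 * h)))) ≤ suc n')
  (excess : 4 * Λ * (e + (3 + k) * ((3 + k + (3 + k) * (2 + k)) * (D * (2 * h)))) ≤ suc n')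
  (n-large : 8 * g ≤ suc n') (κ-large : suc n' ≤ K₂ * κ) (h-large : suc n' ≤ K₄ * ((3 + k) * h))
  (κ-small : 4 * Λ * (K₄ * κ) ≤ suc n')
  (constants : 2 * Λ * (4 * ((3 + k) * K₂ * ((3 + k) * K₂)) + 4 * ((3 + k) * K₂ * ((3 + k) * K₂)) * (2 * (3 + k) * K₄) + (5 + k)) ≤ (3 + k) * h)
  where

  n r z f μ : ℕ
  n = suc n'
  r = 3 + k
  z = r + r * (2 + k)
  f = z * (D * (2 * h))
  μ = r * h

  swaps : ∀ x y → ManyT K (2 + k) (λ vs → Tiles G t (x ∷ vs) × Tiles G t (y ∷ vs))
  swaps x y = subst (λ K → ManyT K (2 + k) (λ vs → Tiles G t (x ∷ vs) × Tiles G t (y ∷ vs))) (sym K-def)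
    (many-swaps G k g e 1≤g deg ns (subst (λ K → 4 * (K * (r * e)) ≤ n) K-def e-swap) t at shape x y)

  K≥2r : 2 * r ≤ K
  K≥2r = ≤-trans (arith r g 1≤g) (≤-reflexive (sym K-def))
    where
    arith : ∀ r g → 1 ≤ g → 2 * r ≤ 128 * (g * r)
    arith r (suc g) _ = ≤-trans (m≤m+n (2 * r) (126 * r + 128 * (g * r))) (≤-reflexive (idt r g))
      where
      idt : ∀ r g → 2 * r + (126 * r + 128 * (g * r)) ≡ 128 * (suc g * r)
      idt = solve-∀

  1≤K : 1 ≤ K
  1≤K = ≤-trans (s≤s z≤n) K≥2r

  trees : ∀ xs → ManyT K z (Absorbing G t xs)
  trees = Absorbers.many-absorbers G t K swaps (many-copies G (2 + k) K e deg e-copy K≥2r t at)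

  open Selection {n'} {r} {z} (Absorbing G t) (λ z → Packable G t (occ z)) (λ _ _ → proj₁) K 1≤K trees D D-def
    using (State; family)

  chosen : Σ (State (D * (2 * h))) λ st → ∀ xs → ∃ λ c → h ≤ c × Hits (Absorbing G t) xs (State.F st) c
  chosen = family h h-power room

  module T = Tracking G (2 + k) g e f κ K₂ K₄ t at (s≤s z≤n) 1≤g deg ns κ-large n-large e-track f-track

  1≤Λ : 1 ≤ Λ
  1≤Λ = ≤-trans (m≤n+m 1 _) (≤-reflexive (sym Λ-def))

  μ-large : suc (T.B + r) ≤ μ
  μ-large = ≤-trans (arith Λ T.B T.B₁ k 1≤Λ) constants
    where
    arith : ∀ Λ B B₁ k → 1 ≤ Λ → suc (B + (3 + k)) ≤ 2 * Λ * (B + B₁ + (5 + k))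
    arith (suc Λ) B B₁ k _ = ≤-trans (m≤m+n _ (2 * Λ * (B + B₁ + (5 + k)) + (B + B₁ + B₁ + k + 6))) (≤-reflexive (idt Λ B B₁ k))
      where
      idt : ∀ Λ B B₁ k → suc (B + (3 + k)) + (2 * Λ * (B + B₁ + (5 + k)) + (B + B₁ + B₁ + k + 6)) ≡ 2 * suc Λ * (B + B₁ + (5 + k))
      idt = solve-∀

  open Packing G (2 + k) t T.S T.target T.target≤n T.B μ μ-large using (Φ; C; LightCopies; Packed; pack)

  -- The degree loss from e and from the f vertices of the family, rescaled from n to m vertices; it
  -- is a fraction 1 / (4 Λ) of m, rounded up.
  excess' : ∀ m → ∃ λ ρ → (e + r * f) * m ≤ n * ρ × 4 * Λ * ρ ≤ m + 4 * Λ
  excess' m = suc ρ₀ , cancel-pos (4 * Λ) (≤-trans 1≤Λ (m≤m+n Λ _)) (≤-trans (≤-reflexive (sym (*-assoc (4 * Λ) (e + r * f) m)))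
      (≤-trans (*-monoˡ-≤ m excess) (≤-trans (mul n (≤-trans (n≤1+n m) (proj₂ (proj₂ fl)))) (≤-reflexive (idt n Λ ρ₀))))) ,
    ≤-trans (≤-reflexive (idt' Λ ρ₀)) (+-monoˡ-≤ (4 * Λ) (proj₁ (proj₂ fl)))
    where
    fl = floor m (4 * Λ) (≤-trans 1≤Λ (m≤m+n Λ _))
    ρ₀ : ℕ
    ρ₀ = proj₁ fl
    idt : ∀ n Λ ρ → n * (4 * Λ * ρ + 4 * Λ) ≡ 4 * Λ * (n * suc ρ)
    idt = solve-∀
    idt' : ∀ Λ ρ → 4 * Λ * suc ρ ≡ 4 * Λ * ρ + 4 * Λ
    idt' = solve-∀

  light : ∀ U → μ ≤ size U → Φ U ≤ n * C → LightCopies U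
  light U large potential = T.Bad.light-copies μ μ-large U potential ρ (proj₁ (proj₂ (excess' (size U))))
    (≤-trans h-large (*-monoʳ-≤ K₄ large))
    (subst (λ x → x * (T.B + (T.B₁ + (κ + (ρ + 1)))) ≤ size U) Λ-def
      (arith Λ T.B T.B₁ κ ρ K₄ n h k (size U) (s≤s z≤n) constants large (proj₂ (proj₂ (excess' (size U)))) κ-small h-large))
    where
    ρ : ℕ
    ρ = proj₁ (excess' (size U))
    arith : ∀ Λ B B₁ κ ρ K₄ n h k m → 1 ≤ n → 2 * Λ * (B + B₁ + (5 + k)) ≤ (3 + k) * h → (3 + k) * h ≤ m → 4 * Λ * ρ ≤ m + 4 * Λ →
      4 * Λ * (K₄ * κ) ≤ n → n ≤ K₄ * ((3 + k) * h) → Λ * (B + (B₁ + (κ + (ρ + 1)))) ≤ m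
    arith Λ B B₁ κ ρ zero n h k m 1≤n h1 h2 h3 h4 h5 = ⊥-elim (1+n≰n {0} (≤-trans 1≤n h5))
    arith Λ B B₁ κ ρ (suc K₄) n h k m 1≤n h1 h2 h3 h4 h5 = *-cancelˡ-≤ 4
      (lin (4 * (Λ * k) + 12 * Λ) (mul 2 h1 ⊕ mul 3 h2 ⊕ h3 ⊕ small) (idt Λ B B₁ κ ρ h k m))
      where
      small : 4 * Λ * κ ≤ (3 + k) * h
      small = cancel-mul K₄ _ _ (≤-trans (≤-reflexive (swap Λ κ (suc K₄))) (≤-trans h4 h5))
        where
        swap : ∀ Λ κ K → K * (4 * Λ * κ) ≡ 4 * Λ * (K * κ)
        swap = solve-∀
      idt : ∀ Λ B B₁ κ ρ h k m → 4 * (Λ * (B + (B₁ + (κ + (ρ + 1))))) + (2 * ((3 + k) * h) + (3 * m + (m + 4 * Λ + (3 + k) * h))) + (4 * (Λ * k) + 12 * Λ) ≡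
        4 * m + (2 * (2 * Λ * (B + B₁ + (5 + k))) + (3 * ((3 + k) * h) + (4 * Λ * ρ + 4 * Λ * κ)))
      idt = solve-∀

  perfect : Packable G t (λ _ → 1)
  perfect = complete G t h X (proj₁ packed) F F-occ F-self (proj₂ chosen) (proj₁ P) (proj₁ (proj₂ P)) (proj₂ (proj₂ P)) r∣n
    (≤-trans (n≤1+n _) (proj₂ (proj₂ packed)))
    where
    open State (proj₁ chosen)
    packed : ∃ λ U → Packed (∁ X) U × suc (size U) ≤ μ
    packed = pack (∁ X) (T.start μ μ-large (∁ X) (≤-trans (≤-reflexive (trans (size-∁ X) (+-comm (size X) _))) (+-monoʳ-≤ (size (∁ X)) X-size)))
      (λ U _ → light U)
    P = proj₁ (proj₂ packed)

-- Choice of constants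

-- H makes the absorbing family occupy a fraction of n depending on r and g only; W makes the error κ of the
-- tracked sets small compared with the number h of tuples that can be absorbed.
private
  instantiate : ∀ k g → 1 ≤ g → ∀ K Λ D H W z B B₁ → K ≡ 128 * (g * (3 + k)) → Λ ≡ 64 * g * (Scale.G₂ (2 + k) + suc (3 + k)) + 1 →
    z ≡ 3 + k + (3 + k) * (2 + k) → suc D ≡ 2 * (2 * K) ^ z →
    H ≡ 32 * (g * ((3 + k) * (z * (D * 2)))) + 4 * (K * (z * (D * 2))) + 8 * (Λ * ((3 + k) * (z * (D * 2)))) + 1 →
    W ≡ 4 * Λ * (2 * H) → B ≡ 4 * ((3 + k) * (2 * W) * ((3 + k) * (2 * W))) → B₁ ≡ B * (2 * (3 + k) * (2 * H)) →
    ∀ n' (G : BiGraph (suc n')) e (t : Labelling (3 + k)) → Anti t → Shape k t → 3 + k ∣ suc n' →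
    H * suc (2 * Λ * (B + B₁ + (5 + k))) ≤ suc n' × 4 * (K * z) ≤ suc n' × W ≤ suc n' × 8 * g ≤ suc n' × H * (2 * (3 + k)) * (H * (2 * (3 + k))) ≤ suc n' →
    (4 * (K * (3 + k)) + 2 * (3 + k) + 8 * g + 8 * Λ) * e ≤ suc n' →
    (∀ b v → (3 + k) * size (A G b v) ≤ suc n' + e) → NonSparse G (3 + k) g → Packable G t (λ _ → 1)
  instantiate k g 1≤g K Λ D H W z B B₁ K-def Λ-def refl D-def H-def W-def refl refl n' G e t at shape r∣n (HN≤n , Kz≤n , W≤n , g≤n , H²≤n) e-small deg ns =
    Assembly.perfect G k g e 1≤g deg ns t at shape r∣n K Λ D h κ (2 * W) (2 * H) K-def Λ-def D-def
      (≤-trans (e₁ K r g Λ e) e-small) (≤-trans (e₂ K r g Λ e) e-small) (≤-trans (e₃ K r g Λ e) e-small)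
      (power-below-exponential r H n h (s≤s z≤n) 1≤H H²≤n h-high)
      (room K z D h n (≤-trans (f₂ g r z D K Λ H h H-def) h-low) Kz≤n)
      (≤-trans (f₁ g r z D K Λ H h H-def) h-low)
      (excess Λ e r z D h n (≤-trans (e₄ K r g Λ e) e-small) (≤-trans (f₃ g r z D K Λ H h H-def) h-low))
      g≤n
      (≤-trans (doubled W κ n κ-high W≤n) (≤-reflexive refl))
      (≤-trans (doubled H h n h-high H≤n) (*-monoʳ-≤ (2 * H) (m≤m+n h ((2 + k) * h))))
      (≤-trans (≤-reflexive (trans (assoc Λ H κ) (cong (_* κ) (sym W-def)))) κ-low)
      (≤-trans (<⇒≤ N<h) (m≤m+n h ((2 + k) * h)))
    where
    r n : ℕ
    r = 3 + k
    n = suc n'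
    1≤H : 1 ≤ H
    1≤H = ≤-trans (m≤n+m 1 (32 * (g * (r * (z * (D * 2)))) + 4 * (K * (z * (D * 2))) + 8 * (Λ * (r * (z * (D * 2)))))) (≤-reflexive (sym H-def))
    1≤Λ : 1 ≤ Λ
    1≤Λ = ≤-trans (m≤n+m 1 (64 * g * (Scale.G₂ (2 + k) + suc (3 + k)))) (≤-reflexive (sym Λ-def))
    1≤W : 1 ≤ W
    1≤W = ≤-trans (*-mono-≤ (≤-trans 1≤Λ (m≤m+n Λ _)) (≤-trans 1≤H (m≤m+n H _))) (≤-reflexive (sym W-def))
    hf = floor n H 1≤H
    h : ℕ
    h = proj₁ hf
    h-low : H * h ≤ n
    h-low = proj₁ (proj₂ hf)
    h-high : suc n ≤ H * h + H
    h-high = proj₂ (proj₂ hf)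
    κf = floor n W 1≤W
    κ : ℕ
    κ = proj₁ κf
    κ-low : W * κ ≤ n
    κ-low = proj₁ (proj₂ κf)
    κ-high : suc n ≤ W * κ + W
    κ-high = proj₂ (proj₂ κf)
    N : ℕ
    N = 2 * Λ * (B + B₁ + (5 + k))
    H≤n : H ≤ n
    H≤n = ≤-trans (≤-trans (≤-reflexive (sym (*-identityʳ H))) (*-monoʳ-≤ H (s≤s z≤n))) HN≤n
    N<h : suc N ≤ h
    N<h = ≤-pred (*-cancelˡ-< H (suc N) (suc h) (≤-trans (s≤s HN≤n) (≤-trans h-high (≤-reflexive (idt H h)))))
      where
      idt : ∀ H h → H * h + H ≡ H * suc h
      idt = solve-∀
    doubled : ∀ W κ n → suc n ≤ W * κ + W → W ≤ n → n ≤ 2 * W * κ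
    doubled W zero n h1 h2 = ⊥-elim (1+n≰n (≤-trans h1 (≤-trans (≤-reflexive (cong (_+ W) (*-zeroʳ W))) h2)))
    doubled W (suc κ) n h1 h2 = lin (suc (W * κ)) h1 (idt W κ n)
      where
      idt : ∀ W κ n → n + (W * suc κ + W) + suc (W * κ) ≡ 2 * W * suc κ + suc n
      idt = solve-∀
    assoc : ∀ Λ H κ → 4 * Λ * (2 * H * κ) ≡ 4 * Λ * (2 * H) * κ
    assoc = solve-∀
    e₁ : ∀ K r g Λ e → 4 * (K * (r * e)) ≤ (4 * (K * r) + 2 * r + 8 * g + 8 * Λ) * e
    e₁ K r g Λ e = ≤-trans (m≤m+n _ ((2 * r + 8 * g + 8 * Λ) * e)) (≤-reflexive (idt K r g Λ e))
      where
      idt : ∀ K r g Λ e → 4 * (K * (r * e)) + (2 * r + 8 * g + 8 * Λ) * e ≡ (4 * (K * r) + 2 * r + 8 * g + 8 * Λ) * e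
      idt = solve-∀
    e₂ : ∀ K r g Λ e → 2 * (r * e) ≤ (4 * (K * r) + 2 * r + 8 * g + 8 * Λ) * e
    e₂ K r g Λ e = ≤-trans (m≤m+n _ ((4 * (K * r) + 8 * g + 8 * Λ) * e)) (≤-reflexive (idt K r g Λ e))
      where
      idt : ∀ K r g Λ e → 2 * (r * e) + (4 * (K * r) + 8 * g + 8 * Λ) * e ≡ (4 * (K * r) + 2 * r + 8 * g + 8 * Λ) * e
      idt = solve-∀
    e₃ : ∀ K r g Λ e → 8 * g * e ≤ (4 * (K * r) + 2 * r + 8 * g + 8 * Λ) * e
    e₃ K r g Λ e = *-monoˡ-≤ e (≤-trans (m≤n+m (8 * g) (4 * (K * r) + 2 * r)) (m≤m+n (4 * (K * r) + 2 * r + 8 * g) (8 * Λ)))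
    e₄ : ∀ K r g Λ e → 8 * Λ * e ≤ (4 * (K * r) + 2 * r + 8 * g + 8 * Λ) * e
    e₄ K r g Λ e = *-monoˡ-≤ e (m≤n+m (8 * Λ) (4 * (K * r) + 2 * r + 8 * g))
    f₁ : ∀ g r z D K Λ H h → H ≡ 32 * (g * (r * (z * (D * 2)))) + 4 * (K * (z * (D * 2))) + 8 * (Λ * (r * (z * (D * 2)))) + 1 →
      32 * g * (r * (z * (D * (2 * h)))) ≤ H * h
    f₁ g r z D K Λ _ h refl = ≤-trans (m≤m+n _ ((4 * (K * (z * (D * 2))) + 8 * (Λ * (r * (z * (D * 2)))) + 1) * h)) (≤-reflexive (idt g r z D K Λ h))
      where
      idt : ∀ g r z D K Λ h → 32 * g * (r * (z * (D * (2 * h)))) + (4 * (K * (z * (D * 2))) + 8 * (Λ * (r * (z * (D * 2)))) + 1) * h ≡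
        (32 * (g * (r * (z * (D * 2)))) + 4 * (K * (z * (D * 2))) + 8 * (Λ * (r * (z * (D * 2)))) + 1) * h
      idt = solve-∀
    f₂ : ∀ g r z D K Λ H h → H ≡ 32 * (g * (r * (z * (D * 2)))) + 4 * (K * (z * (D * 2))) + 8 * (Λ * (r * (z * (D * 2)))) + 1 →
      4 * (K * (z * (D * (2 * h)))) ≤ H * h
    f₂ g r z D K Λ _ h refl = ≤-trans (m≤m+n _ ((32 * (g * (r * (z * (D * 2)))) + 8 * (Λ * (r * (z * (D * 2)))) + 1) * h)) (≤-reflexive (idt g r z D K Λ h))
      where
      idt : ∀ g r z D K Λ h → 4 * (K * (z * (D * (2 * h)))) + (32 * (g * (r * (z * (D * 2)))) + 8 * (Λ * (r * (z * (D * 2)))) + 1) * h ≡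
        (32 * (g * (r * (z * (D * 2)))) + 4 * (K * (z * (D * 2))) + 8 * (Λ * (r * (z * (D * 2)))) + 1) * h
      idt = solve-∀
    f₃ : ∀ g r z D K Λ H h → H ≡ 32 * (g * (r * (z * (D * 2)))) + 4 * (K * (z * (D * 2))) + 8 * (Λ * (r * (z * (D * 2)))) + 1 →
      8 * (Λ * (r * (z * (D * (2 * h))))) ≤ H * h
    f₃ g r z D K Λ _ h refl = ≤-trans (m≤m+n _ ((32 * (g * (r * (z * (D * 2)))) + 4 * (K * (z * (D * 2))) + 1) * h)) (≤-reflexive (idt g r z D K Λ h))
      where
      idt : ∀ g r z D K Λ h → 8 * (Λ * (r * (z * (D * (2 * h))))) + (32 * (g * (r * (z * (D * 2)))) + 4 * (K * (z * (D * 2))) + 1) * h ≡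
        (32 * (g * (r * (z * (D * 2)))) + 4 * (K * (z * (D * 2))) + 8 * (Λ * (r * (z * (D * 2)))) + 1) * h
      idt = solve-∀
    room : ∀ K z D h n → 4 * (K * (z * (D * (2 * h)))) ≤ n → 4 * (K * z) ≤ n → 2 * (K * (z * (D * (2 * h)) + z)) ≤ n
    room K z D h n h1 h2 = *-cancelˡ-≤ 2 (lin 0 (h1 ⊕ h2) (idt K z (z * (D * (2 * h))) n))
      where
      idt : ∀ K z f n → 2 * (2 * (K * (f + z))) + (n + n) + 0 ≡ 2 * n + (4 * (K * f) + 4 * (K * z))
      idt = solve-∀
    excess : ∀ Λ e r z D h n → 8 * Λ * e ≤ n → 8 * (Λ * (r * (z * (D * (2 * h))))) ≤ n → 4 * Λ * (e + r * (z * (D * (2 * h)))) ≤ n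
    excess Λ e r z D h n h1 h2 = *-cancelˡ-≤ 2 (lin 0 (h1 ⊕ h2) (idt Λ e (r * (z * (D * (2 * h)))) n))
      where
      idt : ∀ Λ e f n → 2 * (4 * Λ * (e + f)) + (n + n) + 0 ≡ 2 * n + (8 * Λ * e + 8 * (Λ * f))
      idt = solve-∀

  parts : ∀ a b c d e n → a + (b + (c + (d + e))) ≤ n → a ≤ n × b ≤ n × c ≤ n × d ≤ n × e ≤ n
  parts a b c d e n h = m+n≤o⇒m≤o a h , m+n≤o⇒m≤o b h₁ , m+n≤o⇒m≤o c h₂ , m+n≤o⇒m≤o d h₃ , m+n≤o⇒n≤o d h₃
    where
    h₁ = m+n≤o⇒n≤o a h
    h₂ = m+n≤o⇒n≤o b h₁
    h₃ = m+n≤o⇒n≤o c h₂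

packing-constants : ∀ k g → 1 ≤ g → Σ ℕ λ Ec → Σ ℕ λ n₀ → 1 ≤ Ec × (∀ n' → n₀ ≤ suc n' → (G : BiGraph (suc n')) (e : ℕ) (t : Labelling (3 + k)) →
  Anti t → Shape k t → 3 + k ∣ suc n' → Ec * e ≤ suc n' →
  (∀ b v → (3 + k) * size (A G b v) ≤ suc n' + e) → NonSparse G (3 + k) g → Packable G t (λ _ → 1))
packing-constants k g 1≤g = Ec , n₀ , pos , λ n' large G e t at shape r∣n small deg ns →
    instantiate k g 1≤g K Λ D H W z B B₁ refl refl refl D-def refl refl refl refl n' G e t at shape r∣n
      (parts (H * suc (2 * Λ * (B + B₁ + (5 + k)))) (4 * (K * z)) W (8 * g) (H * (2 * (3 + k)) * (H * (2 * (3 + k)))) (suc n') large) small deg ns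
  where
  K Λ z D H W B B₁ Ec n₀ : ℕ
  K = 128 * (g * (3 + k))
  Λ = 64 * g * (Scale.G₂ (2 + k) + suc (3 + k)) + 1
  z = 3 + k + (3 + k) * (2 + k)
  D = 2 * (2 * K) ^ z ∸ 1
  H = 32 * (g * ((3 + k) * (z * (D * 2)))) + 4 * (K * (z * (D * 2))) + 8 * (Λ * ((3 + k) * (z * (D * 2)))) + 1
  W = 4 * Λ * (2 * H)
  B = 4 * ((3 + k) * (2 * W) * ((3 + k) * (2 * W)))
  B₁ = B * (2 * (3 + k) * (2 * H))
  -- A sum with one term per requirement on e; likewise n₀ adds up the lower bounds required of n.
  Ec = 4 * (K * (3 + k)) + 2 * (3 + k) + 8 * g + 8 * Λ
  n₀ = H * suc (2 * Λ * (B + B₁ + (5 + k))) + (4 * (K * z) + (W + (8 * g + H * (2 * (3 + k)) * (H * (2 * (3 + k))))))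
  pos : 1 ≤ Ec
  pos = ≤-trans (s≤s z≤n) (≤-trans (m≤n+m (2 * (3 + k)) (4 * (K * (3 + k)))) (≤-trans (m≤m+n (4 * (K * (3 + k)) + 2 * (3 + k)) (8 * g)) (m≤m+n (4 * (K * (3 + k)) + 2 * (3 + k) + 8 * g) (8 * Λ))))
  1≤K : 1 ≤ K
  1≤K = ≤-trans (*-mono-≤ 1≤g (s≤s (z≤n {2 + k}))) (m≤m+n (g * (3 + k)) _)
  D-def : suc D ≡ 2 * (2 * K) ^ z
  D-def = m+[n∸m]≡n (≤-trans (^-pos' (2 * K) z (≤-trans 1≤K (m≤m+n K _))) (m≤m+n _ _))
    where
    ^-pos' : ∀ x k → 1 ≤ x → 1 ≤ x ^ k
    ^-pos' x zero h = ≤-refl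
    ^-pos' x (suc k) h = *-mono-≤ h (^-pos' x k h)

-- Rational hypotheses

-- Imported only now: the constructor +_ of ℤ makes the sections of _+_ on ℕ ambiguous.
open import Data.Integer using (+_)
import Data.Integer as ℤ
import Data.Integer.Properties as ℤₚ
open import Data.Rational using (ℚ; mkℚ; _<_; _-_; _/_; 0ℚ; 1ℚ; toℚᵘ; *<*)
import Data.Rational as ℚ
import Data.Rational.Properties as ℚₚ
import Data.Rational.Solver
open import Data.Rational.Unnormalised using (mkℚᵘ; *≡*; *≤*)
import Data.Rational.Unnormalised as ℚᵘ
import Data.Rational.Unnormalised.Properties as ℚᵘₚ

ι-unnormalised : ∀ k → toℚᵘ (ℕ→ℚ k) ℚᵘ.≃ mkℚᵘ (+ k) 0
ι-unnormalised k = ℚₚ.toℚᵘ-fromℚᵘ (mkℚᵘ (+ k) 0)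

ι-+ : ∀ a b → ℕ→ℚ (a + b) ≡ ℕ→ℚ a ℚ.+ ℕ→ℚ b
ι-+ a b = ℚₚ.toℚᵘ-injective (ℚᵘₚ.≃-trans (ι-unnormalised (a + b)) (ℚᵘₚ.≃-trans (*≡* eq)
  (ℚᵘₚ.≃-sym (ℚᵘₚ.≃-trans (ℚₚ.toℚᵘ-homo-+ (ℕ→ℚ a) (ℕ→ℚ b)) (ℚᵘₚ.+-cong (ι-unnormalised a) (ι-unnormalised b))))))
  where
  eq : + (a + b) ℤ.* + 1 ≡ (+ a ℤ.* + 1 ℤ.+ + b ℤ.* + 1) ℤ.* + 1
  eq = cong (ℤ._* + 1) (sym (cong₂ ℤ._+_ (ℤₚ.*-identityʳ (+ a)) (ℤₚ.*-identityʳ (+ b))))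

ι-* : ∀ a b → ℕ→ℚ (a * b) ≡ ℕ→ℚ a ℚ.* ℕ→ℚ b
ι-* a b = ℚₚ.toℚᵘ-injective (ℚᵘₚ.≃-trans (ι-unnormalised (a * b)) (ℚᵘₚ.≃-trans (*≡* (cong (ℤ._* + 1) (ℤₚ.pos-* a b)))
  (ℚᵘₚ.≃-sym (ℚᵘₚ.≃-trans (ℚₚ.toℚᵘ-homo-* (ℕ→ℚ a) (ℕ→ℚ b)) (ℚᵘₚ.*-cong (ι-unnormalised a) (ι-unnormalised b))))))

ι-mono : ∀ {a b} → a ≤ b → ℕ→ℚ a ℚ.≤ ℕ→ℚ b
ι-mono {a} {b} h = ℚₚ.toℚᵘ-cancel-≤ (ℚᵘₚ.≤-respˡ-≃ (ℚᵘₚ.≃-sym (ι-unnormalised a)) (ℚᵘₚ.≤-respʳ-≃ (ℚᵘₚ.≃-sym (ι-unnormalised b))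
  (*≤* (ℤₚ.*-monoʳ-≤-nonNeg (+ 1) (ℤ.+≤+ h)))))

ι-cancel : ∀ {a b} → ℕ→ℚ a ℚ.≤ ℕ→ℚ b → a ≤ b
ι-cancel {a} {b} h = ℤₚ.drop‿+≤+ (subst₂ ℤ._≤_ (ℤₚ.*-identityʳ (+ a)) (ℤₚ.*-identityʳ (+ b))
  (ℚᵘₚ.drop-*≤* (ℚᵘₚ.≤-respˡ-≃ (ι-unnormalised a) (ℚᵘₚ.≤-respʳ-≃ (ι-unnormalised b) (ℚₚ.toℚᵘ-mono-≤ h)))))

ι-inverse : ∀ d → ℕ→ℚ (suc d) ℚ.* ((+ 1) / suc d) ≡ 1ℚ
ι-inverse d = ℚₚ.toℚᵘ-injective (ℚᵘₚ.≃-trans (ℚₚ.toℚᵘ-homo-* (ℕ→ℚ (suc d)) ((+ 1) / suc d))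
  (ℚᵘₚ.≃-trans (ℚᵘₚ.*-cong (ι-unnormalised (suc d)) (ℚₚ.toℚᵘ-fromℚᵘ (mkℚᵘ (+ 1) d))) (*≡* eq)))
  where
  eq : + suc d ℤ.* + 1 ℤ.* + 1 ≡ + 1 ℤ.* + (1 * suc d)
  eq = trans (ℤₚ.*-identityʳ (+ suc d ℤ.* + 1)) (trans (ℤₚ.*-comm (+ suc d) (+ 1)) (cong (λ z → + 1 ℤ.* + z) (sym (+-identityʳ (suc d)))))

ι-scale : ∀ k {p q} → p ℚ.≤ q → ℕ→ℚ k ℚ.* p ℚ.≤ ℕ→ℚ k ℚ.* q
ι-scale k h = ℚₚ.*-monoˡ-≤-nonNeg (ℕ→ℚ k) {{ℚ.nonNegative (ι-mono {0} {k} z≤n)}} h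

unit-fraction : ∀ γ → 0ℚ < γ → ∃ λ d → (+ 1) / suc d ℚ.≤ γ
unit-fraction (mkℚ (+ zero) d c) (*<* (ℤ.+<+ ()))
unit-fraction (mkℚ (+ suc p) d c) _ = d , ℚₚ.toℚᵘ-cancel-≤ (ℚᵘₚ.≤-respˡ-≃ (ℚᵘₚ.≃-sym (ℚₚ.toℚᵘ-fromℚᵘ (mkℚᵘ (+ 1) d)))
  (*≤* (ℤₚ.*-monoʳ-≤-nonNeg (+ suc d) (ℤ.+≤+ (s≤s (z≤n {p}))))))

unit-positive : ∀ d → 0ℚ < (+ 1) / suc d
unit-positive d = ℚₚ.toℚᵘ-cancel-< (ℚᵘₚ.<-respʳ-≃ (ℚᵘₚ.≃-sym (ℚₚ.toℚᵘ-fromℚᵘ (mkℚᵘ (+ 1) d))) (ℚᵘ.*<* (ℤ.+<+ (s≤s z≤n))))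

-- ε is replaced by its bound and both fractions are cleared by the factor (N + 1)(r + 1).
degree-bound : ∀ r N n d ε → ε ℚ.≤ (+ 1) / suc N → (1ℚ - ((+ 1) / suc r) - ε) ℚ.* ℕ→ℚ n ℚ.≤ ℕ→ℚ d →
  suc N * suc r * n ≤ suc N * suc r * d + (suc N * n + suc r * n)
degree-bound r N n d ε hε h = ι-cancel (subst₂ ℚ._≤_ lhs rhs (ι-scale (suc N * suc r) bound))
  where
  open Data.Rational.Solver.+-*-Solver renaming (solve to solveℚ)
  a b x y : ℚ
  a = (+ 1) / suc r
  b = (+ 1) / suc N
  x = ℕ→ℚ (suc N)
  y = ℕ→ℚ (suc r)
  bound : ℕ→ℚ n ℚ.≤ ℕ→ℚ d ℚ.+ (a ℚ.+ b) ℚ.* ℕ→ℚ n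
  bound = ℚₚ.≤-trans (ℚₚ.≤-reflexive (solveℚ 3 (λ m a e → m := (con 1ℚ :- a :- e) :* m :+ (a :+ e) :* m) refl (ℕ→ℚ n) a ε))
    (ℚₚ.+-mono-≤ h (ℚₚ.*-monoʳ-≤-nonNeg (ℕ→ℚ n) {{ℚ.nonNegative (ι-mono {0} {n} z≤n)}} (ℚₚ.+-monoʳ-≤ a hε)))
  lhs : ℕ→ℚ (suc N * suc r) ℚ.* ℕ→ℚ n ≡ ℕ→ℚ (suc N * suc r * n)
  lhs = sym (ι-* (suc N * suc r) n)
  rhs : ℕ→ℚ (suc N * suc r) ℚ.* (ℕ→ℚ d ℚ.+ (a ℚ.+ b) ℚ.* ℕ→ℚ n) ≡ ℕ→ℚ (suc N * suc r * d + (suc N * n + suc r * n))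
  rhs = trans (cong (ℚ._* (ℕ→ℚ d ℚ.+ (a ℚ.+ b) ℚ.* ℕ→ℚ n)) (ι-* (suc N) (suc r)))
    (trans (solveℚ 6 (λ x y d a b m → x :* y :* (d :+ (a :+ b) :* m) := x :* y :* d :+ (y :* a :* (x :* m) :+ x :* b :* (y :* m))) refl x y (ℕ→ℚ d) a b (ℕ→ℚ n))
    (trans (cong₂ (λ p q → x ℚ.* y ℚ.* ℕ→ℚ d ℚ.+ (p ℚ.* (x ℚ.* ℕ→ℚ n) ℚ.+ q ℚ.* (y ℚ.* ℕ→ℚ n))) (ι-inverse r) (ι-inverse N))
    (trans (cong₂ (λ p q → x ℚ.* y ℚ.* ℕ→ℚ d ℚ.+ (p ℚ.+ q)) (ℚₚ.*-identityˡ (x ℚ.* ℕ→ℚ n)) (ℚₚ.*-identityˡ (y ℚ.* ℕ→ℚ n)))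
    (sym (trans (ι-+ (suc N * suc r * d) _) (cong₂ ℚ._+_ (trans (ι-* (suc N * suc r) d) (cong (ℚ._* ℕ→ℚ d) (ι-* (suc N) (suc r))))
      (trans (ι-+ (suc N * n) (suc r * n)) (cong₂ ℚ._+_ (ι-* (suc N) n) (ι-* (suc r) n)))))))))

dense : ∀ g γ x m → (+ 1) / suc g ℚ.≤ γ → ¬ (ℕ→ℚ x ℚ.≤ γ ℚ.* ℕ→ℚ m) → suc m ≤ suc g * x
dense g γ x m hγ not-sparse = ≰⇒> (λ le → not-sparse (ℚₚ.≤-trans (ℚₚ.≤-reflexive (sym eq))
  (ℚₚ.≤-trans (ℚₚ.*-monoˡ-≤-nonNeg u {{ℚ.nonNegative (ℚₚ.<⇒≤ (unit-positive g))}} (ι-mono le))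
    (ℚₚ.*-monoʳ-≤-nonNeg (ℕ→ℚ m) {{ℚ.nonNegative (ι-mono {0} {m} z≤n)}} hγ))))
  where
  u : ℚ
  u = (+ 1) / suc g
  eq : u ℚ.* ℕ→ℚ (suc g * x) ≡ ℕ→ℚ x
  eq = trans (cong (u ℚ.*_) (ι-* (suc g) x)) (trans (sym (ℚₚ.*-assoc u (ℕ→ℚ (suc g)) (ℕ→ℚ x)))
    (trans (cong (ℚ._* ℕ→ℚ x) (trans (ℚₚ.*-comm u (ℕ→ℚ (suc g))) (ι-inverse g))) (ℚₚ.*-identityˡ (ℕ→ℚ x))))

-- From digraphs and tournaments to labelled copies

bigraph : ∀ {n} → Digraph n → BiGraph n
bigraph G = record
  { E = λ { true u v → adj G u v ; false u v → adj G v u }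
  ; E-sym = λ { true u v → refl ; false u v → refl }
  ; E-irr = λ { true v → noLoops G v ; false v → noLoops G v } }

tournament-anti : ∀ {r} (T : Tournament r) → Anti (adj (digraph T))
tournament-anti T i j i≢j with oneEdge T i j i≢j
... | inj₁ (p , q) rewrite p = q
... | inj₂ (p , q) rewrite p = q

tournament-shape : ∀ k (T : Tournament (3 + k)) → ¬ IsoToC3 (digraph T) → Shape k (adj (digraph T))
tournament-shape zero T ¬C3 with cyclic-or-source (digraph T) (tournament-anti T)
... | inj₁ iso = ⊥-elim (¬C3 iso)
... | inj₂ s = source s
tournament-shape (suc k) T _ with classify k (adj (digraph T)) (tournament-anti T)
... | inj₁ s = source s
... | inj₂ (inj₁ s) = sink s
... | inj₂ (inj₂ s) = twins s

copy-isCopy : ∀ {r n} (T : Tournament r) (G : Digraph n) vs → Copy (bigraph G) (adj (digraph T)) vs → IsCopy (digraph T) G (lookup vs)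
copy-isCopy T G vs c = inj , hom
  where
  inj : Injective _≡_ _≡_ (lookup vs)
  inj {i} {j} eq with i Fin.≟ j
  ... | yes p = p
  ... | no i≢j = ⊥-elim (true≢false (c i j i≢j) (trans (cong (E (bigraph G) (adj (digraph T) i j) (lookup vs i)) (sym eq))
                   (E-irr (bigraph G) (adj (digraph T) i j) (lookup vs i))))
  hom : ∀ i j → adj (digraph T) i j ≡ true → adj G (lookup vs i) (lookup vs j) ≡ true
  hom i j e with i Fin.≟ j
  ... | yes refl = ⊥-elim (true≢false e (noLoops (digraph T) i))
  ... | no i≢j = subst (λ b → E (bigraph G) b (lookup vs i) (lookup vs j) ≡ true) e (c i j i≢j)

sum-two : ∀ n (f : Fin n → ℕ) i j → i ≢ j → f i + f j ≤ sumFin n f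
sum-two (suc n) f zero zero i≢j = ⊥-elim (i≢j refl)
sum-two (suc n) f zero (suc j) i≢j = +-monoʳ-≤ (f zero) (sum-term n (λ i → f (suc i)) j)
sum-two (suc n) f (suc i) zero i≢j = ≤-trans (≤-reflexive (+-comm (f (suc i)) (f zero))) (+-monoʳ-≤ (f zero) (sum-term n (λ i → f (suc i)) i))
sum-two (suc n) f (suc i) (suc j) i≢j = ≤-trans (sum-two n (λ i → f (suc i)) i j (λ { refl → i≢j refl })) (m≤n+m _ (f zero))

occs-sum : ∀ {n r} (L : List (Vec (Fin n) r)) v → occs L v ≡ sumFin (length L) (λ c → occ (List.lookup L c) v)
occs-sum [] v = refl
occs-sum (x ∷ L) v = cong (λ s → occ x v + s) (occs-sum L v)

-- Total multiplicity one is both halves of the bijection: two copies through one vertex would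
-- contribute 2, and a missed vertex 0.
perfect-packing : ∀ {r n} (T : Tournament r) (G : Digraph n) → Packable (bigraph G) (adj (digraph T)) (λ _ → 1) → PerfectPacking (digraph T) G
perfect-packing {r} {n} T G (L , cs , os) = length L , (λ c → lookup (List.lookup L c)) ,
    (λ c → copy-isCopy T G (List.lookup L c) (All.lookup cs (∈-lookup c))) , (λ {x} {y} → injective x y) , surjective
  where
  once : ∀ v → sumFin (length L) (λ c → occ (List.lookup L c) v) ≡ 1
  once v = trans (sym (occs-sum L v)) (os v)
  appears : ∀ c i → 1 ≤ occ (List.lookup L c) (lookup (List.lookup L c) i)
  appears c i = ≤-trans (≤-reflexive (sym (δ-refl (lookup (List.lookup L c) i)))) (≤-trans
    (sum-term r (λ j → δ (lookup (List.lookup L c) j) (lookup (List.lookup L c) i)) i) (≤-reflexive (sym (occ-sum (List.lookup L c) _))))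
  injective : ∀ (x y : Fin (length L) × Fin r) → lookup (List.lookup L (proj₁ x)) (proj₂ x) ≡ lookup (List.lookup L (proj₁ y)) (proj₂ y) → x ≡ y
  injective (c , i) (d , j) eq with c Fin.≟ d
  ... | yes refl = cong (c ,_) (proj₁ (copy-isCopy T G (List.lookup L c) (All.lookup cs (∈-lookup c))) eq)
  ... | no c≢d = ⊥-elim (1+n≰n (≤-trans (appears c i ⊕ subst (λ v → 1 ≤ occ (List.lookup L d) v) (sym eq) (appears d j))
          (≤-trans (sum-two (length L) (λ c → occ (List.lookup L c) _) c d c≢d) (≤-reflexive (once _)))))
  surjective : ∀ v → ∃ λ x → ∀ {z} → z ≡ x → lookup (List.lookup L (proj₁ z)) (proj₂ z) ≡ v
  surjective v with sum-pos (length L) (λ c → occ (List.lookup L c) v) (≤-reflexive (sym (once v)))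
  ... | c , p with occ-member (List.lookup L c) v p
  ... | i , e = (c , i) , λ { refl → e }

nonsparse : ∀ {n} (G : Digraph n) r g γ → (+ 1) / suc g ℚ.≤ γ →
  ((S : Subset n) → n ≤ size S * r → ¬ GammaIndependent G γ S) → NonSparse (bigraph G) r (suc g)
nonsparse {n} G r g γ hγ ns true S h = dense g γ (edgesIn G S) (n * n) hγ (ns S (≤-trans h (≤-reflexive (*-comm r (size S)))))
nonsparse {n} G r g γ hγ ns false S h = subst (λ z → suc (n * n) ≤ suc g * z)
  (trans (sum-swap n n _) (sum-cong n (λ u → sum-cong n (λ v → cong b2n (pt (S u) (S v) (adj G v u))))))
  (nonsparse G r g γ hγ ns true S h)
  where
  pt : ∀ a b e → b ∧ (a ∧ e) ≡ a ∧ (b ∧ e)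
  pt true true e = refl
  pt true false e = refl
  pt false true e = refl
  pt false false e = refl

-- For the excess x of (r + 1) a over n, the degree inequality gives Ec x ≤ n < Ec (e + 1), hence x
-- ≤ e.
degree-excess : ∀ r Ec n e a d → n ≡ d + a → suc n ≤ Ec * e + Ec → suc (suc r * Ec) * suc r * n ≤ suc (suc r * Ec) * suc r * d + (suc (suc r * Ec) * n + suc r * n) →
  suc r * a ≤ n + e
degree-excess r Ec n e a d n-eq h1 h2 = ≤-trans (m≤n+m∸n (suc r * a) n) (+-monoʳ-≤ n
    (≤-pred (*-cancelˡ-< Ec (suc r * a ∸ n) (suc e) (≤-trans (s≤s small) (≤-trans h1 (≤-reflexive (idt Ec e)))))))
  where
  N = suc (suc r * Ec)
  x = suc r * a ∸ n
  idt : ∀ Ec e → Ec * e + Ec ≡ Ec * suc e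
  idt = solve-∀
  A-bound : N * (suc r * a) ≤ N * n + suc r * n
  A-bound = +-cancelˡ-≤ (N * suc r * d) _ _ (≤-trans (≤-reflexive (trans (idt' N (suc r) d a) (cong (N * suc r *_) (sym n-eq)))) h2)
    where
    idt' : ∀ N r d a → N * r * d + N * (r * a) ≡ N * r * (d + a)
    idt' = solve-∀
  Nx : N * x ≤ suc r * n
  Nx = ≤-trans (≤-reflexive (*-distribˡ-∸ N (suc r * a) n)) (≤-trans (∸-monoˡ-≤ (N * n) A-bound) (≤-reflexive (m+n∸m≡n (N * n) (suc r * n))))
  small : Ec * x ≤ n
  small = cancel-mul r _ _ (≤-trans (≤-reflexive (sym (*-assoc (suc r) Ec x))) (≤-trans (*-monoˡ-≤ x (n≤1+n (suc r * Ec))) Nx))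

theorem10p1 : (r : ℕ) → .{{_ : NonZero r}} → 3 ≤ r →
    Σ ℚ λ γ₀ → 0ℚ < γ₀ ×
    ((γ : ℚ) → 0ℚ < γ → γ Data.Rational.≤ γ₀ →
    Σ ℚ λ ε₀ → 0ℚ < ε₀ ×
    ((ε : ℚ) → 0ℚ < ε → ε Data.Rational.≤ ε₀ →
    Σ ℕ λ n₀ → (n : ℕ) → n₀ ≤ n → r ∣ n →
    (T : Tournament r) → ¬ IsoToC3 (digraph T) →
    (G : Digraph n) →
    MinSemiDegAtLeast G ((1ℚ - ((+ 1) / r) - ε) Data.Rational.* ℕ→ℚ n) →
    ((S : Subset n) → n Data.Nat.≤ size S * r → ¬ GammaIndependent G γ S) →
    PerfectPacking (digraph T) G))
theorem10p1 (suc (suc (suc k))) (s≤s (s≤s (s≤s z≤n))) = 1ℚ , unit-positive 0 , λ γ 0<γ _ →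
  let (g , hγ) = unit-fraction γ 0<γ
      (Ec , n₀ , 1≤Ec , pack) = packing-constants k (suc g) (s≤s z≤n)
  -- This ε₀ makes r ε n less than n / Ec, so the integer part e of n / Ec bounds the degree error.
  -- Asking for `suc n₀` excludes n = 0.
  in (+ 1) / suc ((3 + k) * Ec) , unit-positive ((3 + k) * Ec) , λ ε _ hε → suc n₀ , λ
  { (suc n') large r∣n T ¬C3 G deg ns →
    let (e , e-low , e-high) = floor (suc n') Ec 1≤Ec
        excess : ∀ d a → suc n' ≡ d + a → (1ℚ - ((+ 1) / (3 + k)) - ε) ℚ.* ℕ→ℚ (suc n') ℚ.≤ ℕ→ℚ d → (3 + k) * a ≤ suc n' + e
        excess d a eq h = degree-excess (2 + k) Ec (suc n') e a d eq e-high (degree-bound (2 + k) ((3 + k) * Ec) (suc n') d ε hε h)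
    in perfect-packing T G (pack n' (≤-trans (n≤1+n n₀) large) (bigraph G) e (adj (digraph T)) (tournament-anti T)
         (tournament-shape k T ¬C3) r∣n e-low
         (λ { true v → excess (outdeg G v) (size (A (bigraph G) true v)) (size-∁ (λ u → adj G v u)) (proj₁ (deg v))
            ; false v → excess (indeg G v) (size (A (bigraph G) false v)) (size-∁ (λ u → adj G u v)) (proj₂ (deg v)) })
         (nonsparse G (3 + k) g γ hγ ns)) }
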